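{- Let $m,n\ge 0$ be integers and let $\Pi$ be a polygonal embedding of size $(m,n)$ with signature $\sigma(\Pi)$. Then $\Pi$ is a p-minor of $\mathbb{U}_{\sigma(\Pi),m+2n}$.
   Context: A polygonal embedding $\Pi$ is a simple connected plane graph whose outer face boundary is a cycle $O$, together with a sequence of distinct vertices $c_0,\dots,c_{s-1}$ ($s\ge 2$) on $O$, called corners, appearing in clockwise order along $O$, each of degree exactly two in $\Pi$ (the sequence is the border), and a signature $\sigma(\Pi)$: a word of $s$ symbols, each of the form $a$ or $\bar a$ for a letter $a$, in which every letter occurs exactly twice. The $i$-th side of $\Pi$ is the subpath of $O$ going clockwise from $c_i$ to $c_{i+1 \bmod s}$, and it is associated with the $i$-th symbol of $\sigma(\Pi)$. Two sides whose symbols share the same letter are twin sides, and they must contain the same number of vertices. Each side is oriented: clockwise (from $c_i$ to $c_{i+1}$) if its symbol is positive ($a$), anticlockwise if its symbol is negative ($\bar a$). The sewing $\mathrm{sewing}(\Pi)$ is the graph obtained from $\Pi$ by identifying every pair of twin sides vertex by vertex so that their orientations agree (identified vertices/edges become single vertices/edges). Vertices of $\Pi$ not on $O$ are internal. $\Pi$ has size $(m,n)$ if every side has at most $m$ vertices other than its two corners and $\Pi$ has at most $n$ internal vertices. A polygonal embedding $\Pi$ is a p-minor of a polygonal embedding $\Pi'$ if $\sigma(\Pi)=\sigma(\Pi')$ and $\mathrm{sewing}(\Pi)$ is a minor of $\mathrm{sewing}(\Pi')$. For a signature $\sigma$ with $|\sigma|$ symbols and an integer $m\ge 1$, the polygonal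 embedding $\mathbb{U}_{\sigma,m}$ is defined as follows. Let $N=|\sigma|m$. Start from the half-grid with vertices $(i,j)$, $0\le j\le i<N$, where $(i,j)$ and $(i',j')$ are adjacent iff $|i-i'|+|j-j'|=1$. Add edges joining $(i,i)$ to $(i-1,i-1)$ for all $i$ (indices modulo $N$), so that the diagonal vertices form a cycle, which is the outer face cycle. Then for each $i\in\{0,\dots,|\sigma|-1\}$, subdivide the edge between $(im,im)$ and $(im-1,im-1)$ (modulo $N$) by a new vertex $c_i$. The border is $(c_0,\dots,c_{|\sigma|-1})$, the $i$-th side is the path from $c_i$ to $c_{i+1 \bmod |\sigma|}$ along the outer cycle, and the signature is $\sigma$. -}

module Defs where

open import Data.Nat using (ℕ; zero; suc; _+_; _*_; _∸_; _≤_; _<_)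
open import Data.Nat.Properties using (≤-refl)
open import Data.Nat.DivMod using (_%_; m%n<n)
open import Data.Fin using (Fin; toℕ; fromℕ<; inject₁; fromℕ; combine)
  renaming (zero to fzero; suc to fsuc)
open import Data.Bool using (Bool; true; false; if_then_else_)
open import Data.List using (List; []; _∷_; _++_; map; length; lookup; reverse; zip; drop; upTo; allFin)
open import Data.Nat.ListAction using (sum)
open import Data.List.Membership.Propositional using (_∈_)
open import Data.Product using (Σ; ∃; _×_; _,_; proj₁; proj₂)
open import Data.Sum using (_⊎_)
open import Data.Empty using (⊥)
open import Relation.Nullary using (¬_)
open import Relation.Binary.PropositionalEquality using (_≡_; _≢_)
open import Relation.Binary.Construct.Closure.ReflexiveTransitive using (Star)
open import Relation.Binary.Construct.Closure.Equivalence using (EqClosure)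

next : ∀ {n} → Fin n → Fin n
next {suc k} i = fromℕ< (m%n<n (suc (toℕ i)) (suc k))

iter : ∀ {A : Set} → ℕ → (A → A) → A → A
iter zero    f x = x
iter (suc k) f x = f (iter k f x)

range : ℕ → ℕ → List ℕ
range a b = map (a +_) (upTo (suc (b ∸ a)))

-- Signatures: a symbol is (letter , sign); sign true = positive (a),
-- sign false = negative (ā).  Letters are natural numbers.

Symbol : Set
Symbol = ℕ × Bool

letter : (σ : List Symbol) → Fin (length σ) → ℕ
letter σ i = proj₁ (lookup σ i)

positive : (σ : List Symbol) → Fin (length σ) → Bool
positive σ i = proj₂ (lookup σ i)

record WFSig (σ : List Symbol) : Set where
  field
    len≥2 : 2 ≤ length σ
    twice : ∀ i → Σ (Fin (length σ)) λ j →
              j ≢ i × letter σ j ≡ letter σ i ×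
              (∀ k → letter σ k ≡ letter σ i → k ≡ i ⊎ k ≡ j)

-- Simple graphs with a rotation system (combinatorial embedding).
-- nbr u : Fin (deg u) → Fin V lists the neighbours of u in CLOCKWISE order.

record RotSystem : Set where
  field
    V        : ℕ
    deg      : Fin V → ℕ
    nbr      : (u : Fin V) → Fin (deg u) → Fin V
    back     : (u : Fin V) (i : Fin (deg u)) → Fin (deg (nbr u i))
    back-nbr : ∀ u i → nbr (nbr u i) (back u i) ≡ u
    nbr-inj  : ∀ u i j → nbr u i ≡ nbr u j → i ≡ j
    loopless : ∀ u i → nbr u i ≢ u

  Adj : Fin V → Fin V → Set
  Adj u v = Σ (Fin (deg u)) λ i → nbr u i ≡ v

  Dart : Set
  Dart = Σ (Fin V) λ u → Fin (deg u)

  tail head : Dart → Fin V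
  tail d = proj₁ d
  head (u , i) = nbr u i

  -- face permutation: arriving at v along u→v, leave along the edge that
  -- follows vu clockwise at v.  Faces are then traced with the face on the
  -- left; in particular the outer face boundary is traced clockwise.
  φ : Dart → Dart
  φ (u , i) = nbr u i , next (back u i)

  sumDeg : ℕ
  sumDeg = sum (map deg (allFin V))

  record Faces (F : ℕ) : Set where
    field
      face  : Dart → Fin F
      surj  : ∀ f → Σ Dart λ d → face d ≡ f
      inv   : ∀ d → face (φ d) ≡ face d
      orbit : ∀ d d' → face d ≡ face d' → Σ ℕ λ k → iter k φ d ≡ d'

-- connected plane graph: connected rotation system of genus 0 (Euler V - E + F = 2)
record PlaneGraph : Set where
  field
    rs        : RotSystem
  open RotSystem rs public
  field
    connected : ∀ u v → Star Adj u v
    F         : ℕ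
    faces     : Faces F
    euler     : 2 * V + 2 * F ≡ sumDeg + 4      -- (2E = sumDeg)

record PolyEmb : Set where
  field
    G : PlaneGraph
  open PlaneGraph G public
  field
    -- outer face boundary: a cycle O of length L, listed clockwise,
    -- given periodically O : ℕ → Fin V, starting at the corner c₀
    L      : ℕ
    L≥3    : 3 ≤ L
    O      : ℕ → Fin V
    O-per  : ∀ t → O (L + t) ≡ O t
    O-inj  : ∀ t u → t < L → u < L → O t ≡ O u → t ≡ u
    od     : ℕ → Dart
    od-tl  : ∀ t → tail (od t) ≡ O t
    od-hd  : ∀ t → head (od t) ≡ O (suc t)
    od-φ   : ∀ t → φ (od t) ≡ od (suc t)
    σ      : List Symbol
    σ-ok   : WFSig σ
    -- corner positions along O : c_i = O (q i), q 0 = 0, q s = L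
    q      : Fin (suc (length σ)) → ℕ
    q-0    : q fzero ≡ 0
    q-s    : q (fromℕ (length σ)) ≡ L
    q-mono : ∀ i → q (inject₁ i) < q (fsuc i)
    corner-deg : ∀ i → deg (O (q (inject₁ i))) ≡ 2
    twin-len : ∀ i j → letter σ i ≡ letter σ j →
                 q (fsuc i) ∸ q (inject₁ i) ≡ q (fsuc j) ∸ q (inject₁ j)

  side : Fin (length σ) → List (Fin V)
  side i = map O (range (q (inject₁ i)) (q (fsuc i)))

-- size (m , n): each side has ≤ m non-corner vertices, ≤ n internal vertices
HasSize : PolyEmb → ℕ → ℕ → Set
HasSize Π m n = (∀ i → q (fsuc i) ≤ q (inject₁ i) + suc m) × V ≤ L + n
  where open PolyEmb Π

-- Bordered graphs (what sewing needs): a graph, a signature and the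
-- vertex sequence of each side (clockwise, corner to corner).

record Bordered : Set₁ where
  field
    Vtx  : Set
    Adj  : Vtx → Vtx → Set
    σ    : List Symbol
    side : Fin (length σ) → List Vtx

  oside : Fin (length σ) → List Vtx
  oside i = if positive σ i then side i else reverse (side i)

  Glue : Vtx → Vtx → Set
  Glue a b = Σ (Fin (length σ)) λ i → Σ (Fin (length σ)) λ j →
               letter σ i ≡ letter σ j × (a , b) ∈ zip (oside i) (oside j)

toBordered : PolyEmb → Bordered
toBordered Π = record { Vtx = Fin V ; Adj = Adj ; σ = σ ; side = side }
  where open PolyEmb Π

record QGraph : Set₁ where
  field
    Vtx : Set
    _~_ : Vtx → Vtx → Set      -- identification (an equivalence relation)
    Adj : Vtx → Vtx → Set

  QAdj : Vtx → Vtx → Set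
  QAdj u v = Σ Vtx λ u' → Σ Vtx λ v' → u ~ u' × v ~ v' × Adj u' v'

sewing : Bordered → QGraph
sewing B = record { Vtx = Vtx ; _~_ = EqClosure Glue ; Adj = Adj }
  where open Bordered B

-- H is a minor of G: a minor model (branch sets of classes of G for the
-- classes of H: nonempty, disjoint, connected, realising every edge of H)
record Minor (H G : QGraph) : Set₁ where
  private
    module H = QGraph H
    module G = QGraph G
  field
    β        : H.Vtx → G.Vtx → Set
    β-resp   : ∀ {x y a} → H._~_ x y → β x a → β y a
    β-sat    : ∀ {x a b} → G._~_ a b → β x a → β x b
    nonempty : ∀ x → Σ G.Vtx λ a → β x a
    disjoint : ∀ {x y a} → β x a → β y a → H._~_ x y
    conn     : ∀ {x a b} → β x a → β x b →
                 Star (λ u v → β x u × β x v × (G._~_ u v ⊎ G.QAdj u v)) a b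
    edges    : ∀ {x y} → H.QAdj x y → ¬ H._~_ x y →
                 Σ G.Vtx λ a → Σ G.Vtx λ b → β x a × β y b × G.QAdj a b

PMinor : Bordered → Bordered → Set₁
PMinor B B' = Bordered.σ B ≡ Bordered.σ B' × Minor (sewing B) (sewing B')

data UV (s m : ℕ) : Set where
  gv : (i j : Fin (s * m)) → .(toℕ j ≤ toℕ i) → UV s m
  cv : Fin s → UV s m

module _ (σ : List Symbol) (m : ℕ) where
  private
    s = length σ

  diag : Fin (s * m) → UV s m
  diag x = gv x x ≤-refl

  Uside : Fin s → List (UV s m)
  Uside k = cv k ∷ (map (λ t → diag (combine k t)) (allFin m) ++ cv (next k) ∷ [])

  GridE : UV s m → UV s m → Set
  GridE (gv i j _) (gv i' j' _) =
    (toℕ i' ≡ suc (toℕ i) × toℕ j' ≡ toℕ j) ⊎ (toℕ i' ≡ toℕ i × toℕ j' ≡ suc (toℕ j))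
  GridE _ _ = ⊥

  -- edges of the outer cycle (diagonal cycle with the corners subdivided in)
  CycE : UV s m → UV s m → Set
  CycE a b = Σ (Fin s) λ k → (a , b) ∈ zip (Uside k) (drop 1 (Uside k))

  UAdj : UV s m → UV s m → Set
  UAdj a b = GridE a b ⊎ GridE b a ⊎ CycE a b ⊎ CycE b a

  𝕌 : Bordered
  𝕌 = record { Vtx = UV s m ; Adj = UAdj ; σ = σ ; side = Uside }

{-# OPTIONS --safe #-}
module Submission where

-- Glue the inner faces of Π together along a spanning tree of the dual.  The result is a disc
-- whose boundary is a closed walk w; the edges glued along are pairwise non-crossing chords of w,
-- and by Euler's formula |w| ≤ 2|V| − L.  A walk this short that contains the border goes around
-- the border and around trees attached to it: repeatedly removing a vertex visited only once
-- ends with the border, so w arises from the border by replacing u with u v u, v a new inner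
-- vertex, at most n times.
--
-- Perform each such replacement on the side of u and, at the glued position, on its twin side,
-- which lengthens no side by more than 2n.  Twin sides of 𝕌 then get the same labels.  On the side
-- of u the new labels are ends of chords of w; on the twin side the two copies of u are
-- joined by a chord around v, so that after sewing the labels equal to a given vertex are
-- connected.  All these chords are non-crossing, hence realised in the half-grid: a chord
-- between the diagonal positions j < i follows column j and row i, which meet at (i , j).

-- The obstacle is that an inner tree makes a border vertex `u` occur several times on the walk, and
-- these copies have to be connected in the sewn half-grid without crossing the chords that carry
-- edges. A chord around `v` on the side of `u` could cross a chord leaving `v`. The twin side holds
-- only a mirror image of `v`, where no chord of the walk ends, so the connection is made there and
-- reached through the glue. For this to survive later insertions no label that belongs to the side
-- itself may get under such a chord, which is the invariant `capFree`. Corners are not grid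
-- vertices and carry no chords. Here the degree condition enters: a corner has no inner neighbour,
-- so nothing is inserted at it, and its two edges run along the outer cycle. The length bound:
-- gluing f faces leaves f - 1 chords of two darts each, so |w| + 2(f - 1) + L is at most the number
-- of darts; since F ≤ f + 1, Euler's formula gives |w| + L ≤ 2|V|. Sides of 𝕌 have exactly m + 2n
-- vertices besides their corners; those left over become copies of a corner.

open import Defs
open import Data.Nat using (ℕ; zero; suc; _+_; _*_; _∸_; _≤_; _<_; z≤n; s≤s; NonZero; >-nonZero)
open import Data.Nat.Properties
open import Data.Nat.DivMod using (_%_; _/_; m%n<n; m≡m%n+[m/n]*n; m<n⇒m%n≡m; n%n≡0; m%n%n≡m%n; %-distribˡ-+; [m+n]%n≡m%n)
open import Data.Nat.ListAction using (sum)
open import Data.Nat.Tactic.RingSolver using (solve-∀)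
open import Data.Bool using (Bool; true; false; if_then_else_)
open import Data.Fin using (Fin; toℕ; fromℕ; fromℕ<; inject₁; combine; remQuot) renaming (zero to fzero; suc to fsuc; _≟_ to _≟ᶠ_)
open import Data.Fin.Properties using (toℕ-injective; toℕ<n; toℕ-fromℕ<; toℕ-fromℕ; toℕ-inject₁; toℕ-combine; remQuot-combine; combine-remQuot; any?)
open import Data.List using (List; []; _∷_; _++_; _∷ʳ_; map; length; reverse; zip; concat; concatMap; tabulate; applyUpTo; upTo; allFin; filter; replicate; drop; initLast; _∷ʳ′_)
open import Data.List.Properties using (length-++; length-map; length-reverse; length-applyUpTo; length-tabulate; length-replicate; unfold-reverse; ++-assoc; ++-identityʳ; reverse-++; reverse-involutive; map-++; map-∘; map-id; map-replicate; map-applyUpTo; applyUpTo-∷ʳ; ∷-injective; ∷-injectiveˡ; tabulate-cong)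
open import Data.List.Membership.Propositional using (_∈_; _∉_; find; lose)
open import Data.List.Membership.Propositional.Properties using (∈-++⁺ˡ; ∈-++⁺ʳ; ∈-++⁻; ∈-∃++; ∈-allFin; ∈-map⁺; ∈-map⁻; ∈-filter⁺; ∈-filter⁻; ∈-applyUpTo⁺; ∈-applyUpTo⁻)
open import Data.List.Membership.DecPropositional using (_∈?_)
open import Data.List.Relation.Unary.Any as Any using (here; there)
open import Data.List.Relation.Unary.Any.Properties using (reverse⁻; reverse⁺)
open import Data.List.Relation.Unary.All as All using ([]; _∷_)
open import Data.List.Relation.Unary.AllPairs using ([]; _∷_)
open import Data.List.Relation.Unary.Unique.Propositional using (Unique)
open import Data.List.Relation.Unary.Unique.Propositional.Properties using (++⁺; allFin⁺; filter⁺; applyUpTo⁺₁)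
open import Data.List.Relation.Binary.Pointwise as Pointwise using (Pointwise; Pointwise-length; []; _∷_)
open import Data.List.Relation.Binary.Permutation.Propositional using (_↭_; ↭-refl; ↭-reflexive; ↭-sym; ↭-trans; ↭⇒↭ₛ)
open import Data.List.Relation.Binary.Permutation.Propositional.Properties using (∈-resp-↭; ++-commutativeMonoid; ++⁺ʳ; ↭-length; ↭-reverse)
open import Data.Product using (Σ; ∃; _×_; _,_; proj₁; proj₂)
open import Data.Product.Properties using (≡-dec)
open import Data.Sum using (_⊎_; inj₁; inj₂)
open import Data.Empty using (⊥; ⊥-elim)
open import Function using (_∘_; id)
open import Relation.Nullary using (¬_; Dec; yes; no; ¬?)
open import Relation.Nullary.Decidable using (_×-dec_; recompute)
open import Relation.Binary.Definitions using (tri<; tri≈; tri>)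
open import Relation.Binary.PropositionalEquality hiding ([_])
open import Relation.Binary.Construct.Closure.ReflexiveTransitive as Star using (Star; ε; _◅_; _◅◅_)
open import Relation.Binary.Construct.Closure.Symmetric using (fwd; bwd)
open import Relation.Binary.Construct.Closure.Equivalence as Eq using (EqClosure)
import Data.List.Relation.Binary.Permutation.Setoid.Properties as SetoidPerm
import Algebra.Solver.CommutativeMonoid as CMSolver

-- Lists with positions, non-crossing chords, counting without repetition

infix 4 _[_]=_

-- Lookup is a relation on bare natural numbers, so that positions can be shifted by insertions
-- without carrying bounds along.
data _[_]=_ {A : Set} : List A → ℕ → A → Set where
  here  : ∀ {x xs} → (x ∷ xs) [ 0 ]= x
  there : ∀ {x y xs n} → xs [ n ]= y → (x ∷ xs) [ suc n ]= y

module _ {A : Set} where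

  at-func : ∀ {xs : List A} {n x y} → xs [ n ]= x → xs [ n ]= y → x ≡ y
  at-func here      here      = refl
  at-func (there p) (there q) = at-func p q

  at-< : ∀ {xs : List A} {n x} → xs [ n ]= x → n < length xs
  at-< here      = s≤s z≤n
  at-< (there p) = s≤s (at-< p)

  at-∈ : ∀ {xs : List A} {n x} → xs [ n ]= x → x ∈ xs
  at-∈ here      = here refl
  at-∈ (there p) = there (at-∈ p)

  ∈-at : ∀ {xs : List A} {x} → x ∈ xs → ∃ λ n → xs [ n ]= x
  ∈-at (here refl) = 0 , here
  ∈-at (there p)   = let n , q = ∈-at p in suc n , there q

  at-exists : ∀ (xs : List A) {n} → n < length xs → ∃ λ x → xs [ n ]= x
  at-exists (x ∷ xs) {zero}  _       = x , here
  at-exists (x ∷ xs) {suc n} (s≤s p) = let y , q = at-exists xs p in y , there q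

  at-++ˡ : ∀ {xs ys : List A} {n x} → xs [ n ]= x → (xs ++ ys) [ n ]= x
  at-++ˡ here      = here
  at-++ˡ (there p) = there (at-++ˡ p)

  at-++ʳ : ∀ (xs : List A) {ys n y} → ys [ n ]= y → (xs ++ ys) [ length xs + n ]= y
  at-++ʳ []       p = p
  at-++ʳ (x ∷ xs) p = there (at-++ʳ xs p)

  at-++⁻ : ∀ (xs : List A) {ys n y} → (xs ++ ys) [ n ]= y →
           xs [ n ]= y ⊎ ∃ λ m → n ≡ length xs + m × ys [ m ]= y
  at-++⁻ []       p         = inj₂ (_ , refl , p)
  at-++⁻ (x ∷ xs) here      = inj₁ here
  at-++⁻ (x ∷ xs) (there p) with at-++⁻ xs p
  ... | inj₁ q              = inj₁ (there q)
  ... | inj₂ (m , refl , q) = inj₂ (m , refl , q)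

  at-mid : ∀ (xs : List A) {ys y} → (xs ++ y ∷ ys) [ length xs ]= y
  at-mid []       = here
  at-mid (x ∷ xs) = there (at-mid xs)

  at-reverse : ∀ {xs : List A} {n x} → xs [ n ]= x → reverse xs [ length xs ∸ suc n ]= x
  at-reverse {y ∷ xs} here rewrite unfold-reverse y xs =
    subst (λ k → (reverse xs ++ y ∷ []) [ k ]= y) (length-reverse xs) (at-mid (reverse xs))
  at-reverse {y ∷ xs} (there p) rewrite unfold-reverse y xs = at-++ˡ (at-reverse p)

  at-unique : ∀ {xs : List A} {m n x} → Unique xs → xs [ m ]= x → xs [ n ]= x → m ≡ n
  at-unique u        here      here      = refl
  at-unique (n ∷ u)  here      (there q) = ⊥-elim (All.lookup n (at-∈ q) refl)
  at-unique (n ∷ u)  (there p) here      = ⊥-elim (All.lookup n (at-∈ p) refl)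
  at-unique (_ ∷ u)  (there p) (there q) = cong suc (at-unique u p q)

  at-zip : ∀ {B : Set} {xs : List A} {ys : List B} {n x y} →
           xs [ n ]= x → ys [ n ]= y → (x , y) ∈ zip xs ys
  at-zip here      here      = here refl
  at-zip (there p) (there q) = there (at-zip p q)

  zip-at : ∀ {B : Set} (xs : List A) (ys : List B) {x y} →
           (x , y) ∈ zip xs ys → ∃ λ n → xs [ n ]= x × ys [ n ]= y
  zip-at (x ∷ xs) (y ∷ ys) (here refl) = 0 , here , here
  zip-at (x ∷ xs) (y ∷ ys) (there p)   =
    let n , q , r = zip-at xs ys p in suc n , there q , there r

at-map : ∀ {A B : Set} (f : A → B) {xs n x} → xs [ n ]= x → map f xs [ n ]= f x
at-map f here      = here
at-map f (there p) = there (at-map f p)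

at-map⁻ : ∀ {A B : Set} (f : A → B) (xs : List A) {n y} → map f xs [ n ]= y →
          ∃ λ x → xs [ n ]= x × y ≡ f x
at-map⁻ f (x ∷ xs) here      = x , here , refl
at-map⁻ f (x ∷ xs) (there p) = let z , q , e = at-map⁻ f xs p in z , there q , e

-- bump a k moves the positions ≥ a up by k, making room for k new entries.
bump : ℕ → ℕ → ℕ → ℕ
bump zero    k x       = k + x
bump (suc a) k zero    = 0
bump (suc a) k (suc x) = suc (bump a k x)

bump-mono : ∀ a k {x y} → x < y → bump a k x < bump a k y
bump-mono zero    k p = +-monoʳ-< k p
bump-mono (suc a) k {zero}  {suc y} p       = s≤s z≤n
bump-mono (suc a) k {suc x} {suc y} (s≤s p) = s≤s (bump-mono a k p)

bump-cancel : ∀ a k {x y} → bump a k x < bump a k y → x < y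
bump-cancel zero    k p = +-cancelˡ-< k _ _ p
bump-cancel (suc a) k {zero}  {suc y} p       = s≤s z≤n
bump-cancel (suc a) k {suc x} {suc y} (s≤s p) = s≤s (bump-cancel a k p)

-- Needed whenever a chord is drawn around newly inserted entries: no shifted end falls strictly
-- inside it, so it crosses nothing old.
bump-gap : ∀ a k x → bump a k x < a ⊎ a + k ≤ bump a k x
bump-gap zero    k x       = inj₂ (m≤m+n k x)
bump-gap (suc a) k zero    = inj₁ (s≤s z≤n)
bump-gap (suc a) k (suc x) with bump-gap a k x
... | inj₁ p = inj₁ (s≤s p)
... | inj₂ p = inj₂ (s≤s p)

bump-self : ∀ a k → bump a k a ≡ a + k
bump-self zero    k = +-identityʳ k
bump-self (suc a) k = cong suc (bump-self a k)

module _ {A : Set} where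

  at-bump : ∀ (α ι : List A) {β n y} → (α ++ β) [ n ]= y →
            (α ++ ι ++ β) [ bump (length α) (length ι) n ]= y
  at-bump []      ι p         = at-++ʳ ι p
  at-bump (x ∷ α) ι here      = here
  at-bump (x ∷ α) ι (there p) = there (at-bump α ι p)

-- All inequalities are strict, so chords may share ends. The mirrored pattern is covered by
-- exchanging the two members.
NonCrossing : List (ℕ × ℕ) → Set
NonCrossing C = ∀ {a b c d} → (a , b) ∈ C → (c , d) ∈ C → a < c → c < b → b < d → ⊥

module _ {A : Set} where

  Unique-resp-↭ : ∀ {xs ys : List A} → xs ↭ ys → Unique xs → Unique ys
  Unique-resp-↭ p = SetoidPerm.Unique-resp-↭ (setoid A) (↭⇒↭ₛ p)

  ∈-delete : ∀ (α : List A) {β x y} → y ∈ α ++ x ∷ β → y ≢ x → y ∈ α ++ β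
  ∈-delete []      (here e)  n = ⊥-elim (n e)
  ∈-delete []      (there p) n = p
  ∈-delete (z ∷ α) (here e)  n = here e
  ∈-delete (z ∷ α) (there p) n = there (∈-delete α p n)

  ∈-undelete : ∀ (α : List A) {β x y} → y ∈ α ++ β → y ∈ α ++ x ∷ β
  ∈-undelete []      p         = there p
  ∈-undelete (z ∷ α) (here e)  = here e
  ∈-undelete (z ∷ α) (there p) = there (∈-undelete α p)

  length-delete : ∀ (α : List A) {β x} → length (α ++ x ∷ β) ≡ suc (length (α ++ β))
  length-delete []      = refl
  length-delete (z ∷ α) = cong suc (length-delete α)

  unique-delete : ∀ (α : List A) {β x} → Unique (α ++ x ∷ β) → Unique (α ++ β) × x ∉ α ++ β
  unique-delete []      (n ∷ u) = u , λ p → All.lookup n p refl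
  unique-delete (z ∷ α) (n ∷ u) with unique-delete α u
  ... | u′ , x∉ = All.tabulate (λ p e → All.lookup n (∈-undelete α p) e) ∷ u′ ,
                  λ { (here refl) → All.lookup n (∈-++⁺ʳ α (here refl)) refl ; (there p) → x∉ p }

  -- The pigeonhole principle. The counts of darts, faces and vertices below go through it, as
  -- inequalities suffice there.
  unique-length : ∀ {xs ys : List A} → Unique xs → (∀ {x} → x ∈ xs → x ∈ ys) → length xs ≤ length ys
  unique-length {[]}     _       _ = z≤n
  unique-length {x ∷ xs} (n ∷ u) f with ∈-∃++ (f (here refl))
  ... | α , β , refl = subst (suc (length xs) ≤_) (sym (length-delete α))
    (s≤s (unique-length u (λ p → ∈-delete α (f (there p)) (λ e → All.lookup n p (sym e)))))

minimal : ∀ {P : ℕ → Set} → (∀ k → Dec (P k)) → ∀ n → P n →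
          ∃ λ m → P m × (∀ {k} → k < m → ¬ P k)
minimal P? n pn with P? 0
... | yes p0 = 0 , p0 , λ ()
minimal P? zero    pn | no ¬p0 = ⊥-elim (¬p0 pn)
minimal P? (suc n) pn | no ¬p0 with minimal (λ k → P? (suc k)) n pn
... | m , pm , least = suc m , pm , λ { {zero} _ → ¬p0 ; {suc k} (s≤s k<m) → least k<m }

-- The cyclic successor

next-cases : ∀ {k} (i : Fin (suc k)) →
             (suc (toℕ i) < suc k × toℕ (next i) ≡ suc (toℕ i)) ⊎ (toℕ i ≡ k × toℕ (next i) ≡ 0)
next-cases {k} i with suc (toℕ i) <? suc k
... | yes p = inj₁ (p , trans (toℕ-fromℕ< _) (m<n⇒m%n≡m p))
... | no ¬p = inj₂ (e , trans (toℕ-fromℕ< _) (trans (cong (λ x → suc x % suc k) e) (n%n≡0 (suc k))))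
  where e : toℕ i ≡ k
        e = ≤-antisym (≤-pred (toℕ<n i)) (≤-pred (≮⇒≥ ¬p))

next-injective : ∀ {n} {i j : Fin n} → next i ≡ next j → i ≡ j
next-injective {suc k} {i} {j} e with next-cases i | next-cases j
... | inj₁ (_ , p) | inj₁ (_ , q) = toℕ-injective (suc-injective (trans (sym p) (trans (cong toℕ e) q)))
... | inj₁ (_ , p) | inj₂ (_ , q) = ⊥-elim (0≢1+n (trans (sym q) (trans (cong toℕ (sym e)) p)))
... | inj₂ (_ , p) | inj₁ (_ , q) = ⊥-elim (0≢1+n (trans (sym p) (trans (cong toℕ e) q)))
... | inj₂ (p , _) | inj₂ (q , _) = toℕ-injective (trans p (sym q))

toℕ-iter-next : ∀ {k} c (o : Fin (suc k)) → toℕ (iter c next o) ≡ (toℕ o + c) % suc k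
toℕ-iter-next {k} zero o = sym (trans (cong (_% suc k) (+-identityʳ (toℕ o))) (m<n⇒m%n≡m (toℕ<n o)))
toℕ-iter-next {k} (suc c) o = begin
  toℕ (next (iter c next o))                ≡⟨ toℕ-fromℕ< _ ⟩
  (1 + toℕ (iter c next o)) % suc k         ≡⟨ cong (λ x → (1 + x) % suc k) (toℕ-iter-next c o) ⟩
  (1 + x % suc k) % suc k                   ≡⟨ %-distribˡ-+ 1 (x % suc k) (suc k) ⟩
  (1 % suc k + x % suc k % suc k) % suc k   ≡⟨ cong (λ y → (1 % suc k + y) % suc k) (m%n%n≡m%n x (suc k)) ⟩
  (1 % suc k + x % suc k) % suc k           ≡⟨ sym (%-distribˡ-+ 1 x (suc k)) ⟩
  (1 + x) % suc k                           ≡⟨ cong (_% suc k) (sym (+-suc (toℕ o) c)) ⟩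
  (toℕ o + suc c) % suc k                   ∎
  where open ≡-Reasoning
        x = toℕ o + c

next-reach : ∀ {n} (o j : Fin n) → ∃ λ c → c < n × iter c next o ≡ j
next-reach {suc k} o j with toℕ o ≤? toℕ j
... | yes p = toℕ j ∸ toℕ o , ≤-<-trans (m∸n≤m (toℕ j) (toℕ o)) (toℕ<n j) , toℕ-injective (begin
  toℕ (iter (toℕ j ∸ toℕ o) next o)      ≡⟨ toℕ-iter-next (toℕ j ∸ toℕ o) o ⟩
  (toℕ o + (toℕ j ∸ toℕ o)) % suc k      ≡⟨ cong (_% suc k) (m+[n∸m]≡n p) ⟩
  toℕ j % suc k                          ≡⟨ m<n⇒m%n≡m (toℕ<n j) ⟩
  toℕ j                                  ∎)
  where open ≡-Reasoning
... | no ¬p = c , c<n , toℕ-injective (begin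
  toℕ (iter c next o)                    ≡⟨ toℕ-iter-next c o ⟩
  (toℕ o + c) % suc k                    ≡⟨ cong (_% suc k) e ⟩
  (toℕ j + suc k) % suc k                ≡⟨ [m+n]%n≡m%n (toℕ j) (suc k) ⟩
  toℕ j % suc k                          ≡⟨ m<n⇒m%n≡m (toℕ<n j) ⟩
  toℕ j                                  ∎)
  where
  open ≡-Reasoning
  c = suc k ∸ toℕ o + toℕ j
  e : toℕ o + c ≡ toℕ j + suc k
  e = trans (sym (+-assoc (toℕ o) (suc k ∸ toℕ o) (toℕ j)))
        (trans (cong (_+ toℕ j) (m+[n∸m]≡n (<⇒≤ (toℕ<n o)))) (+-comm (suc k) (toℕ j)))
  c<n : c < suc k
  c<n = +-cancelˡ-< (toℕ o) _ _ (subst (_< toℕ o + suc k) (sym e) (+-monoˡ-< (suc k) (≰⇒> ¬p)))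

iter-next-≢ : ∀ {n} (o : Fin n) {c} → 0 < c → c < n → iter c next o ≢ o
iter-next-≢ {suc k} o {c} 0<c c<n e with toℕ o + c <? suc k
... | yes p = <⇒≢ (m<m+n (toℕ o) 0<c)
                (trans (cong toℕ (sym e)) (trans (toℕ-iter-next c o) (m<n⇒m%n≡m p)))
... | no ¬p = <⇒≢ c<n (+-cancelˡ-≡ (toℕ o) _ _ (begin
  toℕ o + c                ≡⟨ sym (m∸n+n≡m (≮⇒≥ ¬p)) ⟩
  r + suc k                ≡⟨ cong (_+ suc k) r≡o ⟩
  toℕ o + suc k            ∎))
  where
  open ≡-Reasoning
  r = toℕ o + c ∸ suc k
  r<n : r < suc k
  r<n = +-cancelʳ-< (suc k) _ _ (subst (_< suc k + suc k) (sym (m∸n+n≡m (≮⇒≥ ¬p)))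
          (+-mono-< (toℕ<n o) c<n))
  r≡o : r ≡ toℕ o
  r≡o = begin
    r                       ≡⟨ sym (m<n⇒m%n≡m r<n) ⟩
    r % suc k               ≡⟨ sym ([m+n]%n≡m%n r (suc k)) ⟩
    (r + suc k) % suc k     ≡⟨ cong (_% suc k) (m∸n+n≡m (≮⇒≥ ¬p)) ⟩
    (toℕ o + c) % suc k     ≡⟨ sym (toℕ-iter-next c o) ⟩
    toℕ (iter c next o)     ≡⟨ cong toℕ e ⟩
    toℕ o                   ∎

-- A property of cyclically arranged items that spreads to both neighbours, except
-- possibly through one item, spreads everywhere: cut the cycle at the exception.
spread : ∀ {n} {Good Out : Fin n → Set} → (∀ i → Dec (Out i)) →
         (∀ {i} → Good i → ¬ Out i) → (∀ {i j} → Out i → Out j → i ≡ j) →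
         (∀ i → Good i → Good (next i) ⊎ Out (next i)) →
         (∀ i → Good (next i) → Good i ⊎ Out i) →
         ∀ i → Good i → ∀ j → Good j ⊎ Out j
spread {n} {Good} {Out} Out? disj uniq ahead behind i gi j with any? Out?
... | no ¬o = let c , _ , e = next-reach i j in subst (λ x → Good x ⊎ Out x) e (inj₁ (go c))
  where
  go : ∀ c → Good (iter c next i)
  go zero    = gi
  go (suc c) with ahead _ (go c)
  ... | inj₁ g = g
  ... | inj₂ o = ⊥-elim (¬o (_ , o))
... | yes (o , oo) with next-reach o i | next-reach o j
... | zero  , _   , refl | _ = ⊥-elim (disj gi oo)
... | suc a , _   , _    | zero  , _   , refl = inj₂ oo
... | suc a , a<n , refl | suc b , b<n , refl = inj₁ (up b b<n)
  where
  step : ∀ {c} → suc c < n → ∀ {P : Set} → P ⊎ Out (iter (suc c) next o) → P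
  step c<n (inj₁ p) = p
  step c<n (inj₂ q) = ⊥-elim (iter-next-≢ o (s≤s z≤n) c<n (uniq q oo))
  down : ∀ c → suc c < n → Good (iter (suc c) next o) → Good (iter 1 next o)
  down zero    _ g = g
  down (suc c) p g = down c (<-trans (n<1+n _) p) (step (<-trans (n<1+n _) p) (behind _ g))
  up : ∀ c → suc c < n → Good (iter (suc c) next o)
  up zero    _ = down a a<n gi
  up (suc c) p = step p (ahead _ (up c (<-trans (n<1+n _) p)))

-- Darts, the outer cycle and face walks

module Plane (Π : PolyEmb) where

  open PolyEmb Π public
  open Faces faces public

  rev : Dart → Dart
  rev (u , i) = nbr u i , back u i

  head-rev : ∀ d → head (rev d) ≡ tail d
  head-rev (u , i) = back-nbr u i

  dart-ext : ∀ {d e : Dart} → tail d ≡ tail e → head d ≡ head e → d ≡ e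
  dart-ext {u , i} {.u , j} refl h = cong (u ,_) (nbr-inj u i j h)

  rev-rev : ∀ d → rev (rev d) ≡ d
  rev-rev d = dart-ext (head-rev d) (head-rev (rev d))

  rev-injective : ∀ {d e} → rev d ≡ rev e → d ≡ e
  rev-injective {d} {e} p = trans (sym (rev-rev d)) (trans (cong rev p) (rev-rev e))

  -- Rotation about the tail. By definition `φ d` is `ρ (rev d)`, which ties the faces met around a
  -- vertex to those across its edges.
  ρ : Dart → Dart
  ρ (u , i) = u , next i

  ρ-injective : ∀ {d e} → ρ d ≡ ρ e → d ≡ e
  ρ-injective {u , i} {v , j} p with cong proj₁ p
  ρ-injective {u , i} {.u , j} p | refl = cong (u ,_) (next-injective (lemma p))
    where lemma : ∀ {x y : Fin (deg u)} → _≡_ {A = Dart} (u , x) (u , y) → x ≡ y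
          lemma refl = refl

  φ-injective : ∀ {d e} → φ d ≡ φ e → d ≡ e
  φ-injective p = rev-injective (ρ-injective p)

  φ-rev : ∀ d → φ (rev d) ≡ ρ d
  φ-rev d = cong ρ (rev-rev d)

  _≟ᵛ_ : (u v : Fin V) → Dec (u ≡ v)
  _≟ᵛ_ = _≟ᶠ_

  _≟ᵈ_ : (d e : Dart) → Dec (d ≡ e)
  _≟ᵈ_ = ≡-dec _≟ᶠ_ _≟ᶠ_

  instance
    L-nonZero : NonZero L
    L-nonZero = >-nonZero (≤-trans (s≤s z≤n) L≥3)

  O-periodic : ∀ k t → O (k * L + t) ≡ O t
  O-periodic zero    t = refl
  O-periodic (suc k) t = trans (cong O (+-assoc L (k * L) t)) (trans (O-per _) (O-periodic k t))

  -- One residue serves all shifts at once: `O-inj` speaks only of indices below `L`, while the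
  -- neighbours of `t` may wrap around.
  O-reduce : ∀ t → ∃ λ r → r < L × (∀ x → O (x + t) ≡ O (x + r))
  O-reduce t = t % L , m%n<n t L , λ x → trans (cong O (eq x)) (O-periodic (t / L) (x + t % L))
    where
    open ≡-Reasoning
    eq : ∀ x → x + t ≡ t / L * L + (x + t % L)
    eq x = begin
      x + t                          ≡⟨ cong (x +_) (m≡m%n+[m/n]*n t L) ⟩
      x + (t % L + t / L * L)        ≡⟨ sym (+-assoc x _ _) ⟩
      x + t % L + t / L * L          ≡⟨ +-comm (x + t % L) _ ⟩
      t / L * L + (x + t % L)        ∎

  O-shift : ∀ {a b} → O a ≡ O b → ∀ x → O (x + a) ≡ O (x + b)
  O-shift {a} {b} e x =
    let r , r<L , f = O-reduce a
        s , s<L , g = O-reduce b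
        r≡s = O-inj r s r<L s<L (trans (sym (f 0)) (trans e (g 0)))
    in trans (f x) (trans (cong (λ y → O (x + y)) r≡s) (sym (g x)))

  od-cong : ∀ {a b} → O a ≡ O b → od a ≡ od b
  od-cong {a} {b} e = dart-ext (trans (od-tl a) (trans e (sym (od-tl b))))
                               (trans (od-hd a) (trans (O-shift e 1) (sym (od-hd b))))

  outer : Fin F
  outer = face (od 0)

  face-od : ∀ t → face (od t) ≡ outer
  face-od zero    = refl
  face-od (suc t) = trans (cong face (sym (od-φ t))) (trans (inv (od t)) (face-od t))

  outer-od : ∀ {d} → face d ≡ outer → ∃ λ t → t < L × d ≡ od t
  outer-od {d} e =
    let k , p = orbit (od 0) d (sym e)
        r , r<L , f = O-reduce k
    in r , r<L , trans (sym p) (trans (walk k) (od-cong (f 0)))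
    where walk : ∀ k → iter k φ (od 0) ≡ od k
          walk zero    = refl
          walk (suc k) = trans (cong φ (walk k)) (od-φ k)

  outer-unique : ∀ {d e} → face d ≡ outer → face e ≡ outer → tail d ≡ tail e → d ≡ e
  outer-unique p q t with outer-od p | outer-od q
  ... | a , _ , refl | b , _ , refl = od-cong (trans (sym (od-tl a)) (trans t (od-tl b)))

  -- Such a dart would be some `od s` leading from `O (1 + t)` back to `O t`. Then `O (2 + t)`
  -- equals `O t`, impossible on a cycle of length at least 3.
  rev-od-inner : ∀ t → face (rev (od t)) ≢ outer
  rev-od-inner t e =
    let s , _ , p = outer-od e
        r , r<L , f = O-reduce t
        Os : O s ≡ O (1 + t)
        Os = trans (sym (od-tl s)) (trans (cong tail (sym p)) (od-hd t))
        O2 : O (2 + t) ≡ O t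
        O2 = trans (sym (O-shift Os 1)) (trans (sym (od-hd s))
               (trans (cong head (sym p)) (trans (head-rev (od t)) (od-tl t))))
    in absurd r r<L (trans (sym (f 2)) (trans O2 (f 0)))
    where
    absurd : ∀ r → r < L → O (2 + r) ≢ O r
    absurd r r<L e with 2 + r <? L
    ... | yes p = <⇒≢ (<-trans (n<1+n r) (n<1+n (1 + r))) (sym (O-inj _ _ p r<L e))
    ... | no ¬p = <⇒≢ L≥3 (+-cancelʳ-≡ r 2 L (trans (sym (m∸n+n≡m (≮⇒≥ ¬p))) (trans (cong (_+ L) x≡r) (+-comm r L))))
      where
      x = 2 + r ∸ L
      x+L : L + x ≡ 2 + r
      x+L = m+[n∸m]≡n (≮⇒≥ ¬p)
      x<L : x < L
      x<L = +-cancelˡ-< L _ _ (subst (_< L + L) (sym x+L) (≤-<-trans (n≤1+n _) (+-mono-≤-< L≥3 r<L)))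
      x≡r : x ≡ r
      x≡r = O-inj x r x<L r<L (trans (sym (O-per x)) (trans (cong O x+L) e))

  c₀ : Fin V
  c₀ = O 0

  O-L : O L ≡ c₀
  O-L = trans (cong O (sym (+-identityʳ L))) (O-per 0)

  -- The border dart leaving `c₀` anticlockwise. Its other side is the outer face, so it is never
  -- glued along and stays the first dart of every boundary walk.
  d₀ : Dart
  d₀ = rev (od (L ∸ 1))

  suc-L∸1 : suc (L ∸ 1) ≡ L
  suc-L∸1 = m+[n∸m]≡n (≤-trans (s≤s z≤n) L≥3)

  tail-d₀ : tail d₀ ≡ c₀
  tail-d₀ = trans (od-hd (L ∸ 1)) (trans (cong O suc-L∸1) O-L)

  dartsAt : Fin V → List Dart
  dartsAt u = map (u ,_) (allFin (deg u))

  darts : List Dart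
  darts = concatMap dartsAt (allFin V)

  length-darts : length darts ≡ sumDeg
  length-darts = go (allFin V)
    where
    at : ∀ u → length (dartsAt u) ≡ deg u
    at u = trans (length-map _ (allFin (deg u))) (length-tabulate {n = deg u} (λ i → i))
    go : ∀ us → length (concatMap dartsAt us) ≡ sum (map deg us)
    go []       = refl
    go (u ∷ us) = trans (length-++ (dartsAt u)) (cong₂ _+_ (at u) (go us))

  ∈-darts : ∀ d → d ∈ darts
  ∈-darts (u , i) = go (∈-allFin u)
    where
    go : ∀ {us} → u ∈ us → (u , i) ∈ concatMap dartsAt us
    go (here refl) = ∈-++⁺ˡ (∈-map⁺ _ (∈-allFin i))
    go {v ∷ us} (there p) = ∈-++⁺ʳ (dartsAt v) (go p)

  data Path : Fin V → List Dart → Fin V → Set where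
    stop : ∀ {u} → Path u [] u
    step : ∀ {u v d ds} → tail d ≡ u → Path (head d) ds v → Path u (d ∷ ds) v

  Path-++ : ∀ {u v x α β} → Path u α v → Path v β x → Path u (α ++ β) x
  Path-++ stop       q = q
  Path-++ (step e p) q = step e (Path-++ p q)

  Path-split : ∀ {u x} α {β} → Path u (α ++ β) x → ∃ λ v → Path u α v × Path v β x
  Path-split []      p          = _ , stop , p
  Path-split (d ∷ α) (step e p) = let v , q , r = Path-split α p in v , step e q , r

  walk : ℕ → Dart → List Dart
  walk zero    d = []
  walk (suc k) d = d ∷ walk k (φ d)

  iter-φ : ∀ k d → iter k φ (φ d) ≡ φ (iter k φ d)
  iter-φ zero    d = refl
  iter-φ (suc k) d = cong φ (iter-φ k d)

  iter-+ : ∀ a b d → iter (a + b) φ d ≡ iter a φ (iter b φ d)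
  iter-+ zero    b d = refl
  iter-+ (suc a) b d = cong φ (iter-+ a b d)

  iter-injective : ∀ k {d e} → iter k φ d ≡ iter k φ e → d ≡ e
  iter-injective zero    p = p
  iter-injective (suc k) p = iter-injective k (φ-injective p)

  walk-Path : ∀ k d → Path (tail d) (walk k d) (tail (iter k φ d))
  walk-Path zero    d = stop
  walk-Path (suc k) d = step refl (subst (λ x → Path (head d) (walk k (φ d)) (tail x)) (iter-φ k d) (walk-Path k (φ d)))

  ∈-walk⁻ : ∀ k {d e} → e ∈ walk k d → ∃ λ i → i < k × e ≡ iter i φ d
  ∈-walk⁻ (suc k) (here refl) = 0 , s≤s z≤n , refl
  ∈-walk⁻ (suc k) {d} (there p) = let i , i<k , e = ∈-walk⁻ k p in suc i , s≤s i<k , trans e (iter-φ i d)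

  ∈-walk⁺ : ∀ {k i} d → i < k → iter i φ d ∈ walk k d
  ∈-walk⁺ {suc k} {zero}  d _       = here refl
  ∈-walk⁺ {suc k} {suc i} d (s≤s p) = there (subst (_∈ walk k (φ d)) (iter-φ i d) (∈-walk⁺ (φ d) p))

  -- As `φ` is injective, common iterates cancel, and any repetition becomes a return to `d` before
  -- the period `K`.
  walk-unique : ∀ k a {K d} → k + a ≤ K → (∀ {i} → i < K → iter (suc i) φ d ≢ d ⊎ suc i ≡ K) →
                Unique (walk k (iter a φ d))
  walk-unique zero    a le least = []
  walk-unique (suc k) a {K} {d} le least =
    All.tabulate (λ p q → absurd (∈-walk⁻ k p) q) ∷
    walk-unique k (suc a) (subst (_≤ K) (sym (+-suc k a)) le) least
    where
    absurd : ∀ {e} → (∃ λ i → i < k × e ≡ iter i φ (φ (iter a φ d))) → iter a φ d ≢ e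
    absurd (i , i<k , refl) q with least {i} (≤-trans i<k (≤-trans (n≤1+n k) (≤-trans (m≤m+n (suc k) a) le)))
    ... | inj₁ n = n (iter-injective a (trans (sym (iter-+ a (suc i) d)) (trans (cong (λ x → iter x φ d) (+-comm a (suc i)))
                     (trans (iter-+ (suc i) a d) (trans (sym (iter-φ i _)) (sym q))))))
    ... | inj₂ n = <⇒≢ (≤-trans (s≤s i<k) (≤-trans (m≤m+n (suc k) a) le)) n

  -- `rest` omits `d` itself: for the face of `rev e` it is then a path from the tail of `e` to its
  -- head, ready to replace `e` in a walk.
  record FaceWalk (d : Dart) : Set where
    field
      rest     : List Dart
      path     : Path (head d) rest (tail d)
      unique   : Unique (d ∷ rest)
      sound    : ∀ {e} → e ∈ d ∷ rest → face e ≡ face d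
      complete : ∀ {e} → face e ≡ face d → e ∈ d ∷ rest

  faceWalk : ∀ d → FaceWalk d
  faceWalk d with orbit (φ d) d (inv d)
  ... | n , p with minimal {λ k → iter (suc k) φ d ≡ d} (λ k → iter (suc k) φ d ≟ᵈ d) n (trans (sym (iter-φ n d)) p)
  ... | K , q , least = record
    { rest     = walk K (φ d)
    ; path     = subst (λ x → Path (head d) (walk K (φ d)) (tail x)) (trans (iter-φ K d) q) (walk-Path K (φ d))
    ; unique   = walk-unique (suc K) 0 {suc K} {d} (≤-reflexive (+-identityʳ (suc K))) least′
    ; sound    = λ {e} e∈ → let i , _ , r = ∈-walk⁻ (suc K) e∈ in trans (cong face r) (face-iter i)
    ; complete = λ {e} f → let k , r = orbit d e (sym f)
                               i , i<K , r′ = reduce k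
                           in subst (_∈ walk (suc K) d) (trans (sym r′) r) (∈-walk⁺ d i<K)
    }
    where
    least′ : ∀ {i} → i < suc K → iter (suc i) φ d ≢ d ⊎ suc i ≡ suc K
    least′ {i} (s≤s i≤K) with m≤n⇒m<n∨m≡n i≤K
    ... | inj₁ i<K = inj₁ (least i<K)
    ... | inj₂ i≡K = inj₂ (cong suc i≡K)
    face-iter : ∀ i → face (iter i φ d) ≡ face d
    face-iter zero    = refl
    face-iter (suc i) = trans (inv _) (face-iter i)
    reduce : ∀ k → ∃ λ i → i < suc K × iter k φ d ≡ iter i φ d
    reduce zero = 0 , s≤s z≤n , refl
    reduce (suc k) with reduce k
    ... | i , s≤s i≤K , e with m≤n⇒m<n∨m≡n i≤K
    ... | inj₁ i<K  = suc i , s≤s i<K , cong φ e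
    ... | inj₂ refl = 0 , s≤s z≤n , trans (cong φ e) q

-- Gluing the inner faces into a disc

exchange : ∀ {A : Set} (α β γ κ λ′ : List A) x y →
           ((α ++ x ∷ β) ++ κ ++ λ′) ++ y ∷ γ ↭ (α ++ γ ++ β) ++ (x ∷ κ) ++ y ∷ λ′
exchange {A} α β γ κ λ′ x y =
  solve 7 (λ α β γ κ λ′ x y → ((α ⊕ x ⊕ β) ⊕ κ ⊕ λ′) ⊕ y ⊕ γ ⊜ (α ⊕ γ ⊕ β) ⊕ (x ⊕ κ) ⊕ y ⊕ λ′)
    ↭-refl α β γ κ λ′ (x ∷ []) (y ∷ [])
  where open CMSolver (++-commutativeMonoid {A = A})

module Growth (Π : PolyEmb) where
  open Plane Π

  _∈ᶠ?_ : (f : Fin F) (fs : List (Fin F)) → Dec (f ∈ fs)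
  _∈ᶠ?_ = _∈?_ _≟ᶠ_

  verts : List Dart → List (Fin V)
  verts w = map tail w ++ c₀ ∷ []

  verts-head : ∀ {u β} → Path u β c₀ → verts β [ 0 ]= u
  verts-head stop          = here
  verts-head (step refl _) = here

  -- The union of the faces in `region`, seen as a disc: its boundary walk, and the
  -- edges inside it as chords between positions of the boundary walk.
  record Disc : Set where
    field
      region   : List (Fin F)
      boundary : List Dart
      chords   : List (Dart × ℕ × ℕ)
      covered  : List Dart
      path     : Path c₀ boundary c₀
      start    : ∃ λ w → boundary ≡ d₀ ∷ w
      perm     : covered ↭ boundary ++ map proj₁ chords ++ map (rev ∘ proj₁) chords
      unique   : Unique covered
      sound    : ∀ {d} → d ∈ covered → face d ∈ region
      complete : ∀ {d} → face d ∈ region → d ∈ covered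
      outer∉   : outer ∉ region
      count    : length region ≡ suc (length chords)
      ends     : ∀ {d p q} → (d , p , q) ∈ chords →
                 p < q × verts boundary [ p ]= tail d × verts boundary [ q ]= head d
      nocross  : ∀ {d p q e r s} → (d , p , q) ∈ chords → (e , r , s) ∈ chords →
                 p < r → r < q → q < s → ⊥

  initial : Disc
  initial = record
    { region   = face d₀ ∷ []
    ; boundary = d₀ ∷ rest
    ; chords   = []
    ; covered  = d₀ ∷ rest
    ; path     = step tail-d₀ (subst (Path (head d₀) rest) tail-d₀ path)
    ; start    = rest , refl
    ; perm     = ↭-reflexive (sym (++-identityʳ _))
    ; unique   = unique
    ; sound    = λ p → here (sound p)
    ; complete = λ { (here p) → complete p }
    ; outer∉   = λ { (here p) → rev-od-inner (L ∸ 1) (sym p) }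
    ; count    = refl
    ; ends     = λ ()
    ; nocross  = λ ()
    }
    where open FaceWalk (faceWalk d₀)

  -- Gluing the face across the boundary dart `d`. The face being new, its darts are disjoint from
  -- `covered`; its walk takes the place of `d`, and `d` survives as a chord.
  module Expand (Δ : Disc) {d : Dart} {α β : List Dart} (split : Disc.boundary Δ ≡ α ++ d ∷ β)
                (new : face (rev d) ∉ Disc.region Δ) (inner : face (rev d) ≢ outer) where
    open Disc Δ
    open FaceWalk (faceWalk (rev d)) using (rest) renaming
      (path to rest-path; unique to rest-unique; sound to rest-sound; complete to rest-complete)

    abstract
      -- A face walk consisting of `rev d` alone would make that dart a loop.
      rest-cons : Σ Dart λ g → Σ (List Dart) λ γ → rest ≡ g ∷ γ × tail g ≡ tail d
      rest-cons with rest | rest-path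
      ... | []    | p = ⊥-elim (absurd p refl refl)
        where absurd : ∀ {u v} → Path u [] v → u ≡ head (rev d) → v ≢ tail (rev d)
              absurd stop e e′ = loopless _ _ (trans (sym e) e′)
      ... | g ∷ γ | step e _ = g , γ , refl , trans e (head-rev d)

    g = proj₁ rest-cons
    γ = proj₁ (proj₂ rest-cons)
    rest≡ : rest ≡ g ∷ γ
    rest≡ = proj₁ (proj₂ (proj₂ rest-cons))
    tail-g : tail g ≡ tail d
    tail-g = proj₂ (proj₂ (proj₂ rest-cons))

    a = length α
    k = length γ

    move : Dart × ℕ × ℕ → Dart × ℕ × ℕ
    move (e , p , q) = e , bump (suc a) k p , bump (suc a) k q

    boundary′ : List Dart
    boundary′ = α ++ rest ++ β

    chords′ : List (Dart × ℕ × ℕ)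
    -- `rest` has `suc k` darts, hence `k` vertices strictly between the two ends of `d`. Everything
    -- from position `suc a` on moves up by `k`.
    chords′ = (d , a , a + suc k) ∷ map move chords

    covered′ : List Dart
    covered′ = covered ++ rev d ∷ rest

    front : List (Fin V)
    front = map tail α ++ tail d ∷ []

    length-front : length front ≡ suc a
    length-front = trans (length-++ (map tail α)) (trans (+-comm _ 1) (cong suc (length-map tail α)))

    verts-old : verts boundary ≡ front ++ verts β
    verts-old = trans (cong verts split) (trans (cong (_++ c₀ ∷ []) (map-++ tail α (d ∷ β)))
      (trans (++-assoc (map tail α) _ _) (sym (++-assoc (map tail α) (tail d ∷ []) (verts β)))))

    verts-new : verts boundary′ ≡ front ++ map tail γ ++ verts β
    verts-new = begin
      verts (α ++ rest ++ β)                                    ≡⟨ cong (λ r → verts (α ++ r ++ β)) rest≡ ⟩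
      map tail (α ++ g ∷ γ ++ β) ++ c₀ ∷ []                     ≡⟨ cong (_++ c₀ ∷ []) (map-++ tail α _) ⟩
      (map tail α ++ tail g ∷ map tail (γ ++ β)) ++ c₀ ∷ []     ≡⟨ ++-assoc (map tail α) _ _ ⟩
      map tail α ++ tail g ∷ (map tail (γ ++ β) ++ c₀ ∷ [])
        ≡⟨ cong₂ (λ x y → map tail α ++ x ∷ y) tail-g
             (trans (cong (_++ c₀ ∷ []) (map-++ tail γ β)) (++-assoc (map tail γ) _ _)) ⟩
      map tail α ++ tail d ∷ (map tail γ ++ verts β)            ≡⟨ sym (++-assoc (map tail α) (tail d ∷ []) _) ⟩
      front ++ map tail γ ++ verts β                            ∎
      where open ≡-Reasoning

    verts-move : ∀ {p u} → verts boundary [ p ]= u → verts boundary′ [ bump (suc a) k p ]= u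
    verts-move {p} {u} x = subst₂ (λ vs n → vs [ n ]= u) (sym verts-new)
      (cong₂ (λ i j → bump i j p) length-front (length-map tail γ))
      (at-bump front (map tail γ) (subst (_[ p ]= u) verts-old x))

    path-β : Path (head d) β c₀
    path-β with Path-split α (subst (λ w → Path c₀ w c₀) split path)
    ... | _ , _ , step _ p = p

    end₁ : verts boundary′ [ a ]= tail d
    end₁ = subst₂ (λ vs n → vs [ n ]= tail d) (sym verts-new) (length-map tail α)
      (at-++ˡ {xs = front} (at-mid (map tail α)))

    end₂ : verts boundary′ [ a + suc k ]= head d
    end₂ = subst₂ (λ vs n → vs [ n ]= head d) (sym verts-new) eq
      (at-++ʳ front (at-++ʳ (map tail γ) (verts-head path-β)))
      where
      eq : length front + (length (map tail γ) + 0) ≡ a + suc k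
      eq = trans (cong₂ _+_ length-front (trans (+-identityʳ _) (length-map tail γ))) (sym (+-suc a k))

    ends′ : ∀ {e p q} → (e , p , q) ∈ chords′ →
            p < q × verts boundary′ [ p ]= tail e × verts boundary′ [ q ]= head e
    ends′ (here refl) = m<m+n a (s≤s z≤n) , end₁ , end₂
    ends′ (there x) with ∈-map⁻ move x
    ... | (e , p , q) , y , refl =
      let p<q , u , v = ends y in bump-mono (suc a) k p<q , verts-move u , verts-move v

    outside : ∀ x → ¬ (a < bump (suc a) k x × bump (suc a) k x < a + suc k)
    outside x (lo , hi) with bump-gap (suc a) k x
    ... | inj₁ p = <⇒≱ lo (≤-pred p)
    ... | inj₂ p = <⇒≱ hi (subst (_≤ bump (suc a) k x) (sym (+-suc a k)) p)

    nocross′ : ∀ {c p q e r s} → (c , p , q) ∈ chords′ → (e , r , s) ∈ chords′ →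
               p < r → r < q → q < s → ⊥
    nocross′ (here refl) (here refl) x _ _ = <-irrefl refl x
    nocross′ (here refl) (there j) x y _ with ∈-map⁻ move j
    ... | (_ , r , _) , _ , refl = outside r (x , y)
    nocross′ (there i) (here refl) _ y z with ∈-map⁻ move i
    ... | (_ , _ , q) , _ , refl = outside q (y , z)
    nocross′ (there i) (there j) x y z with ∈-map⁻ move i | ∈-map⁻ move j
    ... | _ , i′ , refl | _ , j′ , refl =
      nocross i′ j′ (bump-cancel (suc a) k x) (bump-cancel (suc a) k y) (bump-cancel (suc a) k z)

    path′ : Path c₀ boundary′ c₀
    path′ with Path-split α (subst (λ w → Path c₀ w c₀) split path)
    ... | _ , pα , step e pβ = Path-++ pα (Path-++ (subst (λ x → Path x rest (head d)) (trans (head-rev d) e) rest-path) pβ)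

    start′ : ∃ λ w → boundary′ ≡ d₀ ∷ w
    start′ = keep α (trans (sym split) (proj₂ start))
      where
      keep : ∀ α {w} → α ++ d ∷ β ≡ d₀ ∷ w → ∃ λ w → α ++ rest ++ β ≡ d₀ ∷ w
      -- An empty `α` would mean that `d` is `d₀`, across which lies the outer face.
      keep []      refl = ⊥-elim (inner (trans (cong face (rev-rev _)) (face-od (L ∸ 1))))
      keep (_ ∷ α) refl = _ , refl

    -- The dart `d` passes from the boundary to the chords, `rev d` from the new face to the
    -- reversed chords, and `rest` fills the gap; `exchange` is this rearrangement.
    perm′ : covered′ ↭ boundary′ ++ map proj₁ chords′ ++ map (rev ∘ proj₁) chords′
    perm′ = ↭-trans (++⁺ʳ (rev d ∷ rest) (↭-trans perm (↭-reflexive (cong (_++ kd ++ kr) split))))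
      (↭-trans (exchange α β rest kd kr d (rev d))
        (↭-reflexive (cong₂ (λ x y → boundary′ ++ (d ∷ x) ++ rev d ∷ y) (map-∘ {g = proj₁} {f = move} chords) (map-∘ {g = rev ∘ proj₁} {f = move} chords))))
      where
      kd = map proj₁ chords
      kr = map (rev ∘ proj₁) chords

    expand : Disc
    expand = record
      { region   = face (rev d) ∷ region
      ; boundary = boundary′
      ; chords   = chords′
      ; covered  = covered′
      ; path     = path′
      ; start    = start′
      ; perm     = perm′
      ; unique   = ++⁺ unique rest-unique λ (x , y) → new (subst (_∈ region) (rest-sound y) (sound x))
      ; sound    = sound′
      ; complete = λ { (here e) → ∈-++⁺ʳ covered (rest-complete e) ; (there x) → ∈-++⁺ˡ (complete x) }
      ; outer∉   = λ { (here e) → inner (sym e) ; (there x) → outer∉ x }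
      ; count    = cong suc (trans count (cong suc (sym (length-map move chords))))
      ; ends     = ends′
      ; nocross  = nocross′
      }
      where
      sound′ : ∀ {e} → e ∈ covered′ → face e ∈ face (rev d) ∷ region
      sound′ x with ∈-++⁻ covered x
      ... | inj₁ y = there (sound y)
      ... | inj₂ y = here (rest-sound y)

    grows : suc (length covered) ≤ length covered′
    grows = subst (suc (length covered) ≤_) (sym (trans (length-++ covered) (+-suc _ _))) (s≤s (m≤m+n _ _))

  Full : Disc → Set
  Full Δ = ∀ d → face d ∈ Disc.region Δ ⊎ face d ≡ outer

  module Closed (Δ : Disc) (stuck : ∀ {d} → d ∈ Disc.boundary Δ → face (rev d) ∈ Disc.region Δ ⊎ face (rev d) ≡ outer) where
    open Disc Δ

    -- A chord has faces of the region on both sides, so only a boundary dart could lead out, and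
    -- there `stuck` applies.
    cross : ∀ {d} → face d ∈ region → face (rev d) ∈ region ⊎ face (rev d) ≡ outer
    cross x with ∈-++⁻ boundary (∈-resp-↭ perm (complete x))
    ... | inj₁ y = stuck y
    ... | inj₂ y with ∈-++⁻ (map proj₁ chords) y
    ... | inj₁ z with ∈-map⁻ proj₁ z
    ... | c , c∈ , refl = inj₁ (sound (∈-resp-↭ (↭-sym perm)
            (∈-++⁺ʳ boundary (∈-++⁺ʳ (map proj₁ chords) (∈-map⁺ (rev ∘ proj₁) c∈)))))
    cross x | inj₂ y | inj₂ z with ∈-map⁻ (rev ∘ proj₁) z
    ... | c , c∈ , refl = inj₁ (subst (λ e → face e ∈ region) (sym (rev-rev _))
            (sound (∈-resp-↭ (↭-sym perm) (∈-++⁺ʳ boundary (∈-++⁺ˡ (∈-map⁺ proj₁ c∈))))))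

    Good : Dart → Set
    Good d = face d ∈ region ⊎ face d ≡ outer

    face-ρ : ∀ d → face (ρ d) ≡ face (rev d)
    face-ρ d = trans (cong face (sym (φ-rev d))) (inv (rev d))

    -- By `face-ρ`, rotating one step at `u` amounts to crossing an edge. The outer face occurs at
    -- most once around a vertex, which is the single exception that `spread` allows.
    around : ∀ {u i} → face (u , i) ∈ region → ∀ j → Good (u , j)
    around {u} {i} x j = spread {Good = λ i → face (u , i) ∈ region} {Out = λ i → face (u , i) ≡ outer}
      (λ i → face (u , i) ≟ᶠ outer)
      (λ y e → outer∉ (subst (_∈ region) e y))
      (λ p q → same (outer-unique p q refl))
      (λ i y → subst (λ f → f ∈ region ⊎ f ≡ outer) (sym (face-ρ (u , i))) (cross y))
      (λ i y → subst Good (rev-rev (u , i)) (cross (subst (_∈ region) (face-ρ (u , i)) y)))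
      i x j
      where same : ∀ {x y : Fin (deg u)} → _≡_ {A = Dart} (u , x) (u , y) → x ≡ y
            same refl = refl

    -- An edge has the outer face on at most one of its sides, so the face on the other side is in
    -- the region and is handed over to `v`.
    spread-edge : ∀ {u v} → Adj u v → (∀ i → Good (u , i)) → ∀ j → Good (v , j)
    spread-edge {u} (i , refl) g with g i
    ... | inj₁ x = around {i = proj₂ (φ (u , i))} (subst (_∈ region) (sym (inv (u , i))) x)
    ... | inj₂ x = around {i = back u i} (lemma (g (next i)))
      where
      lemma : Good (ρ (u , i)) → face (rev (u , i)) ∈ region
      lemma (inj₁ y) = subst (_∈ region) (face-ρ (u , i)) y
      lemma (inj₂ y) with outer-od x
      ... | t , _ , e = ⊥-elim (rev-od-inner t (trans (cong (face ∘ rev) (sym e)) (trans (sym (face-ρ (u , i))) y)))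

    spread-path : ∀ {u v} → Star Adj u v → (∀ i → Good (u , i)) → ∀ j → Good (v , j)
    spread-path ε        g = g
    spread-path (a ◅ as) g = spread-path as (spread-edge a g)

    full : Full Δ
    full (v , j) = spread-path (connected (tail d₀) v) (around {i = proj₂ d₀} first) j
      where
      first : face d₀ ∈ region
      first = sound (∈-resp-↭ (↭-sym perm) (∈-++⁺ˡ (subst (d₀ ∈_) (sym (proj₂ start)) (here refl))))

  -- `n` bounds the number of darts still uncovered, and each gluing covers new ones.
  grow : ∀ n (Δ : Disc) → sumDeg ≤ length (Disc.covered Δ) + n → Σ Disc Full
  grow n Δ le with Any.any? (λ d → ¬? (face (rev d) ∈ᶠ? Disc.region Δ) ×-dec ¬? (face (rev d) ≟ᶠ outer)) (Disc.boundary Δ)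
  ... | no ¬p = Δ , Closed.full Δ stuck
    where
    stuck : ∀ {d} → d ∈ Disc.boundary Δ → face (rev d) ∈ Disc.region Δ ⊎ face (rev d) ≡ outer
    stuck {d} d∈ with face (rev d) ∈ᶠ? Disc.region Δ | face (rev d) ≟ᶠ outer
    ... | yes p | _     = inj₁ p
    ... | no _  | yes q = inj₂ q
    ... | no p  | no q  = ⊥-elim (¬p (lose d∈ (p , q)))
  ... | yes p with find p
  ... | d , d∈ , new , inner with ∈-∃++ d∈
  ... | α , β , split = next-stage n le
    where
    open Expand Δ split new inner
    next-stage : ∀ n → sumDeg ≤ length (Disc.covered Δ) + n → Σ Disc Full
    next-stage zero le = ⊥-elim (<⇒≱ grows (≤-trans
      (subst (length covered′ ≤_) length-darts (unique-length (Disc.unique expand) (λ {x} _ → ∈-darts x)))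
      (subst (sumDeg ≤_) (+-identityʳ _) le)))
    next-stage (suc n) le = grow n expand (≤-trans le (subst (_≤ length covered′ + n) (sym (+-suc _ n)) (+-monoˡ-≤ n grows)))

  abstract
    disc : Σ Disc Full
    disc = grow sumDeg initial (m≤n+m sumDeg _)

-- Peeling a closed walk down to the border

unique-++-disjoint : ∀ {A : Set} (xs : List A) {ys x} → Unique (xs ++ ys) → x ∈ xs → x ∈ ys → ⊥
unique-++-disjoint (x ∷ xs) (n ∷ u) (here refl) q = All.lookup n (∈-++⁺ʳ xs q) refl
unique-++-disjoint (x ∷ xs) (n ∷ u) (there p)   q = unique-++-disjoint xs u p q

unique-++ˡ : ∀ {A : Set} (xs : List A) {ys} → Unique (xs ++ ys) → Unique xs
unique-++ˡ []       u       = []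
unique-++ˡ (x ∷ xs) (n ∷ u) = All.tabulate (λ p → All.lookup n (∈-++⁺ˡ p)) ∷ unique-++ˡ xs u

module Peeling (Π : PolyEmb) where
  open Plane Π
  open Growth Π

  OnO : Fin V → Set
  OnO u = ∃ λ t → u ≡ O t

  OnO-reduce : ∀ {u} → OnO u → ∃ λ (t : Fin L) → u ≡ O (toℕ t)
  OnO-reduce (t , e) = let r , r<L , f = O-reduce t in
    fromℕ< r<L , trans e (trans (f 0) (cong O (sym (toℕ-fromℕ< r<L))))

  OnO? : ∀ u → Dec (OnO u)
  OnO? u with any? (λ (t : Fin L) → u ≟ᵛ O (toℕ t))
  ... | yes (t , e) = yes (toℕ t , e)
  ... | no ¬p       = no λ x → ¬p (OnO-reduce x)

  IsRevOd : Dart → Set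
  IsRevOd d = ∃ λ t → d ≡ rev (od t)

  IsRevOd? : ∀ d → Dec (IsRevOd d)
  IsRevOd? d with any? (λ (t : Fin L) → d ≟ᵈ rev (od (toℕ t)))
  ... | yes (t , e) = yes (toℕ t , e)
  ... | no ¬p       = no λ (t , e) → let s , f = OnO-reduce (t , refl) in
                      ¬p (s , trans e (cong rev (od-cong f)))

  O-cancel : ∀ {a b} → O (suc a) ≡ O (suc b) → O a ≡ O b
  O-cancel {a} {b} e = trans (sym (back-to a)) (trans (O-shift e (L ∸ 1)) (back-to b))
    where back-to : ∀ t → O (L ∸ 1 + suc t) ≡ O t
          back-to t = trans (cong O (trans (+-suc (L ∸ 1) t) (cong (_+ t) suc-L∸1))) (O-per t)

  tail-rev-od : ∀ t → tail (rev (od t)) ≡ O (suc t)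
  tail-rev-od = od-hd

  head-rev-od : ∀ t → head (rev (od t)) ≡ O t
  head-rev-od t = trans (head-rev (od t)) (od-tl t)

  -- `Adj u v` is recorded because it rules out insertion at a corner. That `v` is new to the word
  -- later makes its place unique up to gluing at the moment of insertion.
  data Grow : List (Fin V) → ℕ → Set where
    base : Grow (applyUpTo O L) 0
    ins  : ∀ α {u v β c} → Grow (α ++ u ∷ β) c → ¬ OnO v → v ∉ α ++ u ∷ β → Adj u v →
           Grow (α ++ u ∷ v ∷ u ∷ β) (suc c)

  -- A closed walk that traverses the border edges once, every other edge of it twice, and is
  -- short enough for these edges to form a unicyclic graph.
  record Around (w : List Dart) (I : List (Fin V)) : Set where
    field
      path   : Path c₀ w c₀
      start  : ∃ λ w′ → w ≡ d₀ ∷ w′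
      unique : Unique w
      revs   : ∀ {d} → d ∈ w → IsRevOd d ⊎ rev d ∈ w
      border : ∀ t → rev (od t) ∈ w
      uniqI  : Unique I
      inner  : ∀ {x} → x ∈ I → ¬ OnO x
      cover  : ∀ {x} → x ∈ I → ∃ λ d → d ∈ w × tail d ≡ x
      size   : length w ≤ L + 2 * length I

    One Two : Fin V → Set
    One x = Σ Dart λ a → a ∈ w × tail a ≡ x × (∀ {b} → b ∈ w → tail b ≡ x → b ≡ a)
    Two x = Σ Dart λ a → Σ Dart λ b → a ∈ w × b ∈ w × tail a ≡ x × tail b ≡ x × a ≢ b

    one-or-two : ∀ {x} → x ∈ I → One x ⊎ Two x
    one-or-two {x} x∈ with cover x∈
    ... | a , a∈ , e with Any.any? (λ b → tail b ≟ᵛ x ×-dec ¬? (a ≟ᵈ b)) w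
    ... | yes p = let b , b∈ , f , n = find p in inj₂ (a , b , a∈ , b∈ , e , f , n)
    ... | no ¬p = inj₁ (a , a∈ , e , only)
      where
      only : ∀ {b} → b ∈ w → tail b ≡ x → b ≡ a
      only {b} b∈ f with a ≟ᵈ b
      ... | yes a≡b = sym a≡b
      ... | no n    = ⊥-elim (¬p (lose b∈ (f , n)))

    leaf-or-all : ∀ J → (∀ {x} → x ∈ J → x ∈ I) → (∃ λ x → x ∈ I × One x) ⊎ (∀ {x} → x ∈ J → Two x)
    leaf-or-all []      _ = inj₂ λ ()
    leaf-or-all (x ∷ J) f with one-or-two (f (here refl)) | leaf-or-all J (f ∘ there)
    ... | inj₁ o | _      = inj₁ (x , f (here refl) , o)
    ... | inj₂ _ | inj₁ l = inj₁ l
    ... | inj₂ t | inj₂ g = inj₂ λ { (here refl) → t ; (there p) → g p }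

    pairs : ∀ J → Unique J → (∀ {x} → x ∈ J → Two x) →
            Σ (List Dart) λ ds → Unique ds × length ds ≡ 2 * length J ×
              (∀ {d} → d ∈ ds → d ∈ w × tail d ∈ J)
    pairs []      _       _ = [] , [] , refl , λ ()
    pairs (x ∷ J) (n ∷ u) f with f (here refl) | pairs J u (f ∘ there)
    ... | a , b , a∈ , b∈ , ea , eb , a≢b | ds , uds , l , g =
      a ∷ b ∷ ds ,
      (a≢b ∷ All.tabulate (apart ea)) ∷ All.tabulate (apart eb) ∷ uds ,
      trans (cong (2 +_) l) (sym (*-suc 2 (length J))) ,
      λ { (here refl) → a∈ , here ea ; (there (here refl)) → b∈ , here eb
        ; (there (there p)) → proj₁ (g p) , there (proj₂ (g p)) }
      where
      apart : ∀ {c} → tail c ≡ x → ∀ {d} → d ∈ ds → c ≢ d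
      apart e p refl = All.lookup n (subst (_∈ J) e (proj₂ (g p))) refl

    -- The `L` border darts and two darts at each inner vertex already exhaust the bound `size`; one
    -- more dart leaving a vertex of O would exceed it.
    border-only : (∀ {x} → x ∈ I → Two x) → ∀ {e} → e ∈ w → OnO (tail e) → IsRevOd e
    border-only two {e} e∈ on with IsRevOd? e
    ... | yes p = p
    ... | no ¬p with pairs I uniqI two
    ... | ds , uds , l , g = ⊥-elim (<⇒≱ (s≤s size) (subst (_≤ length w) len
            (unique-length {ys = w} (All.tabulate e∉ ∷ ++⁺ unique-bs uds disjoint)
              λ { (here refl) → e∈ ; (there q) → mem q })))
      where
      bs : List Dart
      bs = applyUpTo (rev ∘ od) L
      unique-bs : Unique bs
      unique-bs = applyUpTo⁺₁ (rev ∘ od) L λ {i} {j} i<j j<L eq →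
        <⇒≢ i<j (O-inj i j (<-trans i<j j<L) j<L
          (trans (sym (head-rev-od i)) (trans (cong head eq) (head-rev-od j))))
      disjoint : ∀ {d} → ¬ (d ∈ bs × d ∈ ds)
      disjoint (p , q) with ∈-applyUpTo⁻ (rev ∘ od) p
      ... | t , _ , refl = inner (proj₂ (g q)) (suc t , tail-rev-od t)
      e∉ : ∀ {d} → d ∈ bs ++ ds → e ≢ d
      e∉ p refl with ∈-++⁻ bs p
      ... | inj₁ q = let t , _ , eq = ∈-applyUpTo⁻ (rev ∘ od) q in ¬p (t , eq)
      ... | inj₂ q = inner (proj₂ (g q)) on
      mem : ∀ {d} → d ∈ bs ++ ds → d ∈ w
      mem p with ∈-++⁻ bs p
      ... | inj₁ q with ∈-applyUpTo⁻ (rev ∘ od) q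
      ... | t , _ , refl = border t
      mem p | inj₂ q = proj₁ (g q)
      len : length (e ∷ bs ++ ds) ≡ suc (L + 2 * length I)
      len = cong suc (trans (length-++ bs) (cong₂ _+_ (length-applyUpTo (rev ∘ od) L) l))

  -- Each dart leaving a vertex of O is a border dart, which forces the walk down along O one index
  -- at a time. It must end on reaching `c₀`, since the only way on is `d₀`.
  trace : ∀ j {ws} → j < L → Path (O j) ws c₀ → d₀ ∉ ws →
          (∀ {e} → e ∈ ws → OnO (tail e) → IsRevOd e) → reverse (map head ws) ≡ applyUpTo O j
  trace zero    j<L stop _ _ = refl
  trace zero    j<L (step {d = e} p q) d₀∉ only with only (here refl) (0 , p)
  ... | t , refl = ⊥-elim (d₀∉ (here (cong rev (od-cong (O-cancel
          (trans (trans (cong O suc-L∸1) O-L) (trans (sym p) (tail-rev-od t))))))))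
  trace (suc j) {[]} j<L p _ _ = ⊥-elim (absurd p)
    where absurd : Path (O (suc j)) [] c₀ → ⊥
          absurd p = 0≢1+n (sym (O-inj (suc j) 0 j<L (≤-trans (s≤s z≤n) j<L) (end p)))
            where end : ∀ {u v} → Path u [] v → u ≡ v
                  end stop = refl
  trace (suc j) j<L (step {d = e} {ds = ds} p q) d₀∉ only with only (here refl) (suc j , p)
  ... | t , refl = begin
      reverse (head (rev (od t)) ∷ map head ds)       ≡⟨ unfold-reverse _ (map head ds) ⟩
      reverse (map head ds) ∷ʳ head (rev (od t))      ≡⟨ cong₂ _∷ʳ_ (trace j (<-trans (n<1+n j) j<L)
                                                           (subst (λ x → Path x ds c₀) h q) (d₀∉ ∘ there) (only ∘ there)) h ⟩
      applyUpTo O j ∷ʳ O j                            ≡⟨ applyUpTo-∷ʳ O j ⟩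
      applyUpTo O (suc j)                             ∎
    where
    open ≡-Reasoning
    h : head (rev (od t)) ≡ O j
    h = trans (head-rev-od t) (O-cancel (trans (sym (tail-rev-od t)) p))

  -- Reversal turns the anticlockwise walk into the clockwise order of the sides. Heads rather than
  -- tails are taken, so that the reversed list begins with `c₀`.
  word : List Dart → List (Fin V)
  word w = reverse (map head w)

  word-++ : ∀ α β → word (α ++ β) ≡ word β ++ word α
  word-++ α β = trans (cong reverse (map-++ head α β)) (reverse-++ (map head α) (map head β))

  word-last : ∀ {u v} d α → Path u (d ∷ α) v → ∃ λ A → word (d ∷ α) ≡ v ∷ A
  word-last d []      (step _ stop) = [] , refl
  word-last d (e ∷ α) (step _ p) = let A , q = word-last e α p in
    A ∷ʳ head d , trans (unfold-reverse (head d) (map head (e ∷ α))) (cong (_∷ʳ head d) q)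

  module Leaf {w : List Dart} {I : List (Fin V)} {x : Fin V} (R : Around w I) (x∈ : x ∈ I) (one : Around.One R x) where
    open Around R

    a = proj₁ one
    a∈ = proj₁ (proj₂ one)
    tail-a = proj₁ (proj₂ (proj₂ one))
    only = proj₂ (proj₂ (proj₂ one))
    ¬on : ¬ OnO x
    ¬on = inner x∈

    record Spike : Set where
      field
        α β   : List Dart
        d     : Dart
        split : w ≡ (d₀ ∷ α) ++ d ∷ a ∷ β
        turn  : a ≡ rev d
        hd    : head d ≡ x

    -- The dart `d` entering `x` ends off O, so it is no border dart and its reverse occurs on the
    -- walk. That reverse leaves `x`, and `a` is the only dart to do so: the walk turns back at `x`.
    spike : Spike
    spike with ∈-∃++ a∈
    ... | α , β , e with initLast α
    ... | [] = ⊥-elim (¬on (0 , trans (sym tail-a) (trans (cong tail (∷-injectiveˡ (trans (sym e) (proj₂ start)))) tail-d₀)))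
    ... | α′ ∷ʳ′ d = go α′ (trans e (++-assoc α′ (d ∷ []) (a ∷ β)))
      where
      go : ∀ α′ → w ≡ α′ ++ d ∷ a ∷ β → Spike
      go α′ e with Path-split α′ (subst (λ w → Path c₀ w c₀) e path)
      ... | _ , _ , step _ (step p _) = go′ α′ e
        where
        h : head d ≡ x
        h = trans (sym p) tail-a
        d∈ : d ∈ w
        d∈ = subst (d ∈_) (sym e) (∈-++⁺ʳ α′ (here refl))
        t : a ≡ rev d
        t with revs d∈
        ... | inj₁ (t , refl) = ⊥-elim (¬on (t , trans (sym h) (head-rev-od t)))
        ... | inj₂ r = sym (only r h)
        go′ : ∀ α′ → w ≡ α′ ++ d ∷ a ∷ β → Spike
        go′ [] e with trans (sym e) (proj₂ start)
        ... | refl = ⊥-elim (¬on (_ , trans (sym h) (head-rev-od (L ∸ 1))))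
        go′ (b ∷ α″) e with trans (sym e) (proj₂ start)
        ... | refl = record { α = α″ ; β = β ; d = d ; split = e ; turn = t ; hd = h }

    open Spike spike public

    α₀ : List Dart
    α₀ = d₀ ∷ α

    w′ : List Dart
    w′ = α₀ ++ β

    unique₀ : Unique (α₀ ++ d ∷ a ∷ β)
    unique₀ = subst Unique split unique

    unique₁ : Unique (α₀ ++ a ∷ β) × d ∉ α₀ ++ a ∷ β
    unique₁ = unique-delete α₀ unique₀

    unique₂ : Unique w′ × a ∉ w′
    unique₂ = unique-delete α₀ (proj₁ unique₁)

    d∉ : d ∉ w′
    d∉ p = proj₂ unique₁ (∈-undelete α₀ p)

    keep : ∀ {e} → e ∈ w → e ≢ d → e ≢ a → e ∈ w′
    keep p n m = ∈-delete α₀ (∈-delete α₀ (subst (_ ∈_) split p) n) m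

    embed : ∀ {e} → e ∈ w′ → e ∈ w
    embed p = subst (_ ∈_) (sym split) (∈-undelete α₀ (∈-undelete α₀ p))

    paths : ∃ λ v → Path c₀ α₀ v × Path v (d ∷ a ∷ β) c₀
    paths = Path-split α₀ (subst (λ w → Path c₀ w c₀) split path)

    head-a : head a ≡ tail d
    head-a = trans (cong head turn) (head-rev d)

    path-α : Path c₀ α₀ (tail d)
    path-α with paths
    ... | _ , p , step e _ = subst (Path c₀ α₀) (sym e) p

    path-β : Path (tail d) β c₀
    path-β with paths
    ... | _ , _ , step _ (step _ p) = subst (λ x → Path x β c₀) head-a p

    -- The reverse of any dart entering `x` leaves `x`, hence is `a`, so that dart is the removed
    -- `d`. The shortened word therefore avoids `x`, as the constructor `ins` demands.
    fresh : ∀ {e} → e ∈ w′ → head e ≢ x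
    fresh {e} e∈ h with revs (embed e∈)
    ... | inj₁ (t , refl) = ¬on (t , trans (sym h) (head-rev-od t))
    ... | inj₂ r = d∉ (subst (_∈ w′) (rev-injective (trans (only r h) turn)) e∈)

    around : ∃ λ I′ → Around w′ I′
    around with ∈-∃++ x∈
    ... | I₁ , I₂ , eqI = I₁ ++ I₂ , record
      { path   = Path-++ path-α path-β
      ; start  = α ++ β , refl
      ; unique = proj₁ unique₂
      ; revs   = revs′
      ; border = λ t → keep (border t) (λ e → ¬on (t , trans (sym hd) (trans (cong head (sym e)) (head-rev-od t))))
                   (λ e → ¬on (suc t , trans (sym tail-a) (trans (cong tail (sym e)) (tail-rev-od t))))
      ; uniqI  = proj₁ uI
      ; inner  = λ p → inner (old p)
      ; cover  = cover′
      ; size   = ≤-pred (≤-pred (subst₂ _≤_ lenw lenI size))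
      }
      where
      uI = unique-delete I₁ (subst Unique eqI uniqI)
      old : ∀ {y} → y ∈ I₁ ++ I₂ → y ∈ I
      old p = subst (_ ∈_) (sym eqI) (∈-undelete I₁ p)
      lenw : length w ≡ suc (suc (length w′))
      lenw = trans (cong length split) (trans (length-delete α₀) (cong suc (length-delete α₀)))
      lenI : L + 2 * length I ≡ suc (suc (L + 2 * length (I₁ ++ I₂)))
      lenI = trans (cong (λ n → L + 2 * n) (trans (cong length eqI) (length-delete I₁))) (arith L (length (I₁ ++ I₂)))
        where arith : ∀ l n → l + 2 * suc n ≡ suc (suc (l + 2 * n))
              arith = solve-∀
      revs′ : ∀ {e} → e ∈ w′ → IsRevOd e ⊎ rev e ∈ w′
      revs′ {e} e∈ with revs (embed e∈)
      ... | inj₁ p = inj₁ p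
      ... | inj₂ r = inj₂ (keep r
              (λ q → proj₂ unique₂ (subst (_∈ w′) (trans (sym (rev-rev e)) (trans (cong rev q) (sym turn))) e∈))
              (λ q → d∉ (subst (_∈ w′) (rev-injective (trans q turn)) e∈)))
      next-tail : ∀ {u β} → Path u β c₀ → ¬ OnO u → ∃ λ b → b ∈ β × tail b ≡ u
      next-tail stop       n = ⊥-elim (n (0 , refl))
      next-tail (step e _) n = _ , here refl , e
      cover′ : ∀ {y} → y ∈ I₁ ++ I₂ → ∃ λ d → d ∈ w′ × tail d ≡ y
      cover′ {y} y∈ with cover (old y∈)
      ... | e , e∈ , te with e ≟ᵈ d
      -- The dart recorded at `y` was the removed `d`. After the cut the walk continues from
      -- `tail d`, and it cannot stop there because `y` is off O while the walk ends in `c₀`.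
      ... | yes refl = let b , b∈ , tb = next-tail path-β (λ o → inner (old y∈) (subst OnO te o)) in
                       b , ∈-++⁺ʳ α₀ b∈ , trans tb te
      ... | no e≢d = e , keep e∈ e≢d (λ e≡a → proj₂ uI (subst (_∈ I₁ ++ I₂) (trans (sym te) (trans (cong tail e≡a) tail-a)) y∈)) , te

    regrow : ∀ {c} → Grow (word w′) c → Grow (word w) (suc c)
    regrow {c} G with word-last d₀ α path-α
    ... | A , e = subst (λ y → Grow y (suc c)) (sym eq)
        (ins (word β) (subst (λ y → Grow y c) eq′ G) ¬on (subst (x ∉_) eq′ x∉) (proj₂ d , hd))
      where
      open ≡-Reasoning
      eq′ : word w′ ≡ word β ++ tail d ∷ A
      eq′ = trans (word-++ α₀ β) (cong (word β ++_) e)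
      eq : word w ≡ word β ++ tail d ∷ x ∷ tail d ∷ A
      eq = begin
        word w                                              ≡⟨ cong word split ⟩
        word (α₀ ++ (d ∷ a ∷ []) ++ β)                      ≡⟨ word-++ α₀ _ ⟩
        word ((d ∷ a ∷ []) ++ β) ++ word α₀                 ≡⟨ cong (_++ word α₀) (word-++ (d ∷ a ∷ []) β) ⟩
        (word β ++ head a ∷ head d ∷ []) ++ word α₀         ≡⟨ ++-assoc (word β) _ _ ⟩
        word β ++ head a ∷ head d ∷ word α₀                 ≡⟨ cong₂ (λ y z → word β ++ y ∷ z ∷ word α₀) head-a hd ⟩
        word β ++ tail d ∷ x ∷ word α₀                      ≡⟨ cong (λ z → word β ++ tail d ∷ x ∷ z) e ⟩
        word β ++ tail d ∷ x ∷ tail d ∷ A                   ∎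
      x∉ : x ∉ word w′
      x∉ p with ∈-map⁻ head (reverse⁻ p)
      ... | b , b∈ , h = fresh b∈ (sym h)

  peel : ∀ n {w I} → length w ≤ n → Around w I → ∃ (Grow (word w))
  peel n {w} {I} le R with Around.leaf-or-all R I (λ p → p)
  -- Here no inner vertex is visited exactly once. By `border-only` all darts leaving O follow the
  -- border, and `d₀` occurs once, so `trace` finds a single turn around it.
  ... | inj₂ two = 0 , subst (λ y → Grow y 0) (sym (done (Around.start R) (Around.path R) (Around.unique R) (Around.border-only R two))) base
    where
    open ≡-Reasoning
    done : ∀ {w} → (∃ λ w′ → w ≡ d₀ ∷ w′) → Path c₀ w c₀ → Unique w →
           (∀ {e} → e ∈ w → OnO (tail e) → IsRevOd e) → word w ≡ applyUpTo O L
    done (w′ , refl) (step _ p) (n ∷ _) only = begin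
      word (d₀ ∷ w′)                       ≡⟨ unfold-reverse _ (map head w′) ⟩
      word w′ ∷ʳ head d₀                   ≡⟨ cong₂ _∷ʳ_ (trace (L ∸ 1) (≤-reflexive suc-L∸1)
                                                (subst (λ x → Path x w′ c₀) h p) (λ q → All.lookup n q refl) (only ∘ there)) h ⟩
      applyUpTo O (L ∸ 1) ∷ʳ O (L ∸ 1)     ≡⟨ applyUpTo-∷ʳ O (L ∸ 1) ⟩
      applyUpTo O (suc (L ∸ 1))            ≡⟨ cong (applyUpTo O) suc-L∸1 ⟩
      applyUpTo O L                        ∎
      where h = head-rev-od (L ∸ 1)
  ... | inj₁ (x , x∈ , one) = next-stage n le
    where
    open Leaf R x∈ one
    shorter : suc (suc (length w′)) ≡ length w
    shorter = sym (trans (cong length split) (trans (length-delete α₀) (cong suc (length-delete α₀))))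
    next-stage : ∀ n → length w ≤ n → ∃ (Grow (word w))
    next-stage zero    le = ⊥-elim (<⇒≱ (s≤s z≤n) (subst (_≤ 0) (sym shorter) le))
    next-stage (suc n) le = let I′ , R′ = around
                                c , G = peel n (≤-trans (n≤1+n _) (≤-pred (subst (_≤ suc n) (sym shorter) le))) R′
                            in suc c , regrow G

  length-Grow : ∀ {ys c} → Grow ys c → length ys ≡ L + 2 * c
  length-Grow base = trans (length-applyUpTo O L) (sym (+-identityʳ L))
  length-Grow (ins α {u} {v} {β} {c} G _ _ _) = begin
    length (α ++ u ∷ v ∷ u ∷ β)           ≡⟨ length-delete α ⟩
    suc (length (α ++ v ∷ u ∷ β))         ≡⟨ cong suc (length-delete α) ⟩
    suc (suc (length (α ++ u ∷ β)))       ≡⟨ cong (suc ∘ suc) (length-Grow G) ⟩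
    suc (suc (L + 2 * c))                 ≡⟨ arith L c ⟩
    L + 2 * suc c                         ∎
    where
    open ≡-Reasoning
    arith : ∀ l n → suc (suc (l + 2 * n)) ≡ l + 2 * suc n
    arith = solve-∀

-- The length of the boundary walk, and edges as chords of its word

module Unfold (Π : PolyEmb) where
  open Plane Π
  open Growth Π
  open Peeling Π

  Δ : Disc
  Δ = proj₁ disc

  open Disc Δ

  in-region : ∀ {d} → face d ≢ outer → face d ∈ region
  in-region {d} n with proj₂ disc d
  ... | inj₁ p = p
  ... | inj₂ p = ⊥-elim (n p)

  starts finishes : List Dart
  starts   = map proj₁ chords
  finishes = map (rev ∘ proj₁) chords

  data Kind (d : Dart) : Set where
    onBoundary : d ∈ boundary → Kind d
    chord      : ∀ {p q} → (d , p , q) ∈ chords → Kind d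
    chordRev   : ∀ {e p q} → (e , p , q) ∈ chords → d ≡ rev e → Kind d

  kind : ∀ {d} → face d ≢ outer → Kind d
  kind n with ∈-++⁻ boundary (∈-resp-↭ perm (complete (in-region n)))
  ... | inj₁ p = onBoundary p
  ... | inj₂ p with ∈-++⁻ starts p
  ... | inj₁ q with ∈-map⁻ proj₁ q
  ... | _ , r , refl = chord r
  kind n | inj₂ p | inj₂ q with ∈-map⁻ (rev ∘ proj₁) q
  ... | _ , r , refl = chordRev r refl

  unique-all : Unique (boundary ++ starts ++ finishes)
  unique-all = Unique-resp-↭ perm unique

  not-chord : ∀ {d p q} → d ∈ boundary → (d , p , q) ∈ chords → ⊥
  not-chord x y = unique-++-disjoint boundary unique-all x (∈-++⁺ˡ (∈-map⁺ proj₁ y))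

  not-chordRev : ∀ {d p q} → rev d ∈ boundary → (d , p , q) ∈ chords → ⊥
  not-chordRev x y = unique-++-disjoint boundary unique-all x (∈-++⁺ʳ starts (∈-map⁺ (rev ∘ proj₁) y))

  chord-face : ∀ {d p q} → (d , p , q) ∈ chords → face d ∈ region
  chord-face x = sound (∈-resp-↭ (↭-sym perm) (∈-++⁺ʳ boundary (∈-++⁺ˡ (∈-map⁺ proj₁ x))))

  chordRev-face : ∀ {d p q} → (d , p , q) ∈ chords → face (rev d) ∈ region
  chordRev-face x = sound (∈-resp-↭ (↭-sym perm) (∈-++⁺ʳ boundary (∈-++⁺ʳ starts (∈-map⁺ (rev ∘ proj₁) x))))

  -- Both directions of a chord are covered, whereas `od t` lies on the outer face, which is outside
  -- the region.
  border′ : ∀ t → rev (od t) ∈ boundary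
  border′ t with kind (rev-od-inner t)
  ... | onBoundary p = p
  ... | chord p      = ⊥-elim (outer∉ (subst (_∈ region) (trans (cong face (rev-rev (od t))) (face-od t)) (chordRev-face p)))
  ... | chordRev p e = ⊥-elim (outer∉ (subst (_∈ region) (trans (cong face (sym (rev-injective e))) (face-od t)) (chord-face p)))

  revs′ : ∀ {d} → d ∈ boundary → IsRevOd d ⊎ rev d ∈ boundary
  revs′ {d} d∈ with face (rev d) ≟ᶠ outer
  ... | yes p = let t , _ , e = outer-od p in inj₁ (t , trans (sym (rev-rev d)) (cong rev e))
  ... | no n with kind n
  ... | onBoundary p = inj₂ p
  ... | chord p      = ⊥-elim (not-chordRev (subst (_∈ boundary) (sym (rev-rev d)) d∈) p)
  ... | chordRev p e = ⊥-elim (not-chord d∈ (subst (λ x → (x , _) ∈ chords) (sym (rev-injective e)) p))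

  dart-at : ∀ {x} → ¬ OnO x → Fin (deg x)
  dart-at {x} n with connected x c₀
  ... | ε           = ⊥-elim (n (0 , refl))
  ... | (i , _) ◅ _ = i

  verts-tail : ∀ {p x} → ¬ OnO x → verts boundary [ p ]= x → ∃ λ d → d ∈ boundary × tail d ≡ x
  verts-tail n at with at-++⁻ (map tail boundary) at
  ... | inj₁ p = let d , q , e = at-map⁻ tail boundary p in d , at-∈ q , sym e
  ... | inj₂ (_ , _ , here) = ⊥-elim (n (0 , refl))

  -- Chords end at positions of the boundary walk, so gluing never hides a vertex in the interior of
  -- the disc.
  cover′ : ∀ {x} → ¬ OnO x → ∃ λ d → d ∈ boundary × tail d ≡ x
  cover′ {x} n with kind {x , dart-at n} (λ e → let t , _ , eq = outer-od e in n (t , trans (cong tail eq) (od-tl t)))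
  ... | onBoundary p    = _ , p , refl
  ... | chord p         = verts-tail n (proj₁ (proj₂ (ends p)))
  ... | chordRev p e    = verts-tail n (subst (verts boundary [ _ ]=_) (sym (cong tail e)) (proj₂ (proj₂ (ends p))))

  I : List (Fin V)
  I = filter (¬? ∘ OnO?) (allFin V)

  V≤L+I : V ≤ L + length I
  V≤L+I = subst₂ _≤_ (length-tabulate {n = V} (λ i → i))
    (trans (length-++ (applyUpTo O L)) (cong (_+ length I) (length-applyUpTo O L)))
    (unique-length {ys = applyUpTo O L ++ I} (allFin⁺ V) λ {x} _ → mem x)
    where
    mem : ∀ x → x ∈ applyUpTo O L ++ I
    mem x with OnO? x
    ... | yes p = let t , e = OnO-reduce p in ∈-++⁺ˡ (subst (_∈ applyUpTo O L) (sym e) (∈-applyUpTo⁺ O (toℕ<n t)))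
    ... | no n  = ∈-++⁺ʳ (applyUpTo O L) (∈-filter⁺ (¬? ∘ OnO?) (∈-allFin x) n)

  F≤ : F ≤ suc (suc (length chords))
  F≤ = subst₂ _≤_ (length-tabulate {n = F} (λ i → i)) (cong suc count)
    (unique-length {ys = outer ∷ region} (allFin⁺ F) λ {f} _ → mem f)
    where
    mem : ∀ f → f ∈ outer ∷ region
    mem f with surj f
    ... | d , refl with proj₂ disc d
    ... | inj₁ p = there p
    ... | inj₂ p = here p

  -- the only use of Euler's formula
  boundary-short : length boundary + L ≤ 2 * V
  boundary-short = +-cancelʳ-≤ (2 * F) _ _ (begin
    length boundary + L + 2 * F              ≤⟨ +-monoʳ-≤ (length boundary + L) (*-monoʳ-≤ 2 F≤) ⟩
    length boundary + L + 2 * suc (suc k)    ≡⟨ arith (length boundary) L k ⟩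
    length boundary + (k + k) + L + 4        ≡⟨ cong (λ n → n + L + 4) (sym len) ⟩
    length covered + L + 4                   ≡⟨ cong (λ n → length covered + n + 4) (sym (length-applyUpTo od L)) ⟩
    length covered + length bs + 4           ≡⟨ cong (_+ 4) (sym (length-++ covered)) ⟩
    length (covered ++ bs) + 4               ≤⟨ +-monoˡ-≤ 4 (unique-length (++⁺ unique unique-bs apart) (λ {x} _ → ∈-darts x)) ⟩
    length darts + 4                         ≡⟨ cong (_+ 4) length-darts ⟩
    sumDeg + 4                               ≡⟨ sym euler ⟩
    2 * V + 2 * F                            ∎)
    where
    open ≤-Reasoning
    k = length chords
    bs = applyUpTo od L
    arith : ∀ b l k → b + l + 2 * suc (suc k) ≡ b + (k + k) + l + 4
    arith = solve-∀
    len : length covered ≡ length boundary + (k + k)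
    len = trans (↭-length perm) (trans (length-++ boundary) (cong (length boundary +_)
      (trans (length-++ starts) (cong₂ _+_ (length-map proj₁ chords) (length-map (rev ∘ proj₁) chords)))))
    unique-bs : Unique bs
    unique-bs = applyUpTo⁺₁ od L λ {i} {j} i<j j<L eq →
      <⇒≢ i<j (O-inj i j (<-trans i<j j<L) j<L (trans (sym (od-tl i)) (trans (cong tail eq) (od-tl j))))
    apart : ∀ {d} → ¬ (d ∈ covered × d ∈ bs)
    apart (p , q) with ∈-applyUpTo⁻ od q
    ... | t , _ , refl = outer∉ (subst (_∈ region) (face-od t) (sound p))

  around : Around boundary I
  around = record
    { path   = path
    ; start  = start
    ; unique = unique-++ˡ boundary unique-all
    ; revs   = revs′
    ; border = border′
    ; uniqI  = filter⁺ (¬? ∘ OnO?) (allFin⁺ V)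
    ; inner  = λ p → proj₂ (∈-filter⁻ (¬? ∘ OnO?) {xs = allFin V} p)
    ; cover  = λ p → cover′ (proj₂ (∈-filter⁻ (¬? ∘ OnO?) {xs = allFin V} p))
    ; size   = +-cancelʳ-≤ L _ _ (≤-trans boundary-short (subst (2 * V ≤_) (arith L (length I)) (*-monoʳ-≤ 2 V≤L+I)))
    }
    where arith : ∀ l i → 2 * (l + i) ≡ l + 2 * i + l
          arith = solve-∀

  -- `c₀` is excepted in `edges`: it is both the first and the last entry of `verts`, and only one
  -- of the two is kept in the word. Edges at corners are realised separately.
  record Unfolding : Set where
    field
      letters : List (Fin V)
      steps   : ℕ
      grown   : Grow letters steps
      few     : L + steps ≤ V
      all     : ∀ x → x ∈ letters
      links   : List (ℕ × ℕ)
      nocross : NonCrossing links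
      edges   : ∀ {x y} → Adj x y → x ≢ c₀ → y ≢ c₀ → Σ ℕ λ p → Σ ℕ λ q → (p , q) ∈ links × p < q ×
                ((letters [ p ]= x × letters [ q ]= y) ⊎ (letters [ p ]= y × letters [ q ]= x))

  M : ℕ
  M = length boundary

  verts≡ : ∀ {u w} → Path u w c₀ → verts w ≡ u ∷ map head w
  verts≡ stop          = refl
  verts≡ (step refl p) = cong (_ ∷_) (verts≡ p)

  verts-step : ∀ {u w d} → Path u w c₀ → d ∈ w → ∃ λ j → verts w [ j ]= tail d × verts w [ suc j ]= head d
  verts-step (step _ p) (here refl) = 0 , here , there (verts-head p)
  verts-step (step _ p) (there q)   = let j , a , b = verts-step p q in suc j , there a , there b

  length-verts : length (verts boundary) ≡ suc M
  length-verts = trans (length-++ (map tail boundary)) (trans (+-comm _ 1) (cong suc (length-map tail boundary)))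

  verts-≤ : ∀ {p x} → verts boundary [ p ]= x → p ≤ M
  verts-≤ a = ≤-pred (subst (_ <_) length-verts (at-< a))

  word-at : ∀ {p x} → x ≢ c₀ → verts boundary [ p ]= x → word boundary [ M ∸ p ]= x
  word-at {p} {x} n a with at-++⁻ (word boundary) {c₀ ∷ []} (subst₂ (λ ys k → ys [ k ]= x)
      (trans (cong reverse (verts≡ path)) (unfold-reverse c₀ (map head boundary)))
      (cong (_∸ suc p) length-verts) (at-reverse a))
  ... | inj₁ q              = q
  ... | inj₂ (_ , _ , here) = ⊥-elim (n refl)

  -- The boundary walk runs anticlockwise, the sides are read clockwise.
  flip : Dart × ℕ × ℕ → ℕ × ℕ
  flip (_ , p , q) = M ∸ q , M ∸ p

  -- Edges of the walk itself are treated as chords too, because neighbouring letters may later be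
  -- separated by mirrored entries and pads.
  consecutive : List (ℕ × ℕ)
  consecutive = applyUpTo (λ i → i , suc i) M

  nocross′ : NonCrossing (map flip chords ++ consecutive)
  nocross′ i j x y z with ∈-++⁻ (map flip chords) i | ∈-++⁻ (map flip chords) j
  ... | inj₁ p | inj₁ q with ∈-map⁻ flip p | ∈-map⁻ flip q
  ... | (_ , _ , _) , i′ , refl | (_ , _ , _) , j′ , refl =
        nocross j′ i′ (∸-cancelʳ-< {o = M} z) (∸-cancelʳ-< {o = M} y) (∸-cancelʳ-< {o = M} x)
  nocross′ i j x y z | inj₂ p | _ with ∈-applyUpTo⁻ (λ i → i , suc i) p
  ... | _ , _ , refl = <⇒≱ y x
  nocross′ i j x y z | inj₁ _ | inj₂ q with ∈-applyUpTo⁻ (λ i → i , suc i) q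
  ... | _ , _ , refl = <⇒≱ z y

  edge-boundary : ∀ {d} → tail d ≢ c₀ → head d ≢ c₀ → d ∈ boundary → Σ ℕ λ p → Σ ℕ λ q →
    (p , q) ∈ map flip chords ++ consecutive × p < q × word boundary [ p ]= head d × word boundary [ q ]= tail d
  edge-boundary {d} m n d∈ with verts-step path d∈
  ... | j , a , b = M ∸ suc j , M ∸ j ,
      ∈-++⁺ʳ (map flip chords) (subst (λ k → (M ∸ suc j , k) ∈ consecutive) eq
        (∈-applyUpTo⁺ (λ i → i , suc i) (subst (_≤ M) (sym eq) (m∸n≤m M j)))) ,
      subst (M ∸ suc j <_) eq (n<1+n _) , word-at n b , word-at m a
    where
    eq : suc (M ∸ suc j) ≡ M ∸ j
    eq = sym (+-∸-assoc 1 (verts-≤ b))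

  edge-chord : ∀ {d p q} → tail d ≢ c₀ → head d ≢ c₀ → (d , p , q) ∈ chords → Σ ℕ λ p → Σ ℕ λ q →
    (p , q) ∈ map flip chords ++ consecutive × p < q × word boundary [ p ]= head d × word boundary [ q ]= tail d
  edge-chord {p = p} {q} m n c = let p<q , a , b = ends c in
    M ∸ q , M ∸ p , ∈-++⁺ˡ (∈-map⁺ flip c) , ∸-monoʳ-< p<q (verts-≤ b) , word-at n b , word-at m a

  unfold : Unfolding
  unfold = record
    { letters = word boundary
    ; steps   = proj₁ grown
    ; grown   = proj₂ grown
    ; few     = few
    ; all     = all
    ; links   = map flip chords ++ consecutive
    ; nocross = nocross′
    ; edges   = edges
    }
    where
    grown = peel M ≤-refl around
    len : L + 2 * proj₁ grown ≡ M
    len = trans (sym (length-Grow (proj₂ grown))) (trans (length-reverse (map head boundary)) (length-map head boundary))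
    arith : ∀ l c → l + 2 * c + l ≡ 2 * (l + c)
    arith = solve-∀
    few : L + proj₁ grown ≤ V
    few = *-cancelˡ-≤ 2 (subst (_≤ 2 * V) (trans (cong (_+ L) (sym len)) (arith L (proj₁ grown))) boundary-short)
    all : ∀ x → x ∈ word boundary
    all x with OnO? x
    ... | yes (t , refl) = reverse⁺ (subst (_∈ map head boundary) (head-rev-od t) (∈-map⁺ head (border′ t)))
    ... | no n with cover′ n
    ... | d , d∈ , refl with verts-step path d∈
    ... | j , a , _ = at-∈ (word-at (λ e → n (0 , e)) a)
    edges : ∀ {x y} → Adj x y → x ≢ c₀ → y ≢ c₀ → Σ ℕ λ p → Σ ℕ λ q → (p , q) ∈ map flip chords ++ consecutive × p < q ×
            ((word boundary [ p ]= x × word boundary [ q ]= y) ⊎ (word boundary [ p ]= y × word boundary [ q ]= x))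
    edges {x} (i , refl) m n with face (x , i) ≟ᶠ outer
    ... | yes o = let t , _ , e = outer-od o
                      p , q , c , lt , a , b = edge-boundary n (subst (_≢ c₀) (sym (head-rev (x , i))) m)
                                                 (subst (λ d → rev d ∈ boundary) (sym e) (border′ t))
                  in p , q , c , lt , inj₁ (subst (word boundary [ p ]=_) (head-rev (x , i)) a , b)
    ... | no o with kind o
    ... | onBoundary k = let p , q , c , lt , a , b = edge-boundary m n k in p , q , c , lt , inj₂ (a , b)
    ... | chord k      = let p , q , c , lt , a , b = edge-chord m n k in p , q , c , lt , inj₂ (a , b)
    ... | chordRev {e} k eq = let te = trans (cong head eq) (head-rev e)
                                  he = cong tail eq
                                  p , q , c , lt , a , b = edge-chord (subst (_≢ c₀) te n) (subst (_≢ c₀) he m) k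
      in p , q , c , lt , inj₁ (subst (word boundary [ p ]=_) (sym he) a , subst (word boundary [ q ]=_) (sym te) b)

-- Words: shifting, orienting, cutting and splicing

bump-cancel-≤ : ∀ a k {x y} → bump a k x ≤ bump a k y → x ≤ y
bump-cancel-≤ a k le = ≮⇒≥ λ lt → <⇒≱ (bump-mono a k lt) le

-- On a mirrored side the ends of caps move by `bump r 2` and the real entries by `bump (suc r) 2`.
-- The two maps differ only at `r`; this lemma and the next compare them.
bump-suc-< : ∀ r k {b m} → b < m → bump r k b < bump (suc r) k m
bump-suc-< zero    k {b}     {suc m} (s≤s p) = s≤s (+-monoʳ-≤ k p)
bump-suc-< (suc r) k {zero}  {suc m} p       = s≤s z≤n
bump-suc-< (suc r) k {suc b} {suc m} (s≤s p) = s≤s (bump-suc-< r k p)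

bump-suc-≤ : ∀ r k m → bump (suc r) k m ≤ bump r k m
bump-suc-≤ zero    k zero    = z≤n
bump-suc-≤ zero    k (suc m) = ≤-reflexive (sym (+-suc k m))
bump-suc-≤ (suc r) k zero    = z≤n
bump-suc-≤ (suc r) k (suc m) = s≤s (bump-suc-≤ r k m)

module _ {A : Set} where

  -- The default will be the corner beyond the word, so a side without interior vertices needs no
  -- separate case: the neighbour of one corner is then the other.
  hd : A → List A → A
  hd d []      = d
  hd d (x ∷ _) = x

  lst : A → List A → A
  lst d []       = d
  lst d (x ∷ xs) = lst x xs

  lst-∷ʳ : ∀ d xs (x : A) → lst d (xs ∷ʳ x) ≡ x
  lst-∷ʳ d []       x = refl
  lst-∷ʳ d (y ∷ xs) x = lst-∷ʳ y xs x

  hd-++ : ∀ d (xs ys : List A) → hd d (xs ++ ys) ≡ hd (hd d ys) xs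
  hd-++ d []      ys = refl
  hd-++ d (_ ∷ _) ys = refl

  hd-reverse : ∀ d (xs : List A) → hd d (reverse xs) ≡ lst d xs
  hd-reverse d [] = refl
  hd-reverse d (x ∷ xs) = trans (cong (hd d) (unfold-reverse x xs))
    (trans (hd-++ d (reverse xs) (x ∷ [])) (hd-reverse x xs))

  lst-reverse : ∀ d (xs : List A) → lst d (reverse xs) ≡ hd d xs
  lst-reverse d xs = trans (sym (hd-reverse d (reverse xs))) (cong (hd d) (reverse-involutive xs))

  orient : Bool → List A → List A
  orient b xs = if b then xs else reverse xs

  orient-involutive : ∀ b (xs : List A) → orient b (orient b xs) ≡ xs
  orient-involutive true  xs = refl
  orient-involutive false xs = reverse-involutive xs

  length-orient : ∀ b (xs : List A) → length (orient b xs) ≡ length xs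
  length-orient true  xs = refl
  length-orient false xs = length-reverse xs

  orient-wrap : ∀ b x (ys : List A) z →
    orient b (x ∷ ys ++ z ∷ []) ≡ (if b then x else z) ∷ orient b ys ++ (if b then z else x) ∷ []
  orient-wrap true  x ys z = refl
  orient-wrap false x ys z = trans (unfold-reverse x (ys ++ z ∷ [])) (cong (_∷ʳ x) (reverse-++ ys (z ∷ [])))

  ∈-orient⁻ : ∀ b {xs : List A} {x} → x ∈ orient b xs → x ∈ xs
  ∈-orient⁻ true  p = p
  ∈-orient⁻ false p = reverse⁻ p

  -- Replacing one entry by three, symmetrically, commutes with reorienting.
  orient-splice : ∀ b {xs α β : List A} {u} → orient b xs ≡ α ++ u ∷ β →
    Σ (List A) λ α′ → Σ (List A) λ β′ → xs ≡ α′ ++ u ∷ β′ ×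
      (∀ v → orient b (α′ ++ u ∷ v ∷ u ∷ β′) ≡ α ++ u ∷ v ∷ u ∷ β)
  orient-splice true  {α = α} {β} e = α , β , e , λ _ → refl
  orient-splice false {xs} {α} {β} {u} e = reverse β , reverse α ,
    trans (sym (reverse-involutive xs)) (trans (cong reverse e) (eq α β)) ,
    λ v → begin
      reverse (reverse β ++ (u ∷ v ∷ u ∷ []) ++ reverse α)           ≡⟨ reverse-++ (reverse β) _ ⟩
      reverse ((u ∷ v ∷ u ∷ []) ++ reverse α) ++ reverse (reverse β)  ≡⟨ cong₂ _++_ (reverse-++ (u ∷ v ∷ u ∷ []) (reverse α)) (reverse-involutive β) ⟩
      (reverse (reverse α) ++ u ∷ v ∷ u ∷ []) ++ β                    ≡⟨ ++-assoc (reverse (reverse α)) _ _ ⟩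
      reverse (reverse α) ++ u ∷ v ∷ u ∷ β                            ≡⟨ cong (_++ u ∷ v ∷ u ∷ β) (reverse-involutive α) ⟩
      α ++ u ∷ v ∷ u ∷ β                                              ∎
    where
    open ≡-Reasoning
    eq : ∀ α β → reverse (α ++ u ∷ β) ≡ reverse β ++ u ∷ reverse α
    eq α β = trans (reverse-++ α (u ∷ β)) (trans (cong (_++ reverse α) (unfold-reverse u β)) (++-assoc (reverse β) _ _))

  ++-split : ∀ (xs : List A) {ys α u β} → xs ++ ys ≡ α ++ u ∷ β →
    (Σ (List A) λ β₁ → xs ≡ α ++ u ∷ β₁ × β ≡ β₁ ++ ys) ⊎
    (Σ (List A) λ α₁ → α ≡ xs ++ α₁ × ys ≡ α₁ ++ u ∷ β)
  ++-split []       {α = α}     e = inj₂ (α , refl , e)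
  ++-split (x ∷ xs) {α = []}    refl = inj₁ (xs , refl , refl)
  ++-split (x ∷ xs) {α = y ∷ α} e with ∷-injective e
  ... | refl , e′ with ++-split xs e′
  ... | inj₁ (β₁ , refl , f) = inj₁ (β₁ , refl , f)
  ... | inj₂ (α₁ , refl , f) = inj₂ (α₁ , refl , f)

  -- Besides the block containing the marked entry it returns a continuation, which reassembles the
  -- word from any family that agrees with `f` outside that block.
  concat-splice : ∀ {n} (f : Fin n → List A) {α u β} → concat (tabulate f) ≡ α ++ u ∷ β →
    Σ (Fin n) λ k → Σ (List A) λ α₁ → Σ (List A) λ β₁ → f k ≡ α₁ ++ u ∷ β₁ ×
      (∀ (g : Fin n → List A) γ → (∀ j → j ≢ k → g j ≡ f j) → g k ≡ α₁ ++ γ ++ β₁ →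
        concat (tabulate g) ≡ α ++ γ ++ β)
  concat-splice {zero}  f {[]}    ()
  concat-splice {zero}  f {_ ∷ _} ()
  concat-splice {suc n} f {α} {u} {β} e with ++-split (f fzero) e
  ... | inj₁ (β₁ , f₀ , refl) = fzero , α , β₁ , f₀ , λ g γ same g₀ → begin
      g fzero ++ concat (tabulate (g ∘ fsuc))    ≡⟨ cong₂ _++_ g₀ (cong concat (tabulate-cong (λ j → same (fsuc j) λ ()))) ⟩
      (α ++ γ ++ β₁) ++ rest                     ≡⟨ ++-assoc α (γ ++ β₁) rest ⟩
      α ++ (γ ++ β₁) ++ rest                     ≡⟨ cong (α ++_) (++-assoc γ β₁ rest) ⟩
      α ++ γ ++ β₁ ++ rest                       ∎
    where open ≡-Reasoning
          rest = concat (tabulate (f ∘ fsuc))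
  ... | inj₂ (α₂ , refl , e′) with concat-splice (f ∘ fsuc) e′
  ... | k , α₁ , β₁ , fk , cont = fsuc k , α₁ , β₁ , fk , λ g γ same gk →
      trans (cong₂ _++_ (same fzero λ ()) (cont (g ∘ fsuc) γ (λ j n → same (fsuc j) (n ∘ fsuc-inj)) gk))
        (sym (++-assoc (f fzero) α₂ (γ ++ β)))
    where fsuc-inj : ∀ {n} {i j : Fin n} → fsuc i ≡ fsuc j → i ≡ j
          fsuc-inj refl = refl

  ∈-concat-tabulate⁺ : ∀ {n} (f : Fin n → List A) k {x} → x ∈ f k → x ∈ concat (tabulate f)
  ∈-concat-tabulate⁺ f fzero    p = ∈-++⁺ˡ p
  ∈-concat-tabulate⁺ f (fsuc k) p = ∈-++⁺ʳ (f fzero) (∈-concat-tabulate⁺ (f ∘ fsuc) k p)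

module _ {A B : Set} where

  zip-wrap⁻ : ∀ {x z : A} {x′ z′ : B} ys ys′ {a b} → length ys ≡ length ys′ →
    (a , b) ∈ zip (x ∷ ys ++ z ∷ []) (x′ ∷ ys′ ++ z′ ∷ []) →
    (a ≡ x × b ≡ x′) ⊎ (∃ λ n → ys [ n ]= a × ys′ [ n ]= b) ⊎ (a ≡ z × b ≡ z′)
  zip-wrap⁻ {z = z} {z′ = z′} ys ys′ {a} {b} l (here refl) = inj₁ (refl , refl)
  zip-wrap⁻ {z = z} {z′ = z′} ys ys′ {a} {b} l (there p)   = inj₂ (go ys ys′ l p)
    where
    go : ∀ ys ys′ → length ys ≡ length ys′ → (a , b) ∈ zip (ys ++ z ∷ []) (ys′ ++ z′ ∷ []) →
         (∃ λ n → ys [ n ]= a × ys′ [ n ]= b) ⊎ (a ≡ z × b ≡ z′)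
    go []       []         l (here refl) = inj₂ (refl , refl)
    go (y ∷ ys) (y′ ∷ ys′) l (here refl) = inj₁ (0 , here , here)
    go (y ∷ ys) (y′ ∷ ys′) l (there p) with go ys ys′ (suc-injective l) p
    ... | inj₁ (n , q , r) = inj₁ (suc n , there q , there r)
    ... | inj₂ q           = inj₂ q

  zip-wrap-last : ∀ {x z : A} {x′ z′ : B} ys ys′ → length ys ≡ length ys′ →
    (z , z′) ∈ zip (x ∷ ys ++ z ∷ []) (x′ ∷ ys′ ++ z′ ∷ [])
  zip-wrap-last {z = z} {z′ = z′} ys ys′ l = there (go ys ys′ l)
    where
    go : ∀ ys ys′ → length ys ≡ length ys′ → (z , z′) ∈ zip (ys ++ z ∷ []) (ys′ ++ z′ ∷ [])
    go []       []         l = here refl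
    go (y ∷ ys) (y′ ∷ ys′) l = there (go ys ys′ (suc-injective l))

Closed-under : {A : Set} → (A → A → Set) → (A → Set) → Set
Closed-under R P = ∀ {a b} → R a b → (P a → P b) × (P b → P a)

closure-preserves : ∀ {A : Set} {R : A → A → Set} {P : A → Set} → Closed-under R P →
                    ∀ {a b} → EqClosure R a b → P a → P b
closure-preserves f ε            p = p
closure-preserves f (fwd r ◅ rs) p = closure-preserves f rs (proj₁ (f r) p)
closure-preserves f (bwd r ◅ rs) p = closure-preserves f rs (proj₂ (f r) p)

-- Label words whose entries are flagged `true` when they come from the side itself and `false`
-- when they mirror the twin side.
module _ {A : Set} where

  labels : List (A × Bool) → List A
  labels = map proj₁

  reals : List (A × Bool) → List A
  reals []                = []
  reals ((u , true)  ∷ xs) = u ∷ reals xs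
  reals ((u , false) ∷ xs) = reals xs

  reals-++ : ∀ xs ys → reals (xs ++ ys) ≡ reals xs ++ reals ys
  reals-++ []                 ys = refl
  reals-++ ((u , true)  ∷ xs) ys = cong (u ∷_) (reals-++ xs ys)
  reals-++ ((u , false) ∷ xs) ys = reals-++ xs ys

  reals-reverse : ∀ xs → reals (reverse xs) ≡ reverse (reals xs)
  reals-reverse [] = refl
  reals-reverse (x@(u , true) ∷ xs) = trans (cong reals (unfold-reverse x xs)) (trans (reals-++ (reverse xs) _)
    (trans (cong (_∷ʳ u) (reals-reverse xs)) (sym (unfold-reverse u (reals xs)))))
  reals-reverse (x@(u , false) ∷ xs) = trans (cong reals (unfold-reverse x xs)) (trans (reals-++ (reverse xs) _)
    (trans (++-identityʳ _) (reals-reverse xs)))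

  reals-orient : ∀ b xs → reals (orient b xs) ≡ orient b (reals xs)
  reals-orient true  xs = refl
  reals-orient false xs = reals-reverse xs

  ∈-reals : ∀ {xs u} → u ∈ reals xs → u ∈ labels xs
  ∈-reals {(u , true)  ∷ xs} (here e)  = here e
  ∈-reals {(u , true)  ∷ xs} (there p) = there (∈-reals p)
  ∈-reals {(u , false) ∷ xs} p         = there (∈-reals {xs} p)

  -- Only the two added entries get the flag `g`. On a mirrored side a real entry at `r` thus stays
  -- at `r`, to the left of everything a cap from `r` to `r + 2` has to keep free.
  splice : ℕ → A → Bool → List (A × Bool) → List (A × Bool)
  splice r       v g []            = []
  splice zero    v g ((u , f) ∷ xs) = (u , f) ∷ (v , g) ∷ (u , g) ∷ xs
  splice (suc r) v g (x ∷ xs)      = x ∷ splice r v g xs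

  splice-length : ∀ r v g xs → r < length xs → length (splice r v g xs) ≡ 2 + length xs
  splice-length zero    v g (x ∷ xs) _       = refl
  splice-length (suc r) v g (x ∷ xs) (s≤s p) = cong suc (splice-length r v g xs p)

  -- Positions `r` and `r + 2` carry the same label, so the old entry at `r` may be traced to
  -- `r + 2`; labels, caps and links then all move by the one map `bump r 2`.
  splice-old : ∀ r v g xs {x w} → labels xs [ x ]= w → labels (splice r v g xs) [ bump r 2 x ]= w
  splice-old zero    v g (y ∷ xs) here      = there (there here)
  splice-old zero    v g (y ∷ xs) (there p) = there (there (there p))
  splice-old (suc r) v g (y ∷ xs) here      = here
  splice-old (suc r) v g (y ∷ xs) (there p) = there (splice-old r v g xs p)

  splice-at : ∀ r v g xs {w} → labels xs [ r ]= w → labels (splice r v g xs) [ r ]= w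
  splice-at zero    v g (y ∷ xs) here      = here
  splice-at (suc r) v g (y ∷ xs) (there p) = there (splice-at r v g xs p)

  splice⁻ : ∀ r v g xs {x w} → labels (splice r v g xs) [ x ]= w →
         (∃ λ m → x ≡ bump r 2 m × labels xs [ m ]= w) ⊎ (x ≡ r × labels xs [ r ]= w) ⊎ (x ≡ suc r × w ≡ v)
  splice⁻ zero    v g (y ∷ xs) here                      = inj₂ (inj₁ (refl , here))
  splice⁻ zero    v g (y ∷ xs) (there here)              = inj₂ (inj₂ (refl , refl))
  splice⁻ zero    v g (y ∷ xs) (there (there here))      = inj₁ (0 , refl , here)
  splice⁻ zero    v g (y ∷ xs) (there (there (there p))) = inj₁ (_ , refl , there p)
  splice⁻ (suc r) v g (y ∷ xs) here                      = inj₁ (0 , refl , here)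
  splice⁻ (suc r) v g (y ∷ xs) (there p) with splice⁻ r v g xs p
  ... | inj₁ (m , e , q)      = inj₁ (suc m , cong suc e , there q)
  ... | inj₂ (inj₁ (e , q))   = inj₂ (inj₁ (cong suc e , there q))
  ... | inj₂ (inj₂ (e , q))   = inj₂ (inj₂ (cong suc e , q))

  splice-reals : ∀ r v xs → reals (splice r v false xs) ≡ reals xs
  splice-reals r       v []                 = refl
  splice-reals zero    v ((u , true)  ∷ xs) = refl
  splice-reals zero    v ((u , false) ∷ xs) = refl
  splice-reals (suc r) v ((u , true)  ∷ xs) = cong (u ∷_) (splice-reals r v xs)
  splice-reals (suc r) v ((u , false) ∷ xs) = splice-reals r v xs

  reals-splice : ∀ xs {α u β} → reals xs ≡ α ++ u ∷ β →
    ∃ λ r → xs [ r ]= (u , true) × (∀ v → reals (splice r v true xs) ≡ α ++ u ∷ v ∷ u ∷ β)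
  reals-splice [] {[]}    ()
  reals-splice [] {_ ∷ _} ()
  reals-splice ((u , true) ∷ xs) {[]} refl = 0 , here , λ v → refl
  reals-splice ((u , true) ∷ xs) {_ ∷ α} e with ∷-injective e
  ... | refl , e′ = let r , a , f = reals-splice xs e′ in suc r , there a , λ v → cong (u ∷_) (f v)
  reals-splice ((u , false) ∷ xs) e = let r , a , f = reals-splice xs e in suc r , there a , f

  splice-own : ∀ r v xs {x w} → splice r v true xs [ x ]= (w , true) →
            (∃ λ m → x ≡ bump r 2 m × ∃ λ w → xs [ m ]= (w , true)) ⊎ (r ≤ x × x ≤ r + 2)
  splice-own zero    v (y ∷ xs) here                      = inj₂ (z≤n , z≤n)
  splice-own zero    v (y ∷ xs) (there here)              = inj₂ (z≤n , s≤s z≤n)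
  splice-own zero    v (y ∷ xs) (there (there here))      = inj₂ (z≤n , s≤s (s≤s z≤n))
  splice-own zero    v (y ∷ xs) (there (there (there p))) = inj₁ (_ , refl , _ , there p)
  splice-own (suc r) v (y ∷ xs) here                      = inj₁ (0 , refl , _ , here)
  splice-own (suc r) v (y ∷ xs) (there p) with splice-own r v xs p
  ... | inj₁ (m , e , w , q) = inj₁ (suc m , cong suc e , w , there q)
  ... | inj₂ (a , b)         = inj₂ (s≤s a , s≤s b)

  splice-foreign : ∀ r v xs {x w} → splice r v false xs [ x ]= (w , true) →
                ∃ λ m → x ≡ bump (suc r) 2 m × xs [ m ]= (w , true)
  splice-foreign zero    v (y ∷ xs) here                      = 0 , refl , here
  splice-foreign zero    v (y ∷ xs) (there (there (there p))) = _ , refl , there p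
  splice-foreign (suc r) v (y ∷ xs) here                      = 0 , refl , here
  splice-foreign (suc r) v (y ∷ xs) (there p) = let m , e , q = splice-foreign r v xs p in suc m , cong suc e , there q

  splice-hd : ∀ r v g xs d → hd d (labels (splice r v g xs)) ≡ hd d (labels xs)
  splice-hd r       v g []       d = refl
  splice-hd zero    v g (x ∷ xs) d = refl
  splice-hd (suc r) v g (x ∷ xs) d = refl

  splice-lst : ∀ r v g xs d → lst d (labels (splice r v g xs)) ≡ lst d (labels xs)
  splice-lst r       v g []       d = refl
  splice-lst zero    v g (x ∷ xs) d = refl
  splice-lst (suc r) v g (x ∷ xs) d = splice-lst r v g xs _

  splice-Pointwise : ∀ {R : A → A → Set} r v g g′ {xs ys} → R v v → Pointwise R (labels xs) (labels ys) →
                  Pointwise R (labels (splice r v g xs)) (labels (splice r v g′ ys))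
  splice-Pointwise r       v g g′ {[]}     {[]}     rv []       = []
  splice-Pointwise zero    v g g′ {x ∷ xs} {y ∷ ys} rv (p ∷ ps) = p ∷ rv ∷ p ∷ ps
  splice-Pointwise (suc r) v g g′ {x ∷ xs} {y ∷ ys} rv (p ∷ ps) = p ∷ splice-Pointwise r v g g′ rv ps

  Pointwise-at : ∀ {R : A → A → Set} {xs ys n x y} → Pointwise R xs ys → xs [ n ]= x → ys [ n ]= y → R x y
  Pointwise-at (p ∷ ps) here      here      = p
  Pointwise-at (p ∷ ps) (there a) (there b) = Pointwise-at ps a b

-- The sides of the embedding and their sewing

step-mono : ∀ {n} (f : Fin (suc n) → ℕ) → (∀ i → f (inject₁ i) < f (fsuc i)) →
            ∀ i j → toℕ i < toℕ j → f i < f j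
step-mono {suc n} f up fzero (fsuc fzero) _ = up fzero
step-mono {suc n} f up fzero (fsuc (fsuc j)) _ =
  <-trans (up fzero) (step-mono (f ∘ fsuc) (up ∘ fsuc) fzero (fsuc j) (s≤s z≤n))
step-mono {suc n} f up (fsuc i) (fsuc j) (s≤s p) = step-mono (f ∘ fsuc) (up ∘ fsuc) i j p

step-mono-≤ : ∀ {n} (f : Fin (suc n) → ℕ) → (∀ i → f (inject₁ i) < f (fsuc i)) →
              ∀ i j → toℕ i ≤ toℕ j → f i ≤ f j
step-mono-≤ f up i j p with m≤n⇒m<n∨m≡n p
... | inj₁ q = <⇒≤ (step-mono f up i j q)
... | inj₂ q = ≤-reflexive (cong f (toℕ-injective q))

next-inject : ∀ {n} (k : Fin n) → (inject₁ (next k) ≡ fsuc k) ⊎ (inject₁ (next k) ≡ fzero × fsuc k ≡ fromℕ n)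
next-inject {suc n} k with next-cases k
... | inj₁ (_ , e) = inj₁ (toℕ-injective (trans (toℕ-inject₁ _) e))
... | inj₂ (e , z) = inj₂ (toℕ-injective (trans (toℕ-inject₁ _) z) , toℕ-injective (cong suc (trans e (sym (toℕ-fromℕ n)))))

next-surjective : ∀ {n} (k : Fin n) → ∃ λ j → next j ≡ k
next-surjective {suc n} k with next-reach (next k) k
... | zero  , _ , e = k , e
... | suc c , _ , e = _ , e

two-elements : ∀ {n} → n ≡ 2 → (i a b : Fin n) → a ≢ b → i ≡ a ⊎ i ≡ b
two-elements refl fzero        fzero        _            _ = inj₁ refl
two-elements refl fzero        (fsuc fzero) fzero        _ = inj₂ refl
two-elements refl fzero        (fsuc fzero) (fsuc fzero) n = ⊥-elim (n refl)
two-elements refl (fsuc fzero) (fsuc fzero) _            _ = inj₁ refl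
two-elements refl (fsuc fzero) fzero        (fsuc fzero) _ = inj₂ refl
two-elements refl (fsuc fzero) fzero        fzero        n = ⊥-elim (n refl)

module Sides (Π : PolyEmb) where
  open Plane Π
  open Peeling Π using (OnO; Grow; base; ins; O-cancel; tail-rev-od; head-rev-od)

  s : ℕ
  s = length σ

  open QGraph (sewing (toBordered Π)) public using (_~_)

  lo hi : Fin s → ℕ
  lo k = q (inject₁ k)
  hi k = q (fsuc k)

  int : Fin s → ℕ
  int k = hi k ∸ suc (lo k)

  hi≡ : ∀ k → hi k ≡ suc (lo k + int k)
  hi≡ k = sym (m+[n∸m]≡n (q-mono k))

  seg : ℕ → ℕ → List (Fin V)
  seg a n = applyUpTo (λ x → O (a + x)) n

  cor : Fin s → Fin V
  cor k = O (lo k)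

  R₀ : Fin s → List (Fin V)
  R₀ k = seg (suc (lo k)) (int k)

  pos : Fin s → Bool
  pos = positive σ

  Y₀ : Fin s → List (Fin V)
  Y₀ k = orient (pos k) (R₀ k)

  hi≤L : ∀ k → hi k ≤ L
  hi≤L k = subst (hi k ≤_) q-s (step-mono-≤ q q-mono (fsuc k) (fromℕ s)
    (subst (suc (toℕ k) ≤_) (sym (toℕ-fromℕ s)) (toℕ<n k)))

  lo<L : ∀ k → lo k < L
  lo<L k = <-≤-trans (q-mono k) (hi≤L k)

  hi≤lo : ∀ {k j} → toℕ k < toℕ j → hi k ≤ lo j
  hi≤lo {k} {j} p = step-mono-≤ q q-mono (fsuc k) (inject₁ j) (subst (suc (toℕ k) ≤_) (sym (toℕ-inject₁ j)) p)

  cor-next : ∀ k → O (hi k) ≡ cor (next k)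
  cor-next k with next-inject k
  ... | inj₁ e        = cong (O ∘ q) (sym e)
  ... | inj₂ (z , e)  = trans (cong (O ∘ q) e) (trans (cong O q-s) (trans O-L (trans (cong O (sym q-0)) (cong (O ∘ q) (sym z)))))

  locate-side : ∀ {k j t u} → lo k ≤ t → t < hi k → lo j ≤ u → u < hi j → t ≡ u → k ≡ j
  locate-side {k} {j} a b c d refl with <-cmp (toℕ k) (toℕ j)
  ... | tri< p _ _ = ⊥-elim (<⇒≱ b (≤-trans (hi≤lo p) c))
  ... | tri≈ _ p _ = toℕ-injective p
  ... | tri> _ _ p = ⊥-elim (<⇒≱ d (≤-trans (hi≤lo p) a))

  cor-injective : ∀ {k j} → cor k ≡ cor j → k ≡ j
  cor-injective {k} {j} e = locate-side ≤-refl (q-mono k) ≤-refl (q-mono j) (O-inj _ _ (lo<L k) (lo<L j) e)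

  Corner : Fin V → Set
  Corner u = ∃ λ k → u ≡ cor k

  InR₀ : Fin s → Fin V → Set
  InR₀ k u = ∃ λ t → lo k < t × t < hi k × u ≡ O t

  ∈R₀ : ∀ {k u} → u ∈ R₀ k → InR₀ k u
  ∈R₀ {k} p = let x , x<n , e = ∈-applyUpTo⁻ _ p in
    suc (lo k) + x , s≤s (m≤m+n (lo k) x) , subst (suc (lo k + x) <_) (sym (hi≡ k)) (s≤s (+-monoʳ-< (lo k) x<n)) , e

  InR₀-side : ∀ {k j u} → InR₀ k u → InR₀ j u → k ≡ j
  InR₀-side (t , a , b , e) (t′ , a′ , b′ , e′) = locate-side (<⇒≤ a) b (<⇒≤ a′) b′
    (O-inj t t′ (<-≤-trans b (hi≤L _)) (<-≤-trans b′ (hi≤L _)) (trans (sym e) e′))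

  InR₀-¬Corner : ∀ {k u} → InR₀ k u → ¬ Corner u
  InR₀-¬Corner {k} (t , a , b , e) (j , f) with O-inj t (lo j) (<-≤-trans b (hi≤L _)) (lo<L j) (trans (sym e) f)
  ... | refl with locate-side {k} {j} (<⇒≤ a) b ≤-refl (q-mono j) refl
  ... | refl = <-irrefl refl a

  ∈Y₀ : ∀ {k u} → u ∈ Y₀ k → InR₀ k u
  ∈Y₀ {k} p = ∈R₀ (∈-orient⁻ (pos k) p)

  R₀-unique : ∀ k → Unique (R₀ k)
  R₀-unique k = applyUpTo⁺₁ _ (int k) λ {i} {j} i<j j<n e →
    <⇒≢ i<j (+-cancelˡ-≡ (suc (lo k)) i j (O-inj _ _ (lt (<-trans i<j j<n)) (lt j<n) e))
    where
    lt : ∀ {x} → x < int k → suc (lo k) + x < L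
    lt {x} x<n = <-≤-trans (subst (suc (lo k) + x <_) (sym (hi≡ k)) (s≤s (+-monoʳ-< (lo k) x<n))) (hi≤L k)

  Y₀-unique : ∀ k → Unique (Y₀ k)
  Y₀-unique k with pos k
  ... | true  = R₀-unique k
  ... | false = Unique-resp-↭ (↭-sym (↭-reverse (R₀ k))) (R₀-unique k)

  int-twin : ∀ {i j} → letter σ i ≡ letter σ j → int i ≡ int j
  int-twin {i} {j} e = begin
    hi i ∸ suc (lo i)    ≡⟨ cong (hi i ∸_) (+-comm 1 (lo i)) ⟩
    hi i ∸ (lo i + 1)    ≡⟨ sym (∸-+-assoc (hi i) (lo i) 1) ⟩
    hi i ∸ lo i ∸ 1      ≡⟨ cong (_∸ 1) (twin-len i j e) ⟩
    hi j ∸ lo j ∸ 1      ≡⟨ ∸-+-assoc (hi j) (lo j) 1 ⟩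
    hi j ∸ (lo j + 1)    ≡⟨ cong (hi j ∸_) (+-comm (lo j) 1) ⟩
    hi j ∸ suc (lo j)    ∎
    where open ≡-Reasoning

  length-Y₀ : ∀ k → length (Y₀ k) ≡ int k
  length-Y₀ k = trans (length-orient (pos k) (R₀ k)) (length-applyUpTo _ (int k))

  side≡ : ∀ k → side k ≡ cor k ∷ R₀ k ++ cor (next k) ∷ []
  side≡ k = begin
    map O (map (lo k +_) (upTo (suc (hi k ∸ lo k))))   ≡⟨ sym (map-∘ (upTo _)) ⟩
    map (λ x → O (lo k + x)) (upTo (suc (hi k ∸ lo k))) ≡⟨ map-applyUpTo id (λ x → O (lo k + x)) _ ⟩
    seg (lo k) (suc (hi k ∸ lo k))                      ≡⟨ cong (seg (lo k) ∘ suc) len ⟩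
    seg (lo k) (suc (suc (int k)))                      ≡⟨ cong₂ _∷_ (cong O (+-identityʳ (lo k))) (applyUpTo-cong (λ x → cong O (+-suc (lo k) x)) (suc (int k))) ⟩
    cor k ∷ seg (suc (lo k)) (suc (int k))              ≡⟨ cong (cor k ∷_) (sym (applyUpTo-∷ʳ _ (int k))) ⟩
    cor k ∷ R₀ k ++ O (suc (lo k) + int k) ∷ []         ≡⟨ cong (λ x → cor k ∷ R₀ k ++ x ∷ []) (trans (cong O (sym (hi≡ k))) (cor-next k)) ⟩
    cor k ∷ R₀ k ++ cor (next k) ∷ []                   ∎
    where
    open ≡-Reasoning
    len : hi k ∸ lo k ≡ suc (int k)
    len = trans (cong (_∸ lo k) (trans (hi≡ k) (sym (+-suc (lo k) (int k))))) (m+n∸m≡n (lo k) (suc (int k)))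
    applyUpTo-cong : ∀ {f g : ℕ → Fin V} → (∀ x → f x ≡ g x) → ∀ n → applyUpTo f n ≡ applyUpTo g n
    applyUpTo-cong e zero    = refl
    applyUpTo-cong e (suc n) = cong₂ _∷_ (e 0) (applyUpTo-cong (e ∘ suc) n)

  stk enk : Fin s → Fin s
  stk k = if pos k then k else next k
  enk k = if pos k then next k else k

  oside≡ : ∀ k → Bordered.oside (toBordered Π) k ≡ cor (stk k) ∷ Y₀ k ++ cor (enk k) ∷ []
  oside≡ k = trans (cong (orient (pos k)) (side≡ k)) (trans (orient-wrap (pos k) _ (R₀ k) _)
    (cong₂ (λ x y → x ∷ Y₀ k ++ y ∷ []) (push (pos k)) (push (pos k))))
    where
    push : ∀ b {i j : Fin s} → (if b then cor i else cor j) ≡ cor (if b then i else j)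
    push true  = refl
    push false = refl

  data Glued : Fin V → Fin V → Set where
    first  : ∀ {i j} → letter σ i ≡ letter σ j → Glued (cor (stk i)) (cor (stk j))
    middle : ∀ {i j x a b} → letter σ i ≡ letter σ j → Y₀ i [ x ]= a → Y₀ j [ x ]= b → Glued a b
    final  : ∀ {i j} → letter σ i ≡ letter σ j → Glued (cor (enk i)) (cor (enk j))

  Glue : Fin V → Fin V → Set
  Glue = Bordered.Glue (toBordered Π)

  same-length : ∀ {i j} → letter σ i ≡ letter σ j → length (Y₀ i) ≡ length (Y₀ j)
  same-length {i} {j} e = trans (length-Y₀ i) (trans (int-twin e) (sym (length-Y₀ j)))

  unglue : ∀ {a b} → Glue a b → Glued a b
  unglue {a} {b} (i , j , e , p)
    with zip-wrap⁻ (Y₀ i) (Y₀ j) (same-length e) (subst₂ (λ xs ys → (a , b) ∈ zip xs ys) (oside≡ i) (oside≡ j) p)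
  ... | inj₁ (refl , refl)        = first e
  ... | inj₂ (inj₁ (_ , x , y))   = middle e x y
  ... | inj₂ (inj₂ (refl , refl)) = final e

  glue : ∀ {a b} → Glued a b → a ~ b
  glue g = Eq.return (go g)
    where
    wrapped : ∀ {i j a b} → letter σ i ≡ letter σ j →
      (a , b) ∈ zip (cor (stk i) ∷ Y₀ i ++ cor (enk i) ∷ []) (cor (stk j) ∷ Y₀ j ++ cor (enk j) ∷ []) → Glue a b
    wrapped {i} {j} {a} {b} e p = i , j , e , subst₂ (λ xs ys → (a , b) ∈ zip xs ys) (sym (oside≡ i)) (sym (oside≡ j)) p
    go : ∀ {a b} → Glued a b → Glue a b
    go (first {i} {j} e)          = wrapped {i} {j} e (here refl)
    go (middle {i} {j} e x y)     = wrapped {i} {j} e (there (at-zip (at-++ˡ x) (at-++ˡ y)))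
    go (final {i} {j} e)          = wrapped {i} {j} e (zip-wrap-last (Y₀ i) (Y₀ j) (same-length e))

  ~-preserves : ∀ {P : Fin V → Set} → Closed-under Glued P → ∀ {a b} → a ~ b → P a → P b
  ~-preserves f = closure-preserves (f ∘ unglue)

  ~-corner : ∀ {a b} → a ~ b → Corner a → Corner b
  ~-corner = ~-preserves λ
    { (first e)      → (λ _ → _ , refl) , (λ _ → _ , refl)
    ; (middle e x y) → (λ c → ⊥-elim (InR₀-¬Corner (∈Y₀ (at-∈ x)) c)) , (λ c → ⊥-elim (InR₀-¬Corner (∈Y₀ (at-∈ y)) c))
    ; (final e)      → (λ _ → _ , refl) , (λ _ → _ , refl) }

  Glued-OnO : ∀ {a b} → Glued a b → OnO a × OnO b
  Glued-OnO (first e)      = (_ , refl) , (_ , refl)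
  Glued-OnO (middle e x y) = on (∈Y₀ (at-∈ x)) , on (∈Y₀ (at-∈ y))
    where on : ∀ {k u} → InR₀ k u → OnO u
          on (t , _ , _ , e) = t , e
  Glued-OnO (final e)      = (_ , refl) , (_ , refl)

  ~-inner : ∀ {v b} → ¬ OnO v → v ~ b → b ≡ v
  ~-inner {v} n r = ~-preserves {λ x → x ≡ v} (λ g →
      (λ { refl → ⊥-elim (n (proj₁ (Glued-OnO g))) }) , (λ { refl → ⊥-elim (n (proj₂ (Glued-OnO g))) })) r refl

  -- The two border darts at a corner are distinct, as a reversed border dart is not on the outer
  -- face. Degree two leaves no others.
  corner-darts : ∀ k d → tail d ≡ cor k → d ≡ od (lo k) ⊎ ∃ λ t → O (suc t) ≡ cor k × d ≡ rev (od t)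
  corner-darts k d e with pick d (od (lo k)) (rev (od t)) e (od-tl (lo k)) (trans (tail-rev-od t) Ot) different
    where
    t = L ∸ 1 + lo k
    Ot : O (suc t) ≡ cor k
    Ot = trans (cong (λ n → O (n + lo k)) suc-L∸1) (O-per (lo k))
    different : od (lo k) ≢ rev (od t)
    different e = rev-od-inner t (trans (cong face (sym e)) (face-od (lo k)))
    pick : ∀ d a b → tail d ≡ cor k → tail a ≡ cor k → tail b ≡ cor k → a ≢ b → d ≡ a ⊎ (O (suc t) ≡ cor k × d ≡ b)
    pick (_ , i) (_ , j) (_ , l) refl refl refl n with two-elements (corner-deg k) i j l (λ { refl → n refl })
    ... | inj₁ refl = inj₁ refl
    ... | inj₂ refl = inj₂ (Ot , refl)
  ... | inj₁ p = inj₁ p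
  ... | inj₂ (Ot , p) = inj₂ (_ , Ot , p)

  corner-¬inner : ∀ {k v} → Adj (cor k) v → OnO v
  corner-¬inner {k} (i , refl) with corner-darts k (cor k , i) refl
  ... | inj₁ e           = suc (lo k) , trans (cong head e) (od-hd (lo k))
  ... | inj₂ (t , _ , e) = t , trans (cong head e) (head-rev-od t)

-- Label words for the sides: the invariant and its initial instance

module Words (Π : PolyEmb) where
  open Plane Π
  open Peeling Π using (OnO; Grow; base; ins)
  open Sides Π

  Place : Set
  Place = Fin s × ℕ

  -- The connections between places that the sewn half-grid will supply: glue between twin sides,
  -- and caps. The chords of the walk are reserved for edges between branch sets.
  data Link (Y : Fin s → List (Fin V × Bool)) (caps : Fin s → List (ℕ × ℕ)) : Place → Place → Set where
    across : ∀ {i j x} → letter σ i ≡ letter σ j → x < length (Y i) → Link Y caps (i , x) (j , x)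
    cap    : ∀ {k x y} → (x , y) ∈ caps k → Link Y caps (k , x) (k , y)

  spell : (Fin s → List (Fin V)) → List (Fin V)
  spell R = concat (tabulate λ k → cor k ∷ orient (pos k) (R k))

  -- Label words for the sides, read along their orientations so that twin sides carry the same
  -- word up to gluing.  A mirrored walk around a tree keeps the occurrences of each vertex
  -- connected by caps, chords that enclose no label of the side itself.
  record State (lw : List (Fin V)) (c : ℕ) : Set where
    field
      Y       : Fin s → List (Fin V × Bool)
      caps    : Fin s → List (ℕ × ℕ)
      spelled : spell (reals ∘ Y) ≡ lw
      size    : ∀ k → length (Y k) ≤ int k + 2 * c
      twin    : ∀ {i j} → letter σ i ≡ letter σ j → Pointwise _~_ (labels (Y i)) (labels (Y j))
      capEnds : ∀ {k a b} → (a , b) ∈ caps k → a < b × ∃ λ w → labels (Y k) [ a ]= w × labels (Y k) [ b ]= w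
      -- The right end b is included: only then can u v u be inserted at any real u without
      -- putting real labels under a cap.
      capFree : ∀ {k a b x w} → (a , b) ∈ caps k → Y k [ x ]= (w , true) → a < x → x ≤ b → ⊥
      capsNC  : ∀ k → NonCrossing (caps k)
      known   : ∀ {k x w} → labels (Y k) [ x ]= w → w ∈ lw × ¬ Corner w
      front   : ∀ k d → hd d (labels (Y k)) ≡ hd d (Y₀ k)
      rear    : ∀ k d → lst d (labels (Y k)) ≡ lst d (Y₀ k)
      conn    : ∀ {i j x y w w′} → labels (Y i) [ x ]= w → labels (Y j) [ y ]= w′ → w ~ w′ →
                EqClosure (Link Y caps) (i , x) (j , y)

  seg-++ : ∀ a m n → seg a (m + n) ≡ seg a m ++ seg (a + m) n
  seg-++ a zero    n = cong (λ x → seg x n) (sym (+-identityʳ a))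
  seg-++ a (suc m) n = cong (O (a + 0) ∷_) (trans (shift a (m + n)) (trans (seg-++ (suc a) m n)
    (cong₂ _++_ (sym (shift a m)) (cong (λ x → seg x n) (sym (+-suc a m))))))
    where
    shift : ∀ a n → applyUpTo (λ x → O (a + suc x)) n ≡ seg (suc a) n
    shift a n = trans (sym (map-applyUpTo (λ x → a + suc x) O n)) (trans (cong (map O) (go n id)) (map-applyUpTo (λ x → suc a + x) O n))
      where
      go : ∀ n (f : ℕ → ℕ) → applyUpTo (λ x → a + suc (f x)) n ≡ applyUpTo (λ x → suc a + f x) n
      go zero    f = refl
      go (suc n) f = cong₂ _∷_ (+-suc a (f 0)) (go n (f ∘ suc))

  -- The corner positions cut the cycle into blocks, a corner followed by the interior of its side.
  -- An arbitrary increasing `f` lets the induction drop the first block.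
  seg-concat : ∀ {n} (f : Fin (suc n) → ℕ) → (∀ i → f (inject₁ i) < f (fsuc i)) →
    concat (tabulate λ k → O (f (inject₁ k)) ∷ seg (suc (f (inject₁ k))) (f (fsuc k) ∸ suc (f (inject₁ k))))
      ≡ seg (f fzero) (f (fromℕ n) ∸ f fzero)
  seg-concat {zero}  f up = cong (seg (f fzero)) (sym (n∸n≡0 (f fzero)))
  seg-concat {suc n} f up = begin
    (O a ∷ seg (suc a) (b ∸ suc a)) ++ _        ≡⟨ cong ((O a ∷ seg (suc a) (b ∸ suc a)) ++_) (seg-concat (f ∘ fsuc) (up ∘ fsuc)) ⟩
    (O a ∷ seg (suc a) (b ∸ suc a)) ++ seg b (e ∸ b)
      ≡⟨ cong₂ _++_ (cong₂ (λ x y → O x ∷ seg y (b ∸ suc a)) (sym (+-identityʳ a)) (+-comm 1 a)) (cong (λ x → seg x (e ∸ b)) (sym ab)) ⟩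
    (O (a + 0) ∷ seg (a + 1) (b ∸ suc a)) ++ seg (a + (suc (b ∸ suc a))) (e ∸ b)
      ≡⟨ cong (_++ seg (a + (suc (b ∸ suc a))) (e ∸ b)) (sym (seg-++ a 1 (b ∸ suc a))) ⟩
    seg a (suc (b ∸ suc a)) ++ seg (a + (suc (b ∸ suc a))) (e ∸ b)    ≡⟨ sym (seg-++ a (suc (b ∸ suc a)) (e ∸ b)) ⟩
    seg a (suc (b ∸ suc a) + (e ∸ b))           ≡⟨ cong (seg a) total ⟩
    seg a (e ∸ a)                               ∎
    where
    open ≡-Reasoning
    a = f fzero
    b = f (fsuc fzero)
    e = f (fsuc (fromℕ n))
    ab : a + suc (b ∸ suc a) ≡ b
    ab = trans (+-suc a (b ∸ suc a)) (m+[n∸m]≡n (up fzero))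
    b≤e : b ≤ e
    b≤e = step-mono-≤ (f ∘ fsuc) (up ∘ fsuc) fzero (fromℕ n) z≤n
    total : suc (b ∸ suc a) + (e ∸ b) ≡ e ∸ a
    total = +-cancelˡ-≡ a _ _ (trans (sym (+-assoc a _ _)) (trans (cong (_+ (e ∸ b)) ab)
      (trans (m+[n∸m]≡n b≤e) (sym (m+[n∸m]≡n (≤-trans (<⇒≤ (up fzero)) b≤e))))))

  module Start where

    Y : Fin s → List (Fin V × Bool)
    Y k = map (_, true) (Y₀ k)

    labels-Y : ∀ k → labels (Y k) ≡ Y₀ k
    labels-Y k = trans (sym (map-∘ (Y₀ k))) (map-id (Y₀ k))

    reals-true : ∀ (xs : List (Fin V)) → reals (map (_, true) xs) ≡ xs
    reals-true []       = refl
    reals-true (x ∷ xs) = cong (x ∷_) (reals-true xs)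

    spelled : spell (reals ∘ Y) ≡ applyUpTo O L
    spelled = trans (cong concat (tabulate-cong λ k → cong (cor k ∷_)
        (trans (cong (orient (pos k)) (reals-true (Y₀ k))) (orient-involutive (pos k) (R₀ k)))))
      (trans (seg-concat q q-mono) (cong₂ seg q-0 (cong₂ _∸_ q-s q-0)))

    at₀ : ∀ {k x w} → labels (Y k) [ x ]= w → Y₀ k [ x ]= w
    at₀ {k} {x} {w} = subst (_[ x ]= w) (labels-Y k)

    Linked = EqClosure (Link Y (λ _ → []))

    valid : ∀ {k x w} → Y₀ k [ x ]= w → x < length (Y k)
    valid {k} p = subst (_ <_) (sym (length-map (_, true) (Y₀ k))) (at-< p)

    same-place : ∀ {i j x y w} → Y₀ i [ x ]= w → Y₀ j [ y ]= w → (i , x) ≡ (j , y)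
    same-place {i} {j} p r with InR₀-side (∈Y₀ {i} (at-∈ p)) (∈Y₀ {j} (at-∈ r))
    ... | refl = cong (i ,_) (at-unique (Y₀-unique i) p r)

    Reached : Place → Fin V → Set
    Reached Q w = Σ Place λ P → Y₀ (proj₁ P) [ proj₂ P ]= w × Linked Q P

    -- Initially each label has a single place, so a chain of gluings between vertices lifts to a
    -- chain of links between places. It never meets a corner, since corners are glued to corners
    -- only.
    follow : ∀ {i x u w} → Y₀ i [ x ]= u → u ~ w → Reached (i , x) w
    follow {i} {x} p r = ~-preserves along r (_ , p , ε)
      where
      no-corner : ∀ {k} {B : Set} → Reached (i , x) (cor k) → B
      no-corner (_ , p , _) = ⊥-elim (InR₀-¬Corner (∈Y₀ (at-∈ p)) (_ , refl))
      along : Closed-under Glued (Reached (i , x))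
      along (first e) = no-corner , no-corner
      along (final e) = no-corner , no-corner
      along (middle {i₁} {j₁} {y} e a b) =
        (λ (P , p , l) → (j₁ , y) , b , Eq.transitive _ (subst (Linked (i , x)) (same-place p a) l) (Eq.return (across e (valid {i₁} a)))) ,
        (λ (P , p , l) → (i₁ , y) , a , Eq.transitive _ (subst (Linked (i , x)) (same-place p b) l) (Eq.return (across (sym e) (valid {j₁} b))))

    twin : ∀ {i j} → letter σ i ≡ letter σ j → Pointwise _~_ (Y₀ i) (Y₀ j)
    twin {i} {j} e = go (Y₀ i) (Y₀ j) (same-length e) (λ p r → glue (middle {i} {j} e p r))
      where
      go : ∀ xs ys → length xs ≡ length ys → (∀ {n x y} → xs [ n ]= x → ys [ n ]= y → x ~ y) → Pointwise _~_ xs ys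
      go []       []       _ f = []
      go (x ∷ xs) (y ∷ ys) l f = f here here ∷ go xs ys (suc-injective l) (λ p r → f (there p) (there r))

    start : State (applyUpTo O L) 0
    start = record
      { Y       = Y
      ; caps    = λ _ → []
      ; spelled = spelled
      ; size    = λ k → ≤-reflexive (trans (length-map (_, true) (Y₀ k)) (trans (length-Y₀ k) (sym (+-identityʳ (int k)))))
      ; twin    = λ {i} {j} e → subst₂ (Pointwise _~_) (sym (labels-Y i)) (sym (labels-Y j)) (twin e)
      ; capEnds = λ ()
      ; capFree = λ ()
      ; capsNC  = λ k ()
      ; known   = λ {k} p → let t , a , b , e = ∈Y₀ {k} (at-∈ (at₀ {k} p)) in
                  subst (_∈ applyUpTo O L) (sym e) (∈-applyUpTo⁺ O (<-≤-trans b (hi≤L k))) , InR₀-¬Corner {k} (t , a , b , e)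
      ; front   = λ k d → cong (hd d) (labels-Y k)
      ; rear    = λ k d → cong (lst d) (labels-Y k)
      ; conn    = λ {i} {j} p r w~ → let P , p′ , l = follow (at₀ {i} p) w~ in
                  subst (Linked _) (same-place p′ (at₀ {j} r)) l
      }

-- Inserting an inner vertex into the label words

module Insertion (Π : PolyEmb) where
  open Plane Π
  open Peeling Π using (OnO; Grow; base; ins)
  open Sides Π
  open Words Π

  module Insert {α β : List (Fin V)} {u v : Fin V} {c : ℕ} (S : State (α ++ u ∷ β) c)
                (¬on : ¬ OnO v) (fresh : v ∉ α ++ u ∷ β) (adj : Adj u v) where
    open State S

    record Spot : Set where
      field
        i₀      : Fin s
        r       : ℕ
        here₀   : Y i₀ [ r ]= (u , true)
        respell : ∀ R → (∀ k → k ≢ i₀ → R k ≡ reals (Y k)) → R i₀ ≡ reals (splice r v true (Y i₀)) →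
                  spell R ≡ α ++ u ∷ v ∷ u ∷ β

    abstract
      spot : Spot
      spot with concat-splice (λ k → cor k ∷ orient (pos k) (reals (Y k))) spelled
      ... | k , [] , β₁ , e , _ with ∷-injective e
      -- The first entry of a block is a corner, and both neighbours of a corner lie on O.
      ... | refl , _ = ⊥-elim (¬on (corner-¬inner {k} adj))
      spot | k , x ∷ α₁ , β₁ , e , cont with ∷-injective e
      ... | refl , e′ with orient-splice (pos k) e′
      ... | α₂ , β₂ , e₂ , f with reals-splice (Y k) e₂
      ... | r , a , g = record
        { i₀ = k ; r = r ; here₀ = a
        ; respell = λ R same own → cont (λ k → cor k ∷ orient (pos k) (R k)) (u ∷ v ∷ u ∷ [])
            (λ j n → cong (λ xs → cor j ∷ orient (pos j) xs) (same j n))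
            (cong (cor k ∷_) (trans (cong (orient (pos k)) (trans own (g v))) (f v)))
        }

    open Spot spot

    twice : Σ (Fin s) λ j → j ≢ i₀ × letter σ j ≡ letter σ i₀ × (∀ k → letter σ k ≡ letter σ i₀ → k ≡ i₀ ⊎ k ≡ j)
    twice = WFSig.twice σ-ok i₀

    j₀ : Fin s
    j₀ = proj₁ twice

    j₀≢i₀ : j₀ ≢ i₀
    j₀≢i₀ = proj₁ (proj₂ twice)

    letter-j₀ : letter σ j₀ ≡ letter σ i₀
    letter-j₀ = proj₁ (proj₂ (proj₂ twice))

    -- The flag is true on the side of `u` and false on its twin. The constructions below take the
    -- view as an argument, so that each invariant is proved by cases on an arbitrary view.
    data View (k : Fin s) : Set where
      hit   : (g : Bool) → letter σ k ≡ letter σ i₀ → (g ≡ true → k ≡ i₀) → (g ≡ false → k ≢ i₀) → View k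
      other : letter σ k ≢ letter σ i₀ → View k

    view : ∀ k → View k
    view k with letter σ k ≟ letter σ i₀ | k ≟ᶠ i₀
    ... | no n  | _      = other n
    ... | yes e | yes e′ = hit true e (λ _ → e′) λ ()
    ... | yes e | no n   = hit false e (λ ()) λ _ → n

    Yᵛ : ∀ k → View k → List (Fin V × Bool)
    Yᵛ k (hit g _ _ _) = splice r v g (Y k)
    Yᵛ k (other _)     = Y k

    move : ∀ k → View k → ℕ → ℕ
    move k (hit _ _ _ _) = bump r 2
    move k (other _)     = id

    both : ℕ × ℕ → ℕ × ℕ
    both (a , b) = bump r 2 a , bump r 2 b

    -- The new cap on the twin side encloses just position `r + 1`, the mirrored `v`. The side of
    -- `u` gets none, since chords of the walk may end at the real `v`.
    capsᵛ : ∀ k → View k → List (ℕ × ℕ)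
    capsᵛ k (hit true  _ _ _) = map both (caps k)
    capsᵛ k (hit false _ _ _) = (r , r + 2) ∷ map both (caps k)
    capsᵛ k (other _)         = caps k

    Y′ : Fin s → List (Fin V × Bool)
    Y′ k = Yᵛ k (view k)

    caps′ : Fin s → List (ℕ × ℕ)
    caps′ k = capsᵛ k (view k)

    lw′ : List (Fin V)
    lw′ = α ++ u ∷ v ∷ u ∷ β

    length-twin : ∀ {i j} → letter σ i ≡ letter σ j → length (Y i) ≡ length (Y j)
    length-twin {i} {j} e = trans (sym (length-map proj₁ (Y i))) (trans (Pointwise-length (twin e)) (length-map proj₁ (Y j)))

    r<length : ∀ {k} → letter σ k ≡ letter σ i₀ → r < length (Y k)
    r<length e = subst (r <_) (sym (length-twin e)) (at-< here₀)

    label-r : ∀ {k} → letter σ k ≡ letter σ i₀ → ∃ λ w → labels (Y k) [ r ]= w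
    label-r {k} e = at-exists (labels (Y k)) (subst (r <_) (sym (length-map proj₁ (Y k))) (r<length e))

    spelled′ : spell (reals ∘ Y′) ≡ lw′
    spelled′ = respell (reals ∘ Y′) (λ k n → off k n (view k)) (on (view i₀))
      where
      off : ∀ k → k ≢ i₀ → (w : View k) → reals (Yᵛ k w) ≡ reals (Y k)
      off k n (hit true  _ e _) = ⊥-elim (n (e refl))
      off k n (hit false _ _ _) = splice-reals r v (Y k)
      off k n (other _)         = refl
      on : (w : View i₀) → reals (Yᵛ i₀ w) ≡ reals (splice r v true (Y i₀))
      on (hit true  _ _ _) = refl
      on (hit false _ _ n) = ⊥-elim (n refl refl)
      on (other n)         = ⊥-elim (n refl)

    size′ : ∀ k (w : View k) → length (Yᵛ k w) ≤ int k + 2 * suc c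
    size′ k (hit g e _ _) = subst₂ _≤_ (sym (splice-length r v g (Y k) (r<length e))) (arith (int k) c) (s≤s (s≤s (size k)))
      where arith : ∀ i c → 2 + (i + 2 * c) ≡ i + 2 * suc c
            arith = solve-∀
    size′ k (other _) = ≤-trans (size k) (+-monoʳ-≤ (int k) (*-monoʳ-≤ 2 (n≤1+n c)))

    twin′ : ∀ {i j} (w : View i) (w′ : View j) → letter σ i ≡ letter σ j → Pointwise _~_ (labels (Yᵛ i w)) (labels (Yᵛ j w′))
    twin′ (hit g _ _ _) (hit g′ _ _ _) e = splice-Pointwise r v g g′ ε (twin e)
    twin′ (hit _ p _ _) (other n)      e = ⊥-elim (n (trans (sym e) p))
    twin′ (other n)     (hit _ p _ _)  e = ⊥-elim (n (trans e p))
    twin′ (other _)     (other _)      e = twin e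

    moved : ∀ {k} (w : View k) {x a} → labels (Y k) [ x ]= a → labels (Yᵛ k w) [ move k w x ]= a
    moved {k} (hit g _ _ _) p = splice-old r v g (Y k) p
    moved     (other _)     p = p

    capEnds′ : ∀ {k} (w : View k) {a b} → (a , b) ∈ capsᵛ k w →
               a < b × ∃ λ l → labels (Yᵛ k w) [ a ]= l × labels (Yᵛ k w) [ b ]= l
    capEnds′ (other _) p = capEnds p
    capEnds′ {k} w@(hit true _ _ _) p with ∈-map⁻ both p
    ... | _ , p′ , refl = let lt , l , a , b = capEnds p′ in bump-mono r 2 lt , l , moved w a , moved w b
    capEnds′ {k} (hit false e _ _) (here refl) = let l , a = label-r e in
      m<m+n r (s≤s z≤n) , l , splice-at r v false (Y k) a ,
      subst (λ x → labels (splice r v false (Y k)) [ x ]= l) (bump-self r 2) (splice-old r v false (Y k) a)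
    capEnds′ {k} w@(hit false _ _ _) (there p) with ∈-map⁻ both p
    ... | _ , p′ , refl = let lt , l , a , b = capEnds p′ in bump-mono r 2 lt , l , moved w a , moved w b

    r<→ : ∀ {a} → bump r 2 a < r + 2 → a < r
    r<→ {a} lt = bump-cancel r 2 (subst (bump r 2 a <_) (sym (bump-self r 2)) lt)

    r≤→ : ∀ {b} → r ≤ bump r 2 b → r ≤ b
    r≤→ {b} le with bump-gap r 2 b
    ... | inj₁ lt = ⊥-elim (<⇒≱ lt le)
    ... | inj₂ ge = bump-cancel-≤ r 2 (subst (_≤ bump r 2 b) (sym (bump-self r 2)) ge)

    capFree′ : ∀ {k} (w : View k) {a b x l} → (a , b) ∈ capsᵛ k w → Yᵛ k w [ x ]= (l , true) → a < x → x ≤ b → ⊥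
    capFree′ (other _) p y lt le = capFree p y lt le
    capFree′ {k} (hit true _ e _) p y lt le with ∈-map⁻ both p | splice-own r v (Y k) y
    ... | _ , p′ , refl | inj₁ (m , refl , _ , z) = capFree p′ z (bump-cancel r 2 lt) (bump-cancel-≤ r 2 le)
    ... | _ , p′ , refl | inj₂ (lo , hi) with e refl
    -- A cap over one of the three real entries `u`, `v`, `u` would already have had the old `u` at
    -- `r` under it or at its right end. This is why `capFree` includes that end.
    ... | refl = capFree p′ here₀ (r<→ (<-≤-trans lt hi)) (r≤→ (≤-trans lo le))
    capFree′ {k} (hit false _ _ _) (here refl) y lt le with splice-foreign r v (Y k) y
    ... | m , refl , z with bump-gap (suc r) 2 m
    ... | inj₁ q = <⇒≱ lt (≤-pred q)
    ... | inj₂ q = <⇒≱ q le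
    capFree′ {k} (hit false _ _ _) (there p) y lt le with ∈-map⁻ both p | splice-foreign r v (Y k) y
    ... | _ , p′ , refl | m , refl , z = capFree p′ z (bump-cancel r 2 (<-≤-trans lt (bump-suc-≤ r 2 m)))
          (≮⇒≥ λ b<m → <⇒≱ (bump-suc-< r 2 b<m) le)

    outside : ∀ x → r < bump r 2 x → bump r 2 x < r + 2 → ⊥
    outside x lo hi with bump-gap r 2 x
    ... | inj₁ p = <-asym lo p
    ... | inj₂ p = <⇒≱ hi p

    mapped-NC : ∀ k → NonCrossing (map both (caps k))
    mapped-NC k p q x y z with ∈-map⁻ both p | ∈-map⁻ both q
    ... | _ , p′ , refl | _ , q′ , refl = capsNC k p′ q′ (bump-cancel r 2 x) (bump-cancel r 2 y) (bump-cancel r 2 z)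

    capsNC′ : ∀ k (w : View k) → NonCrossing (capsᵛ k w)
    capsNC′ k (other _) = capsNC k
    capsNC′ k (hit true _ _ _) = mapped-NC k
    capsNC′ k (hit false _ _ _) (here refl) (here refl) x y z = <-irrefl refl x
    capsNC′ k (hit false _ _ _) (here refl) (there q) x y z with ∈-map⁻ both q
    ... | (a , _) , _ , refl = outside a x y
    capsNC′ k (hit false _ _ _) (there p) (here refl) x y z with ∈-map⁻ both p
    ... | (_ , b) , _ , refl = outside b y z
    capsNC′ k (hit false _ _ _) (there p) (there q) x y z = mapped-NC k p q x y z

    keep : ∀ {w} → w ∈ α ++ u ∷ β → w ∈ lw′
    keep p = ∈-undelete α (∈-undelete α p)

    known-old : ∀ {k x w} → labels (Y k) [ x ]= w → w ∈ lw′ × ¬ Corner w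
    known-old p = keep (proj₁ (known p)) , proj₂ (known p)

    known′ : ∀ {k} (w : View k) {x l} → labels (Yᵛ k w) [ x ]= l → l ∈ lw′ × ¬ Corner l
    known′ (other _) p = known-old p
    known′ {k} (hit g _ _ _) p with splice⁻ r v g (Y k) p
    ... | inj₁ (_ , _ , q)           = known-old q
    ... | inj₂ (inj₁ (_ , q))        = known-old q
    ... | inj₂ (inj₂ (_ , refl))     = ∈-++⁺ʳ α (there (here refl)) , λ (j , e) → ¬on (lo j , e)

    front′ : ∀ k (w : View k) d → hd d (labels (Yᵛ k w)) ≡ hd d (Y₀ k)
    front′ k (hit g _ _ _) d = trans (splice-hd r v g (Y k) d) (front k d)
    front′ k (other _)     d = front k d

    rear′ : ∀ k (w : View k) d → lst d (labels (Yᵛ k w)) ≡ lst d (Y₀ k)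
    rear′ k (hit g _ _ _) d = trans (splice-lst r v g (Y k) d) (rear k d)
    rear′ k (other _)     d = rear k d

    Linked : Place → Place → Set
    Linked = EqClosure (Link Y′ caps′)

    shift : Place → Place
    shift (k , x) = k , move k (view k) x

    valid : ∀ {k x} → x < length (Y k) → move k (view k) x < length (Y′ k)
    valid {k} {x} lt = let _ , a = at-exists (labels (Y k)) (subst (x <_) (sym (length-map proj₁ (Y k))) lt) in
      subst (move k (view k) x <_) (length-map proj₁ (Y′ k)) (at-< (moved (view k) a))

    move-twin : ∀ {i j} (w : View i) (w′ : View j) → letter σ i ≡ letter σ j → ∀ x → move i w x ≡ move j w′ x
    move-twin (hit _ _ _ _) (hit _ _ _ _) e x = refl
    move-twin (hit _ p _ _) (other n)     e x = ⊥-elim (n (trans (sym e) p))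
    move-twin (other n)     (hit _ p _ _) e x = ⊥-elim (n (trans e p))
    move-twin (other _)     (other _)     e x = refl

    move-cap : ∀ {k} (w : View k) {a b} → (a , b) ∈ caps k → (move k w a , move k w b) ∈ capsᵛ k w
    move-cap (hit true  _ _ _) p = ∈-map⁺ both p
    move-cap (hit false _ _ _) p = there (∈-map⁺ both p)
    move-cap (other _)         p = p

    shift-link : ∀ {P Q} → Link Y caps P Q → Link Y′ caps′ (shift P) (shift Q)
    shift-link (across {i} {j} {x} e lt) = subst (λ y → Link Y′ caps′ (i , move i (view i) x) (j , y))
      (move-twin (view i) (view j) e x) (across e (valid lt))
    shift-link (cap {k} p) = cap (move-cap (view k) p)

    r-valid : ∀ {k x} → letter σ k ≡ letter σ i₀ → x < r + 2 → x < length (Y′ k)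
    r-valid {k} {x} e lt = go (view k)
      where
      go : (w : View k) → x < length (Yᵛ k w)
      go (hit g _ _ _) = subst (x <_) (sym (splice-length r v g (Y k) (r<length e)))
        (<-trans lt (subst (_< 2 + length (Y k)) (+-comm 2 r) (s≤s (s≤s (r<length e)))))
      go (other n) = ⊥-elim (n e)

    bridge : Linked (j₀ , r) (shift (j₀ , r))
    bridge = go (view j₀) refl
      where
      go : (w : View j₀) → w ≡ view j₀ → Linked (j₀ , r) (j₀ , move j₀ (view j₀) r)
      go (hit true  _ e _) _ = ⊥-elim (j₀≢i₀ (e refl))
      go w@(hit false _ _ _) e = subst (λ w → Linked (j₀ , r) (j₀ , move j₀ w r)) e
        (Eq.return (cap (subst (λ w′ → (r , bump r 2 r) ∈ capsᵛ j₀ w′) e (here (cong (r ,_) (bump-self r 2))))))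
      go (other n) _ = ⊥-elim (n letter-j₀)

    -- Apart from `v`, only the left copy at `r` is not the image of an old place. It goes across to
    -- the twin side and there over the new cap to `r + 2`, the image of the old `r`.
    represent : ∀ {k x l} → labels (Y′ k) [ x ]= l → l ≢ v →
                Σ Place λ P → ∃ λ l′ → labels (Y (proj₁ P)) [ proj₂ P ]= l′ × l ~ l′ × Linked (k , x) (shift P)
    represent {k} {x} {l} a n = go (view k) refl a
      where
      go : (w : View k) → w ≡ view k → labels (Yᵛ k w) [ x ]= l →
           Σ Place λ P → ∃ λ l′ → labels (Y (proj₁ P)) [ proj₂ P ]= l′ × l ~ l′ × Linked (k , x) (shift P)
      go (other _) e a = (k , x) , l , a , ε , subst (λ w → Linked (k , x) (k , move k w x)) e ε
      go (hit g p _ _) e a with splice⁻ r v g (Y k) a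
      ... | inj₁ (m , refl , b) = (k , m) , l , b , ε , subst (λ w → Linked (k , bump r 2 m) (k , move k w m)) e ε
      ... | inj₂ (inj₁ (refl , b)) = let l′ , b′ = label-r letter-j₀
                                         p′ = trans p (sym letter-j₀) in
            (j₀ , r) , l′ , b′ , Pointwise-at (twin p′) b b′ ,
            Eq.transitive _ (Eq.return (across p′ (r-valid p (m<m+n r (s≤s z≤n))))) bridge
      ... | inj₂ (inj₂ (_ , e′)) = ⊥-elim (n e′)

    at-new : ∀ {k x} (w : View k) → labels (Yᵛ k w) [ x ]= v → letter σ k ≡ letter σ i₀ × x ≡ suc r
    at-new {k} (hit g p _ _) a with splice⁻ r v g (Y k) a
    ... | inj₁ (_ , _ , b)         = ⊥-elim (fresh (proj₁ (known b)))
    ... | inj₂ (inj₁ (_ , b))      = ⊥-elim (fresh (proj₁ (known b)))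
    ... | inj₂ (inj₂ (e , _))      = p , e
    at-new (other _) a = ⊥-elim (fresh (proj₁ (known a)))

    conn′ : ∀ {i j x y w w′} → labels (Y′ i) [ x ]= w → labels (Y′ j) [ y ]= w′ → w ~ w′ → Linked (i , x) (j , y)
    conn′ {i} {j} {w = w} {w′} a b eq with w ≟ᵛ v | w′ ≟ᵛ v
    ... | yes refl | _ with ~-inner ¬on eq
    ... | refl with at-new (view i) a | at-new (view j) b
    ... | p , refl | p′ , refl = Eq.return (across (trans p (sym p′)) (r-valid p (subst (suc r <_) (+-comm 2 r) ≤-refl)))
    conn′ a b eq | no n | yes refl = ⊥-elim (n (~-inner ¬on (Eq.symmetric _ eq)))
    conn′ a b eq | no n | no n′ with represent a n | represent b n′
    ... | P , l , c , l~ , L₁ | P′ , l′ , c′ , l′~ , L₂ =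
      Eq.transitive _ L₁ (Eq.transitive _ (Eq.gmap shift shift-link (conn c c′ (Eq.transitive _ (Eq.symmetric _ l~) (Eq.transitive _ eq l′~))))
        (Eq.symmetric _ L₂))

    insert : State lw′ (suc c)
    insert = record
      { Y       = Y′
      ; caps    = caps′
      ; spelled = spelled′
      ; size    = λ k → size′ k (view k)
      ; twin    = λ {i} {j} → twin′ (view i) (view j)
      ; capEnds = λ {k} → capEnds′ (view k)
      ; capFree = λ {k} → capFree′ (view k)
      ; capsNC  = λ k → capsNC′ k (view k)
      ; known   = λ {k} → known′ (view k)
      ; front   = λ k → front′ k (view k)
      ; rear    = λ k → rear′ k (view k)
      ; conn    = conn′
      }

  state : ∀ {lw c} → Grow lw c → State lw c
  state base             = Start.start
  state (ins α G n f a)  = Insert.insert (state G) n f a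

-- Real entries of a word, and blocks of equal length

module _ {A : Set} where

  -- the position of the P-th real entry, or one past the end if there are too few
  sel : List (A × Bool) → ℕ → ℕ
  sel []                 P       = P
  sel ((u , true)  ∷ xs) zero    = 0
  sel ((u , true)  ∷ xs) (suc P) = suc (sel xs P)
  sel ((u , false) ∷ xs) P       = suc (sel xs P)

  sel-mono : ∀ xs {P Q} → P < Q → sel xs P < sel xs Q
  sel-mono []                 p = p
  sel-mono ((u , true)  ∷ xs) {zero}  {suc Q} p       = s≤s z≤n
  sel-mono ((u , true)  ∷ xs) {suc P} {suc Q} (s≤s p) = s≤s (sel-mono xs p)
  sel-mono ((u , false) ∷ xs) p = s≤s (sel-mono xs p)

  sel-cancel : ∀ xs {P Q} → sel xs P < sel xs Q → P < Q
  sel-cancel xs {P} {Q} lt with <-cmp P Q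
  ... | tri< p _ _    = p
  ... | tri≈ _ refl _ = ⊥-elim (<-irrefl refl lt)
  ... | tri> _ _ p    = ⊥-elim (<-asym lt (sel-mono xs p))

  sel-at : ∀ xs {P w} → reals xs [ P ]= w → xs [ sel xs P ]= (w , true)
  sel-at ((u , true)  ∷ xs) here      = here
  sel-at ((u , true)  ∷ xs) (there p) = there (sel-at xs p)
  sel-at ((u , false) ∷ xs) p         = there (sel-at xs p)

  sel-real : ∀ xs {P} → sel xs P < length xs → ∃ λ w → xs [ sel xs P ]= (w , true)
  sel-real ((u , true)  ∷ xs) {zero}  p       = u , here
  sel-real ((u , true)  ∷ xs) {suc P} (s≤s p) = let w , a = sel-real xs p in w , there a
  sel-real ((u , false) ∷ xs) {P}     (s≤s p) = let w , a = sel-real xs {P} p in w , there a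

  reals-concat : ∀ {n} (f : Fin n → List (A × Bool)) → reals (concat (tabulate f)) ≡ concat (tabulate (reals ∘ f))
  reals-concat {zero}  f = refl
  reals-concat {suc n} f = trans (reals-++ (f fzero) _) (cong (reals (f fzero) ++_) (reals-concat (f ∘ fsuc)))

  reals-pad : ∀ d (u : A) xs → reals (replicate d (u , false) ++ xs) ≡ reals xs
  reals-pad zero    u xs = refl
  reals-pad (suc d) u xs = reals-pad d u xs

module _ {A : Set} {n L : ℕ} where

  concat-at : (f : Fin n → List A) → (∀ k → length (f k) ≡ L) → ∀ k {t e} → f k [ t ]= e →
              concat (tabulate f) [ toℕ k * L + t ]= e
  concat-at = go
    where
    go : ∀ {n} (f : Fin n → List A) → (∀ k → length (f k) ≡ L) → ∀ k {t e} → f k [ t ]= e →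
         concat (tabulate f) [ toℕ k * L + t ]= e
    go f l fzero    a = at-++ˡ a
    go f l (fsuc k) {t} {e} a = subst (λ x → concat (tabulate f) [ x ]= e)
      (trans (cong (_+ (toℕ k * L + t)) (l fzero)) (sym (+-assoc L (toℕ k * L) t)))
      (at-++ʳ (f fzero) (go (f ∘ fsuc) (l ∘ fsuc) k a))

  concat-at⁻ : (f : Fin n → List A) → (∀ k → length (f k) ≡ L) → ∀ {z e} → concat (tabulate f) [ z ]= e →
               Σ (Fin n) λ k → ∃ λ t → z ≡ toℕ k * L + t × f k [ t ]= e
  concat-at⁻ = go
    where
    go : ∀ {n} (f : Fin n → List A) → (∀ k → length (f k) ≡ L) → ∀ {z e} → concat (tabulate f) [ z ]= e →
         Σ (Fin n) λ k → ∃ λ t → z ≡ toℕ k * L + t × f k [ t ]= e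
    go {suc n} f l a with at-++⁻ (f fzero) a
    ... | inj₁ b = fzero , _ , refl , b
    ... | inj₂ (m , refl , b) with go (f ∘ fsuc) (l ∘ fsuc) b
    ... | k , t , refl , c = fsuc k , t , trans (cong (_+ (toℕ k * L + t)) (l fzero)) (sym (+-assoc L (toℕ k * L) t)) , c

∈-concat-tabulate⁻ : ∀ {A : Set} {n} (f : Fin n → List A) {x} → x ∈ concat (tabulate f) → ∃ λ k → x ∈ f k
∈-concat-tabulate⁻ {n = suc n} f p with ∈-++⁻ (f fzero) p
... | inj₁ q = fzero , q
... | inj₂ q = let k , r = ∈-concat-tabulate⁻ (f ∘ fsuc) q in fsuc k , r

quotient-mono : ∀ {L k k′ t t′} → t′ < L → k * L + t < k′ * L + t′ → k ≤ k′
quotient-mono {L} {k} {k′} {t} {t′} t′<L lt = ≮⇒≥ λ k′<k → <⇒≱ lt (begin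
  k′ * L + t′    ≤⟨ +-monoʳ-≤ (k′ * L) (<⇒≤ t′<L) ⟩
  k′ * L + L     ≡⟨ +-comm (k′ * L) L ⟩
  suc k′ * L     ≤⟨ *-monoˡ-≤ L k′<k ⟩
  k * L          ≤⟨ m≤m+n (k * L) t ⟩
  k * L + t      ∎)
  where open ≤-Reasoning

-- Drawing chords in the half-grid

-- Non-crossing chords in the half-grid: a chord from j to a later i occupies part of column j
-- and of row i, which meet at (i , j); the meeting vertex goes to the row if that row continues
-- further and to the column otherwise.
module HalfGrid {N : ℕ} {Ch : Fin N → Fin N → Set}
                (nc : ∀ {a b c d} → Ch a b → Ch c d → toℕ a < toℕ c → toℕ c < toℕ b → toℕ b < toℕ d → ⊥) where

  LongerRow : Fin N → Fin N → Set
  LongerRow i j = Σ (Fin N) λ j′ → Ch j′ i × toℕ j′ < toℕ j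

  data Own (i j : Fin N) : Fin N → Set where
    diagonal : i ≡ j → Own i j i
    row      : LongerRow i j → Own i j i
    column   : ∀ i′ → Ch j i′ → toℕ i < toℕ i′ → Own i j j
    meet     : Ch j i → ¬ LongerRow i j → Own i j j

  -- The critical case is row `i` coming from some `j′ < j` while column `j` goes on to some
  -- `i′ > i`: off the diagonal j′ < j < i < i′, and the two chords cross.
  own-unique : ∀ {i j x y} → toℕ j ≤ toℕ i → Own i j x → Own i j y → x ≡ y
  own-unique _ (diagonal _)    (diagonal _)    = refl
  own-unique _ (diagonal _)    (row _)         = refl
  own-unique _ (diagonal e)    (column _ _ _)  = e
  own-unique _ (diagonal e)    (meet _ _)      = e
  own-unique _ (row _)         (diagonal _)    = refl
  own-unique _ (row _)         (row _)         = refl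
  own-unique le (row (j′ , c , lt)) (column i′ c′ lt′) with m≤n⇒m<n∨m≡n le
  ... | inj₁ j<i = ⊥-elim (nc c c′ lt j<i lt′)
  ... | inj₂ j≡i = toℕ-injective (sym j≡i)
  own-unique _ (row l)         (meet _ n)      = ⊥-elim (n l)
  own-unique _ (column _ _ _)  (diagonal e)    = sym e
  own-unique le (column i′ c′ lt′) (row (j′ , c , lt)) with m≤n⇒m<n∨m≡n le
  ... | inj₁ j<i = ⊥-elim (nc c c′ lt j<i lt′)
  ... | inj₂ j≡i = toℕ-injective j≡i
  own-unique _ (column _ _ _)  (column _ _ _)  = refl
  own-unique _ (column _ _ _)  (meet _ _)      = refl
  own-unique _ (meet _ _)      (diagonal e)    = sym e
  own-unique _ (meet _ n)      (row l)         = ⊥-elim (n l)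
  own-unique _ (meet _ _)      (column _ _ _)  = refl
  own-unique _ (meet _ _)      (meet _ _)      = refl

-- Labels and chords on the diagonal

module Layout (Π : PolyEmb) (p : ℕ) (lw : List (Fin (PolyEmb.V Π))) (c : ℕ)
             (S : Words.State Π lw c) (fits : ∀ k → length (Words.State.Y S k) ≤ p)
             (links : List (ℕ × ℕ)) (links-NC : NonCrossing links) where
  open Plane Π
  open Sides Π
  open Words Π
  open State S

  st en : Fin s → Fin V
  st k = cor (stk k)
  en k = cor (enk k)

  d : Fin s → ℕ
  d k = p ∸ length (Y k)

  d+length : ∀ k → d k + length (Y k) ≡ p
  d+length k = m∸n+n≡m (fits k)

  -- Pads are copies of the corner at the oriented start, so they agree on twin sides up to gluing.
  FY : Fin s → List (Fin V × Bool)
  FY k = replicate (d k) (st k , false) ++ Y k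

  length-FY : ∀ k → length (FY k) ≡ p
  length-FY k = trans (length-++ (replicate (d k) _)) (trans (cong (_+ length (Y k)) (length-replicate (d k))) (d+length k))

  X : Fin s → List (Fin V × Bool)
  X k = orient (pos k) (FY k)

  length-X : ∀ k → length (X k) ≡ p
  length-X k = trans (length-orient (pos k) (FY k)) (length-FY k)

  cw : Bool → ℕ → ℕ
  cw true  y = y
  cw false y = p ∸ suc y

  cw-< : ∀ b {y} → y < p → cw b y < p
  cw-< true  lt = lt
  cw-< false lt = ∸-monoʳ-< (s≤s z≤n) lt

  cw-cw : ∀ b {y} → y < p → cw b (cw b y) ≡ y
  cw-cw true  lt = refl
  cw-cw false {y} lt = trans (cong (p ∸_) (sym (+-∸-assoc 1 lt))) (m∸[m∸n]≡n (<⇒≤ lt))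

  cw-at : ∀ {A : Set} b {xs : List A} {y e} → length xs ≡ p → xs [ y ]= e → orient b xs [ cw b y ]= e
  cw-at true  l a = a
  cw-at false {y = y} {e} l a = subst (λ n → _ [ n ∸ suc y ]= e) l (at-reverse a)

  cw-at⁻ : ∀ {A : Set} b {xs : List A} {y e} → length xs ≡ p → orient b xs [ y ]= e → xs [ cw b y ]= e
  cw-at⁻ b {xs} {y} {e} l a = subst (_[ cw b y ]= e) (orient-involutive b xs) (cw-at b (trans (length-orient b xs) l) a)

  N : ℕ
  N = s * p

  ix : ∀ (k : Fin s) {y} → y < p → Fin N
  ix k lt = combine k (fromℕ< (cw-< (pos k) lt))

  label-at : ∀ (k : Fin s) (t : Fin p) → ∃ λ e → X k [ toℕ t ]= e
  label-at k t = at-exists (X k) (subst (toℕ t <_) (sym (length-X k)) (toℕ<n t))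

  lab′ : Fin s × Fin p → Fin V
  lab′ (k , t) = proj₁ (proj₁ (label-at k t))

  lab : Fin N → Fin V
  lab x = lab′ (remQuot p x)

  lab-combine : ∀ {k t w f} → X k [ toℕ t ]= (w , f) → lab (combine k t) ≡ w
  lab-combine {k} {t} a = trans (cong lab′ (remQuot-combine k t)) (cong proj₁ (at-func (proj₂ (label-at k t)) a))

  lab-ix : ∀ {k y w} (lt : y < p) → labels (FY k) [ y ]= w → lab (ix k lt) ≡ w
  lab-ix {k} lt a with at-map⁻ proj₁ (FY k) a
  ... | e , b , refl = lab-combine (subst (λ n → X k [ n ]= e) (sym (toℕ-fromℕ< _)) (cw-at (pos k) (length-FY k) b))

  -- The place of a diagonal vertex when the corners are counted as well.
  z′ : Fin s × Fin p → ℕ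
  z′ (k , t) = toℕ k * suc p + suc (toℕ t)

  z : Fin N → ℕ
  z x = z′ (remQuot p x)

  z-combine : ∀ k t → z (combine k t) ≡ toℕ k * suc p + suc (toℕ t)
  z-combine k t = cong z′ (remQuot-combine k t)

  z-ix : ∀ k {y} (lt : y < p) → z (ix k lt) ≡ toℕ k * suc p + suc (cw (pos k) y)
  z-ix k lt = trans (z-combine k _) (cong (λ n → toℕ k * suc p + suc n) (toℕ-fromℕ< _))

  uncombine : ∀ (x : Fin N) → Σ (Fin s) λ k → Σ (Fin p) λ t → x ≡ combine k t
  uncombine x = proj₁ (remQuot {s} p x) , proj₂ (remQuot {s} p x) , sym (combine-remQuot {s} p x)

  z-mono : ∀ {x y} → toℕ x < toℕ y → z x < z y
  z-mono {x} {y} lt with uncombine x | uncombine y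
  ... | k , t , refl | k′ , t′ , refl = subst₂ _<_ (sym (form k t)) (sym (form k′ t′))
      (s≤s (+-mono-≤-< (quotient-mono {p} (toℕ<n t′) (subst₂ _<_ (flat k t) (flat k′ t′) lt)) lt))
    where
    flat : ∀ (k : Fin s) (t : Fin p) → toℕ (combine k t) ≡ toℕ k * p + toℕ t
    flat k t = trans (toℕ-combine k t) (cong (_+ toℕ t) (*-comm p (toℕ k)))
    -- The place exceeds the diagonal index by the number of corners up to and including that of
    -- side `k`, a number that never decreases along the diagonal.
    form : ∀ k t → z (combine k t) ≡ suc (toℕ k + toℕ (combine k t))
    form k t = trans (z-combine k t) (trans (arith (toℕ k) p (toℕ t)) (cong (λ n → suc (toℕ k + n)) (sym (flat k t))))
      where arith : ∀ k p t → k * suc p + suc t ≡ suc (k + (k * p + t))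
            arith = solve-∀

  z-cancel : ∀ {x y} → z x < z y → toℕ x < toℕ y
  z-cancel {x} {y} lt with <-cmp (toℕ x) (toℕ y)
  ... | tri< a _ _ = a
  ... | tri≈ _ e _ = ⊥-elim (<-irrefl (cong z (toℕ-injective e)) lt)
  ... | tri> _ _ a = ⊥-elim (<-asym lt (z-mono a))

  as-ix : ∀ (x : Fin N) → Σ (Fin s) λ k → ∃ λ y → Σ (y < p) λ lt → x ≡ ix k lt
  as-ix x with uncombine x
  ... | k , t , refl = k , cw (pos k) (toℕ t) , cw-< (pos k) (toℕ<n t) ,
        cong (combine k) (toℕ-injective (sym (trans (toℕ-fromℕ< _) (cw-cw (pos k) (toℕ<n t)))))

  sideList : Fin s → List (Fin V × Bool)
  sideList k = (cor k , true) ∷ X k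

  length-sideList : ∀ k → length (sideList k) ≡ suc p
  length-sideList k = cong suc (length-X k)

  -- Corners are included as real entries so that the real entries spell exactly `lw`; positions in
  -- `lw` then translate by `sel Z`.
  Z : List (Fin V × Bool)
  Z = concat (tabulate sideList)

  reals-Z : reals Z ≡ lw
  reals-Z = trans (reals-concat sideList) (trans (cong concat (tabulate-cong λ k → cong (cor k ∷_)
    (trans (reals-orient (pos k) (FY k)) (cong (orient (pos k)) (reals-pad (d k) (st k) (Y k)))))) spelled)

  pairCW : Bool → ℕ → ℕ × ℕ → ℕ × ℕ
  pairCW true  e (a , b) = e + a , e + b
  pairCW false e (a , b) = p ∸ suc (e + b) , p ∸ suc (e + a)

  capsCW : Fin s → List (ℕ × ℕ)
  capsCW k = map (pairCW (pos k) (d k)) (caps k)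

  cap-<p : ∀ {k a b} → (a , b) ∈ caps k → d k + a < p × d k + b < p
  cap-<p {k} m = let _ , _ , a , b = capEnds m in lt a , lt b
    where
    lt : ∀ {x w} → labels (Y k) [ x ]= w → d k + x < p
    lt {x} a = subst (d k + x <_) (d+length k) (+-monoʳ-< (d k) (subst (x <_) (length-map proj₁ (Y k)) (at-< a)))

  capsCW-<p : ∀ {k a b} → (a , b) ∈ capsCW k → a < p × b < p
  capsCW-<p {k} m with ∈-map⁻ (pairCW (pos k) (d k)) m
  ... | (a , b) , m′ , e with pos k | e | cap-<p m′
  ... | true  | refl | x , y = x , y
  ... | false | refl | x , y = cw-< false y , cw-< false x

  flip-< : ∀ {e a b} → p ∸ suc (e + b) < p ∸ suc (e + a) → a < b
  flip-< {e} {a} {b} lt = +-cancelˡ-< e a b (≤-pred (∸-cancelʳ-< {suc (e + b)} {suc (e + a)} {p} lt))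

  capsCW-NC : ∀ k → NonCrossing (capsCW k)
  capsCW-NC k i j x y w with ∈-map⁻ (pairCW (pos k) (d k)) i | ∈-map⁻ (pairCW (pos k) (d k)) j
  ... | (_ , _) , i′ , e | (_ , _) , j′ , f with pos k | e | f
  ... | true  | refl | refl = capsNC k i′ j′ (+-cancelˡ-< (d k) _ _ x) (+-cancelˡ-< (d k) _ _ y) (+-cancelˡ-< (d k) _ _ w)
  ... | false | refl | refl = capsNC k j′ i′ (flip-< w) (flip-< y) (flip-< x)

  real-position : ∀ {k y w} → FY k [ y ]= (w , true) → ∃ λ x → y ≡ d k + x × Y k [ x ]= (w , true)
  real-position {k} a = go (d k) a
    where
    go : ∀ n {y w} → (replicate n (st k , false) ++ Y k) [ y ]= (w , true) → ∃ λ x → y ≡ n + x × Y k [ x ]= (w , true)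
    go zero    a         = _ , refl , a
    go (suc n) (there a) = let x , e , b = go n a in x , cong suc e , b

  cap-free-cw : ∀ b {k a e t w} → (a , e) ∈ caps k → FY k [ cw b t ]= (w , true) → t < p →
                proj₁ (pairCW b (d k) (a , e)) < t → t < proj₂ (pairCW b (d k) (a , e)) → ⊥
  cap-free-cw true {k} m at t<p x y with real-position {k} at
  ... | u , refl , r = capFree m r (+-cancelˡ-< (d k) _ _ x) (<⇒≤ (+-cancelˡ-< (d k) _ _ y))
  cap-free-cw false {k} {a} {e} {t} m at t<p x y with real-position {k} at
  ... | u , eq , r = capFree m r (flip-< (subst (_< p ∸ suc (d k + a)) t≡ y)) (<⇒≤ (flip-< (subst (p ∸ suc (d k + e) <_) t≡ x)))
    where
    t≡ : t ≡ p ∸ suc (d k + u)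
    t≡ = trans (sym (cw-cw false t<p)) (cong (λ n → p ∸ suc n) eq)

  capsCW-free : ∀ {k a b t w} → (a , b) ∈ capsCW k → X k [ t ]= (w , true) → a < t → t < b → ⊥
  capsCW-free {k} {t = t} m at x y with ∈-map⁻ (pairCW (pos k) (d k)) m
  ... | (_ , _) , m′ , refl = cap-free-cw (pos k) m′ (cw-at⁻ (pos k) (length-FY k) at) (subst (t <_) (length-X k) (at-< at)) x y

  lift : Fin s → ℕ × ℕ → ℕ × ℕ
  lift k (a , b) = toℕ k * suc p + suc a , toℕ k * suc p + suc b

  pick : ℕ × ℕ → ℕ × ℕ
  pick (P , Q) = sel Z P , sel Z Q

  realL capL allL : List (ℕ × ℕ)
  realL = map pick links
  capL  = concat (tabulate λ k → map (lift k) (capsCW k))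
  allL  = realL ++ capL

  data IsCap : ℕ × ℕ → Set where
    isCap : ∀ k {a b} → (a , b) ∈ capsCW k → IsCap (lift k (a , b))

  capL⁻ : ∀ {e} → e ∈ capL → IsCap e
  capL⁻ m with ∈-concat-tabulate⁻ (λ k → map (lift k) (capsCW k)) m
  ... | k , m′ with ∈-map⁻ (lift k) m′
  ... | (a , b) , m″ , refl = isCap k m″

  in-block : ∀ {k : Fin s} {t x} → toℕ k * suc p + suc t < x → ∀ {t′} → x < toℕ k * suc p + suc t′ →
             ∃ λ u → x ≡ toℕ k * suc p + suc u × t < u × u < t′
  in-block {k} {t} {x} lo {t′} hi = x ∸ suc (B + suc t) + suc t , eq , t<u , +-cancelˡ-< B _ _ (≤-pred (subst₂ _<_ (trans eq (+-suc B _)) (+-suc B t′) hi))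
    where
    B = toℕ k * suc p
    eq : x ≡ B + suc (x ∸ suc (B + suc t) + suc t)
    eq = trans (sym (m+[n∸m]≡n lo)) (arith B t (x ∸ suc (B + suc t)))
      where arith : ∀ B t y → suc (B + suc t) + y ≡ B + suc (y + suc t)
            arith = solve-∀
    t<u : t < x ∸ suc (B + suc t) + suc t
    t<u = m≤n+m (suc t) (x ∸ suc (B + suc t))

  -- Chords of the walk end at real entries, which `capFree` keeps from under the caps. This
  -- separates the two kinds of chords.
  cap-real : ∀ {k a b} → (a , b) ∈ capsCW k → ∀ P → proj₁ (lift k (a , b)) < sel Z P → sel Z P < proj₂ (lift k (a , b)) → ⊥
  cap-real {k} {a} {b} m P lo hi with in-block {k} lo hi
  ... | u , eq , a<u , u<b with at-exists (X k) (subst (u <_) (sym (length-X k)) (<-trans u<b (proj₂ (capsCW-<p {k} m))))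
  ... | e , at with subst (Z [_]= e) (sym eq) (concat-at sideList length-sideList k (there at))
  ... | atZ with sel-real Z {P} (at-< atZ)
  ... | w , real with at-func atZ real
  ... | refl = capsCW-free {k} m at a<u u<b

  allL-NC : NonCrossing allL
  allL-NC i j x y w with ∈-++⁻ realL i | ∈-++⁻ realL j
  ... | inj₁ i′ | inj₁ j′ with ∈-map⁻ pick i′ | ∈-map⁻ pick j′
  ... | (_ , _) , i″ , refl | (_ , _) , j″ , refl =
        links-NC i″ j″ (sel-cancel Z x) (sel-cancel Z y) (sel-cancel Z w)
  allL-NC i j x y w | inj₁ i′ | inj₂ j′ with ∈-map⁻ pick i′ | capL⁻ j′
  ... | (_ , Q) , _ , refl | isCap k m = cap-real {k} m Q y w
  allL-NC i j x y w | inj₂ i′ | inj₁ j′ with capL⁻ i′ | ∈-map⁻ pick j′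
  ... | isCap k m | (P , _) , _ , refl = cap-real {k} m P x y
  allL-NC i j x y w | inj₂ i′ | inj₂ j′ with capL⁻ i′ | capL⁻ j′
  -- A cap stays within one block, so interleaving ends force both caps into the same block.
  ... | isCap k m | isCap k′ m′ with toℕ-injective {i = k} {j = k′} (≤-antisym
          (quotient-mono {suc p} (s≤s (proj₁ (capsCW-<p {k′} m′))) x)
          (quotient-mono {suc p} (s≤s (proj₂ (capsCW-<p {k} m))) y))
  ... | refl = capsCW-NC k m m′ (strip x) (strip y) (strip w)
    where
    strip : ∀ {a b} → toℕ k * suc p + suc a < toℕ k * suc p + suc b → a < b
    strip lt = ≤-pred (+-cancelˡ-< (toℕ k * suc p) _ _ lt)

  Ch : Fin N → Fin N → Set
  Ch a b = (z a , z b) ∈ allL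

  Ch? : ∀ a b → Dec (Ch a b)
  Ch? a b = _∈?_ (≡-dec _≟_ _≟_) (z a , z b) allL

  Ch-NC : ∀ {a b c d} → Ch a b → Ch c d → toℕ a < toℕ c → toℕ c < toℕ b → toℕ b < toℕ d → ⊥
  Ch-NC i j x y w = allL-NC i j (z-mono x) (z-mono y) (z-mono w)

  -- On a negative side clockwise order is opposite to the order of the word, hence the two
  -- alternatives.
  cap-chord : ∀ {k a b} (m : (a , b) ∈ caps k) →
    let x = ix k (proj₁ (cap-<p m)) ; y = ix k (proj₂ (cap-<p m)) in
    (Ch x y × toℕ x < toℕ y) ⊎ (Ch y x × toℕ y < toℕ x)
  cap-chord {k} {a} {b} m = go (pos k) refl
    where
    da = proj₁ (cap-<p m)
    db = proj₂ (cap-<p m)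
    x = ix k da
    y = ix k db
    put : ∀ {e f} → (e , f) ∈ capsCW k → (toℕ k * suc p + suc e , toℕ k * suc p + suc f) ∈ allL
    put m′ = ∈-++⁺ʳ realL (∈-concat-tabulate⁺ (λ k → map (lift k) (capsCW k)) k (∈-map⁺ (lift k) m′))
    m₁ : pairCW (pos k) (d k) (a , b) ∈ capsCW k
    m₁ = ∈-map⁺ (pairCW (pos k) (d k)) m
    a<b = proj₁ (capEnds m)
    ordered : ∀ {u v e f} → z u ≡ toℕ k * suc p + suc e → z v ≡ toℕ k * suc p + suc f → (e , f) ∈ capsCW k → e < f →
              Ch u v × toℕ u < toℕ v
    ordered zu zv m lt = subst₂ (λ e f → (e , f) ∈ allL) (sym zu) (sym zv) (put m) ,
      z-cancel (subst₂ _<_ (sym zu) (sym zv) (+-monoʳ-< (toℕ k * suc p) (s≤s lt)))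
    go : ∀ b′ → pos k ≡ b′ → (Ch x y × toℕ x < toℕ y) ⊎ (Ch y x × toℕ y < toℕ x)
    go true  e = inj₁ (ordered
      (trans (z-ix k da) (cong (λ b → toℕ k * suc p + suc (cw b (d k + a))) e))
      (trans (z-ix k db) (cong (λ b′ → toℕ k * suc p + suc (cw b′ (d k + b))) e))
      (subst (λ b′ → pairCW b′ (d k) (a , b) ∈ capsCW k) e m₁) (+-monoʳ-< (d k) a<b))
    go false e = inj₂ (ordered
      (trans (z-ix k db) (cong (λ b′ → toℕ k * suc p + suc (cw b′ (d k + b))) e))
      (trans (z-ix k da) (cong (λ b → toℕ k * suc p + suc (cw b (d k + a))) e))
      (subst (λ b′ → pairCW b′ (d k) (a , b) ∈ capsCW k) e m₁) (∸-monoʳ-< (s≤s (+-monoʳ-< (d k) a<b)) db))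

  -- A corner is a real entry of `Z` but has no diagonal vertex, so it has to be excluded.
  real-index : ∀ {P w} → lw [ P ]= w → ¬ Corner w → ∃ λ x → z x ≡ sel Z P × lab x ≡ w
  real-index {P} {w} a n with concat-at⁻ sideList length-sideList (sel-at Z (subst (_[ P ]= w) (sym reals-Z) a))
  ... | k , zero  , e , here = ⊥-elim (n (k , refl))
  ... | k , suc t , e , there b = combine k t′ , trans (z-combine k t′) (trans (cong (λ n → toℕ k * suc p + suc n) t≡) (sym e)) ,
        lab-combine (subst (λ n → X k [ n ]= (w , true)) (sym t≡) b)
    where
    lt : t < p
    lt = subst (t <_) (length-X k) (at-< b)
    t′ = fromℕ< lt
    t≡ : toℕ t′ ≡ t
    t≡ = toℕ-fromℕ< lt

-- The minor model

at-tabulate : ∀ {A : Set} {n} (f : Fin n → A) t → tabulate f [ toℕ t ]= f t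
at-tabulate f fzero    = here
at-tabulate f (fsuc t) = there (at-tabulate (f ∘ fsuc) t)

at-hd : ∀ {A : Set} (xs : List A) e → (xs ++ e ∷ []) [ 0 ]= hd e xs
at-hd []      e = here
at-hd (_ ∷ _) e = here

at-lst : ∀ {A : Set} x (xs : List A) {ys} → (x ∷ xs ++ ys) [ length xs ]= lst x xs
at-lst x []       = here
at-lst x (y ∷ xs) = there (at-lst y xs)

at-replicate : ∀ {A : Set} d {e : A} {ys y} → y < d → (replicate d e ++ ys) [ y ]= e
at-replicate (suc d) {y = zero}  _       = here
at-replicate (suc d) {y = suc y} (s≤s p) = there (at-replicate d p)

module Model (Π : PolyEmb) (p : ℕ) (lw : List (Fin (PolyEmb.V Π))) (c : ℕ)
             (S : Words.State Π lw c) (fits : ∀ k → length (Words.State.Y S k) ≤ p)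
             (links : List (ℕ × ℕ)) (links-NC : NonCrossing links) where
  open Plane Π
  open Sides Π
  open Words Π
  open State S
  open Layout Π p lw c S fits links links-NC
  open HalfGrid {N} {Ch} Ch-NC

  U : Set
  U = UV s p

  module G = QGraph (sewing (𝕌 σ p))

  dg : Fin N → U
  dg = diag σ p

  DU : Fin s → List U
  DU k = orient (pos k) (map (λ t → dg (combine k t)) (allFin p))

  length-DU : ∀ k → length (DU k) ≡ p
  length-DU k = trans (length-orient (pos k) _) (trans (length-map _ (allFin p)) (length-tabulate {n = p} id))

  DU-at : ∀ k {y} (lt : y < p) → DU k [ y ]= dg (ix k lt)
  DU-at k {y} lt = subst (λ n → DU k [ n ]= dg (ix k lt)) (cw-cw (pos k) lt)
    (cw-at (pos k) (trans (length-map _ (allFin p)) (length-tabulate {n = p} id))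
      (subst (λ n → map (λ t → dg (combine k t)) (allFin p) [ n ]= dg (ix k lt)) (toℕ-fromℕ< _)
        (at-map (λ t → dg (combine k t)) (at-tabulate id (fromℕ< (cw-< (pos k) lt))))))

  OU : Fin s → List U
  OU k = cv (stk k) ∷ DU k ++ cv (enk k) ∷ []

  oside-U : ∀ k → Bordered.oside (𝕌 σ p) k ≡ OU k
  oside-U k = trans (orient-wrap (pos k) (cv k) _ (cv (next k)))
    (cong₂ (λ x y → x ∷ DU k ++ y ∷ []) (push (pos k)) (push (pos k)))
    where
    push : ∀ b {i j : Fin s} → (if b then cv i else cv j) ≡ cv {m = p} (if b then i else j)
    push true  = refl
    push false = refl

  GlueU : U → U → Set
  GlueU = Bordered.Glue (𝕌 σ p)

  data GluedU : U → U → Set where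
    first  : ∀ {i j} → letter σ i ≡ letter σ j → GluedU (cv (stk i)) (cv (stk j))
    middle : ∀ {i j y} → letter σ i ≡ letter σ j → (lt : y < p) → GluedU (dg (ix i lt)) (dg (ix j lt))
    final  : ∀ {i j} → letter σ i ≡ letter σ j → GluedU (cv (enk i)) (cv (enk j))

  same-DU : ∀ i j → length (DU i) ≡ length (DU j)
  same-DU i j = trans (length-DU i) (sym (length-DU j))

  unglueU : ∀ {a b} → GlueU a b → GluedU a b
  unglueU {a} {b} (i , j , e , m)
    with zip-wrap⁻ (DU i) (DU j) (same-DU i j) (subst₂ (λ xs ys → (a , b) ∈ zip xs ys) (oside-U i) (oside-U j) m)
  ... | inj₁ (refl , refl)        = first e
  ... | inj₂ (inj₂ (refl , refl)) = final e
  ... | inj₂ (inj₁ (y , ai , aj)) with subst (y <_) (length-DU i) (at-< ai)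
  ... | lt with at-func ai (DU-at i lt) | at-func aj (DU-at j lt)
  ... | refl | refl = middle e lt

  glueU : ∀ {a b} → GluedU a b → GlueU a b
  glueU g = go g
    where
    wrapped : ∀ {i j a b} → letter σ i ≡ letter σ j → (a , b) ∈ zip (OU i) (OU j) → GlueU a b
    wrapped {i} {j} {a} {b} e m = i , j , e , subst₂ (λ xs ys → (a , b) ∈ zip xs ys) (sym (oside-U i)) (sym (oside-U j)) m
    go : ∀ {a b} → GluedU a b → GlueU a b
    go (first {i} {j} e)     = wrapped {i} {j} e (here refl)
    go (middle {i} {j} e lt) = wrapped {i} {j} e (there (at-zip (at-++ˡ (DU-at i lt)) (at-++ˡ (DU-at j lt))))
    go (final {i} {j} e)     = wrapped {i} {j} e (zip-wrap-last (DU i) (DU j) (same-DU i j))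

  -- Defined up to `_~_`, so the choice of a representative is immaterial. A grid vertex off the
  -- diagonal and off all chords belongs to no branch set.
  β : Fin V → U → Set
  β x (gv i j _) = ∃ λ y → Own i j y × lab y ~ x
  β x (cv k)     = cor k ~ x

  β-resp : ∀ {x y a} → x ~ y → β x a → β y a
  β-resp {a = gv _ _ _} e (y , o , l) = y , o , Eq.transitive _ l e
  β-resp {a = cv _}     e l           = Eq.transitive _ l e

  β-dg : ∀ {x y} → lab y ~ x → β x (dg y)
  β-dg {y = y} l = y , diagonal refl , l

  β-dg⁻ : ∀ {x y} → β x (dg y) → lab y ~ x
  β-dg⁻ {x} (y′ , o , l) = subst (λ y → lab y ~ x) (own-unique ≤-refl o (diagonal refl)) l

  label-ix : ∀ i {y} → y < p → ∃ λ w → labels (FY i) [ y ]= w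
  label-ix i {y} lt = at-exists (labels (FY i)) (subst (y <_) (sym (trans (length-map proj₁ (FY i)) (length-FY i))) lt)

  labels-FY : ∀ k → labels (FY k) ≡ replicate (d k) (st k) ++ labels (Y k)
  labels-FY k = trans (map-++ proj₁ (replicate (d k) _) (Y k)) (cong (_++ labels (Y k)) (map-replicate proj₁ (d k) _))

  twin-length : ∀ {i j} → letter σ i ≡ letter σ j → length (Y i) ≡ length (Y j)
  twin-length {i} {j} e = trans (sym (length-map proj₁ (Y i))) (trans (Pointwise-length (twin e)) (length-map proj₁ (Y j)))

  twin-FY : ∀ {i j} → letter σ i ≡ letter σ j → Pointwise _~_ (labels (FY i)) (labels (FY j))
  twin-FY {i} {j} e = subst₂ (Pointwise _~_) (sym (labels-FY i))
    (sym (trans (labels-FY j) (cong (λ n → replicate (p ∸ n) (st j) ++ labels (Y j)) (sym (twin-length e)))))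
    (Pointwise.++⁺ (Pointwise.replicate⁺ (glue (first {i} {j} e)) (d i)) (twin e))

  twin-lab : ∀ {i j y} → letter σ i ≡ letter σ j → (lt : y < p) → lab (ix i lt) ~ lab (ix j lt)
  twin-lab {i} {j} e lt = let w , a = label-ix i lt ; w′ , b = label-ix j lt in
    subst₂ _~_ (sym (lab-ix {i} lt a)) (sym (lab-ix {j} lt b)) (Pointwise-at (twin-FY e) a b)

  β-closed : ∀ {x} → Closed-under GlueU (β x)
  β-closed {x} g with unglueU g
  ... | first {i} {j} e = Eq.transitive _ (Eq.symmetric _ h) , Eq.transitive _ h
    where h = glue (first {i} {j} e)
  ... | final {i} {j} e = Eq.transitive _ (Eq.symmetric _ h) , Eq.transitive _ h
    where h = glue (final {i} {j} e)
  ... | middle {i} {j} e lt =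
    (λ b → β-dg {x} {ix j lt} (Eq.transitive _ (Eq.symmetric _ h) (β-dg⁻ {x} {ix i lt} b))) ,
    (λ b → β-dg {x} {ix i lt} (Eq.transitive _ h (β-dg⁻ {x} {ix j lt} b)))
    where h = twin-lab {i} {j} e lt

  β-sat : ∀ {x a b} → a G.~ b → β x a → β x b
  β-sat {x} = closure-preserves (β-closed {x})

  disjoint : ∀ {x y a} → β x a → β y a → x ~ y
  disjoint {a = cv k} l l′ = Eq.transitive _ (Eq.symmetric _ l) l′
  disjoint {x} {y} {a = gv i j le} (u , o , l) (u′ , o′ , l′) =
    -- The order proof stored in `gv` is irrelevant; it is recovered from decidability.
    Eq.transitive _ (Eq.symmetric _ l) (subst (λ w → lab w ~ y) (own-unique (recompute (toℕ j ≤? toℕ i) le) o′ o) l′)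

  A : U → U → Set
  A = UAdj σ p

  A-sym : ∀ {a b} → A a b → A b a
  A-sym (inj₁ x)               = inj₂ (inj₁ x)
  A-sym (inj₂ (inj₁ x))        = inj₁ x
  A-sym (inj₂ (inj₂ (inj₁ x))) = inj₂ (inj₂ (inj₂ x))
  A-sym (inj₂ (inj₂ (inj₂ x))) = inj₂ (inj₂ (inj₁ x))

  T : Fin V → U → U → Set
  T x u v = β x u × β x v × (u G.~ v ⊎ G.QAdj u v)

  T-sym : ∀ {x u v} → T x u v → T x v u
  T-sym (a , b , inj₁ e) = b , a , inj₁ (Eq.symmetric _ e)
  T-sym (a , b , inj₂ (u , v , e , f , g)) = b , a , inj₂ (v , u , f , e , A-sym g)

  Joined : Fin V → U → U → Set
  Joined x = Star (T x)

  Joined-sym : ∀ {x u v} → Joined x u v → Joined x v u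
  Joined-sym {x} = Star.reverse (λ {u} {v} → T-sym {x} {u} {v})

  by-edge : ∀ {x a b} → β x a → β x b → A a b → Joined x a b
  by-edge {a = a} {b} ba bb e = (ba , bb , inj₂ (a , b , ε , ε , e)) ◅ ε

  by-glue : ∀ {x a b} → β x a → a G.~ b → Joined x a b
  by-glue {x} ba e = (ba , β-sat {x} e ba , inj₁ e) ◅ ε

  below : ∀ {i : Fin N} {m} → toℕ i ≡ suc m → Σ (Fin N) λ i′ → toℕ i′ ≡ m
  below {i} {m} e = fromℕ< lt , toℕ-fromℕ< lt
    where lt : m < N
          lt = <-trans (n<1+n m) (subst (_< N) e (toℕ<n i))

  above : ∀ {i j : Fin N} → toℕ j < toℕ i → Σ (Fin N) λ j′ → toℕ j′ ≡ suc (toℕ j)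
  above {i} {j} j<i = fromℕ< lt , toℕ-fromℕ< lt
    where lt : suc (toℕ j) < N
          lt = ≤-<-trans j<i (toℕ<n i)

  hook-row : ∀ {x i} n j .(le : toℕ j ≤ toℕ i) → toℕ i ≡ n + toℕ j → LongerRow i j → lab i ~ x →
             Joined x (gv i j le) (dg i)
  hook-row zero j le e _ _ with toℕ-injective e
  ... | refl = ε
  hook-row {x} {i} (suc n) j le e r@(j₁ , ch , lt) l with above {i} {j} (subst (suc (toℕ j) ≤_) (sym e) (s≤s (m≤n+m (toℕ j) n)))
  ... | j′ , e′ = by-edge {x} {gv i j le} {gv i j′ le′} (i , row r , l) (i , row r′ , l) (inj₁ (inj₂ (refl , e′))) ◅◅
                  hook-row n j′ le′ eq r′ l
    where
    eq : toℕ i ≡ n + toℕ j′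
    eq = trans e (trans (sym (+-suc n (toℕ j))) (cong (n +_) (sym e′)))
    le′ : toℕ j′ ≤ toℕ i
    le′ = subst (toℕ j′ ≤_) (sym eq) (m≤n+m (toℕ j′) n)
    r′ : LongerRow i j′
    r′ = j₁ , ch , <-trans lt (subst (toℕ j <_) (sym e′) ≤-refl)

  -- Only the starting vertex can be a `meet`. One step nearer to the diagonal the chord reaches
  -- strictly further, so ownership is by `column` from there on.
  hook-column : ∀ {x j} n i .(le : toℕ j ≤ toℕ i) → toℕ i ≡ n + toℕ j → Own i j j →
                (Σ (Fin N) λ i′ → Ch j i′ × toℕ i ≤ toℕ i′) → lab j ~ x → Joined x (gv i j le) (dg j)
  hook-column zero i le e _ _ _ with toℕ-injective e
  ... | refl = ε
  hook-column {x} {j} (suc n) i le e o (i₁ , ch , lt) l with below {i} e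
  ... | i′ , e′ = by-edge {x} {gv i j le} {gv i′ j le′} (j , o , l) (j , o′ , l) (inj₂ (inj₁ (inj₁ (i≡ , refl)))) ◅◅
                  hook-column n i′ le′ e′ o′ (i₁ , ch , <⇒≤ lt′) l
    where
    i≡ : toℕ i ≡ suc (toℕ i′)
    i≡ = trans e (cong suc (sym e′))
    le′ : toℕ j ≤ toℕ i′
    le′ = subst (toℕ j ≤_) (sym e′) (m≤n+m (toℕ j) n)
    lt′ : toℕ i′ < toℕ i₁
    lt′ = subst (_≤ toℕ i₁) i≡ lt
    o′ : Own i′ j j
    o′ = column i₁ ch lt′

  hook : ∀ {x} i j .(le : toℕ j ≤ toℕ i) {y} → Own i j y → lab y ~ x → Joined x (gv i j le) (dg y)
  hook i j le o l = go o l (sym (m∸n+n≡m (recompute (toℕ j ≤? toℕ i) le)))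
    where
    go : ∀ {x y} → Own i j y → lab y ~ x → toℕ i ≡ toℕ i ∸ toℕ j + toℕ j → Joined x (gv i j le) (dg y)
    go (diagonal refl)       l e = ε
    go (row r)               l e = hook-row _ j le e r l
    go o@(column i′ ch lt)   l e = hook-column _ i le e o (i′ , ch , <⇒≤ lt) l
    go o@(meet ch _)         l e = hook-column _ i le e o (i , ch , ≤-refl) l

  Edge : Fin V → Fin V → Set
  Edge x y = Σ U λ a → Σ U λ b → β x a × β y b × G.QAdj a b

  Edge-sym : ∀ {x y} → Edge x y → Edge y x
  Edge-sym (a , b , βa , βb , u , v , e , f , g) = b , a , βb , βa , v , u , f , e , A-sym g

  edge : ∀ {x y a b} → β x a → β y b → A a b → Edge x y
  edge {a = a} {b} βa βb e = a , b , βa , βb , a , b , ε , ε , e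

  OwnV : U → Fin N → Set
  OwnV (gv i j _) y = Own i j y
  OwnV (cv _)     y = ⊥

  -- The meeting vertex (i , j) goes to one end of the chord; its neighbour on the other leg belongs
  -- to the other end. That is (i - 1 , j) if row `i` continues beyond column `j`, and (i , j + 1)
  -- if not.
  chord-adjacent : ∀ {i j} → Ch j i → toℕ j < toℕ i → Σ U λ a → Σ U λ b → OwnV a j × OwnV b i × A a b
  chord-adjacent {i} {j} ch lt with any? (λ j′ → Ch? j′ i ×-dec (toℕ j′ <? toℕ j))
  ... | yes r with below {i} (sym (m+[n∸m]≡n (≤-trans (s≤s z≤n) lt)))
  ...   | i′ , e = gv i′ j le′ , gv i j (<⇒≤ lt) , column i ch lt′ , row r , inj₁ (inj₁ (i≡ , refl))
    where
    i≡ : toℕ i ≡ suc (toℕ i′)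
    i≡ = trans (sym (m+[n∸m]≡n (≤-trans (s≤s z≤n) lt))) (cong suc (sym e))
    le′ : toℕ j ≤ toℕ i′
    le′ = ≤-pred (subst (toℕ j <_) i≡ lt)
    lt′ : toℕ i′ < toℕ i
    lt′ = subst (toℕ i′ <_) (sym i≡) ≤-refl
  chord-adjacent {i} {j} ch lt | no n with above {i} {j} lt
  ... | j′ , e = gv i j (<⇒≤ lt) , gv i j′ (subst (_≤ toℕ i) (sym e) lt) , meet ch n ,
                 row (j , ch , subst (toℕ j <_) (sym e) ≤-refl) , inj₁ (inj₂ (refl , e))

  β-own : ∀ {x a y} → OwnV a y → lab y ~ x → β x a
  β-own {a = gv _ _ _} {y} o l = y , o , l

  hook-own : ∀ {x a y} → OwnV a y → lab y ~ x → Joined x a (dg y)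
  hook-own {a = gv i j le} o l = hook i j le o l

  chord-edge : ∀ {i j} → Ch j i → toℕ j < toℕ i → Edge (lab j) (lab i)
  chord-edge ch lt = let a , b , o , o′ , e = chord-adjacent ch lt in
    edge (β-own {a = a} o ε) (β-own {a = b} o′ ε) e

  chord-joined : ∀ {x i j} → Ch j i → toℕ j < toℕ i → lab j ~ x → lab i ~ x → Joined x (dg j) (dg i)
  chord-joined {x} ch lt lj li = let a , b , o , o′ , e = chord-adjacent ch lt in
    Joined-sym (hook-own {a = a} o lj) ◅◅ by-edge {x} (β-own {a = a} o lj) (β-own {a = b} o′ li) e ◅◅ hook-own {a = b} o′ li

  consecutive : ∀ k {n a b} → OU k [ n ]= a → OU k [ suc n ]= b → A a b
  consecutive k {n} {a} {b} x y = go (pos k) (subst (_[ n ]= a) (sym (oside-U k)) x) (subst (_[ suc n ]= b) (sym (oside-U k)) y)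
    where
    W = Uside σ p k
    drop-at : ∀ {xs : List U} {m e} → xs [ suc m ]= e → drop 1 xs [ m ]= e
    drop-at (there q) = q
    cyc : ∀ {m a b} → W [ m ]= a → W [ suc m ]= b → CycE σ p a b
    cyc q r = k , at-zip q (drop-at r)
    unreverse : ∀ {m e} → reverse W [ m ]= e → W [ length W ∸ suc m ]= e
    unreverse {m} {e} q = subst₂ (λ xs l → xs [ l ∸ suc m ]= e) (reverse-involutive W) (length-reverse W) (at-reverse q)
    go : ∀ b′ → orient b′ W [ n ]= a → orient b′ W [ suc n ]= b → A a b
    go true  q r = inj₂ (inj₂ (inj₁ (cyc q r)))
    go false q r = inj₂ (inj₂ (inj₂ (cyc (unreverse r)
      (subst (λ m → W [ m ]= a) (+-∸-assoc 1 (subst (suc n <_) (length-reverse W) (at-< r))) (unreverse q)))))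

  OC : Fin s → List (Fin V)
  OC k = st k ∷ labels (FY k) ++ en k ∷ []

  OC-at : ∀ k {n w} → OC k [ n ]= w → Σ U λ a → OU k [ n ]= a × β w a
  OC-at k here = _ , here , ε
  OC-at k {suc y} {w} (there q) with at-++⁻ (labels (FY k)) q
  ... | inj₁ r = _ , there (at-++ˡ (DU-at k lt)) , β-dg {w} {ix k lt} (subst (_~ w) (sym (lab-ix {k} lt r)) ε)
    where lt = subst (y <_) (trans (length-map proj₁ (FY k)) (length-FY k)) (at-< r)
  ... | inj₂ (_ , e , here) = _ , there (subst (λ n → (DU k ++ cv (enk k) ∷ []) [ n ]= cv (enk k)) eq (at-++ʳ (DU k) here)) , ε
    where
    eq : length (DU k) + 0 ≡ y
    eq = trans (cong (_+ 0) (trans (length-DU k) (sym (trans (length-map proj₁ (FY k)) (length-FY k))))) (sym e)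

  OC-edge : ∀ k {n w w′} → OC k [ n ]= w → OC k [ suc n ]= w′ → Edge w w′
  OC-edge k x y = let a , q , βa = OC-at k x ; b , r , βb = OC-at k y in edge βa βb (consecutive k q r)

  -- The last pad, or the corner itself when there are no pads, still carries `st k`, and `front`
  -- tells which label follows it.
  first-edge : ∀ k → Edge (st k) (hd (en k) (Y₀ k))
  first-edge k = OC-edge k {d k}
    (subst (_[ d k ]= st k) (sym OC≡) (at-replicate (suc (d k)) ≤-refl))
    (subst₂ (λ xs w → xs [ suc (d k) ]= w) (sym OC≡) (front k (en k))
      (subst (λ n → (replicate (suc (d k)) (st k) ++ labels (Y k) ++ en k ∷ []) [ n ]= hd (en k) (labels (Y k)))
        (trans (+-identityʳ _) (length-replicate (suc (d k))))
        (at-++ʳ (replicate (suc (d k)) (st k)) (at-hd (labels (Y k)) (en k)))))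
    where
    OC≡ : OC k ≡ replicate (suc (d k)) (st k) ++ labels (Y k) ++ en k ∷ []
    OC≡ = cong (st k ∷_) (trans (cong (_++ en k ∷ []) (labels-FY k)) (++-assoc (replicate (d k) (st k)) _ _))

  last-edge : ∀ k → Edge (en k) (lst (st k) (Y₀ k))
  last-edge k = Edge-sym (OC-edge k {length (labels (FY k))}
    (subst (λ w → OC k [ length (labels (FY k)) ]= w) eq (at-lst (st k) (labels (FY k))))
    (at-mid (st k ∷ labels (FY k))))
    where
    skip : ∀ n xs → lst (st k) (replicate n (st k) ++ xs) ≡ lst (st k) xs
    skip zero    xs = refl
    skip (suc n) xs = skip n xs
    eq : lst (st k) (labels (FY k)) ≡ lst (st k) (Y₀ k)
    eq = trans (cong (lst (st k)) (labels-FY k)) (trans (skip (d k) (labels (Y k))) (rear k (st k)))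

  -- On a negative side `cor k` is where the oriented word ends, so the edge comes from `last-edge`.
  from-corner : ∀ k → Edge (cor k) (hd (cor (next k)) (R₀ k))
  from-corner k with pos k | first-edge k | last-edge k
  ... | true  | e | _ = e
  ... | false | _ | e = subst (Edge (cor k)) (lst-reverse (cor (next k)) (R₀ k)) e

  to-corner : ∀ k → Edge (cor (next k)) (lst (cor k) (R₀ k))
  to-corner k with pos k | first-edge k | last-edge k
  ... | true  | _ | e = e
  ... | false | e | _ = subst (Edge (cor (next k))) (hd-reverse (cor k) (R₀ k)) e

  hd-seg : ∀ k → hd (cor (next k)) (R₀ k) ≡ O (suc (lo k))
  hd-seg k = go (int k) (hi≡ k)
    where
    go : ∀ n → hi k ≡ suc (lo k + n) → hd (cor (next k)) (seg (suc (lo k)) n) ≡ O (suc (lo k))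
    go zero    e = trans (sym (cor-next k)) (cong O (trans e (cong suc (+-identityʳ (lo k)))))
    go (suc n) e = cong (O ∘ suc) (+-identityʳ (lo k))

  lst-seg : ∀ k → lst (cor k) (R₀ k) ≡ O (lo k + int k)
  lst-seg k = go (int k)
    where
    go : ∀ n → lst (cor k) (seg (suc (lo k)) n) ≡ O (lo k + n)
    go zero    = cong O (sym (+-identityʳ (lo k)))
    go (suc n) = trans (cong (lst (cor k)) (sym (applyUpTo-∷ʳ _ n))) (trans (lst-∷ʳ (cor k) (seg (suc (lo k)) n) _)
      (cong O (sym (+-suc (lo k) n))))

  corner-edge : ∀ k {y} → Adj (cor k) y → Edge (cor k) y
  corner-edge k (i , refl) with corner-darts k (cor k , i) refl
  ... | inj₁ e = subst (Edge (cor k)) (trans (hd-seg k) (sym (trans (cong head e) (od-hd (lo k))))) (from-corner k)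
  ... | inj₂ (t , Ot , e) with next-surjective k
  ... | j , refl = subst (Edge (cor (next j)))
        (trans (lst-seg j) (trans (Peeling.O-cancel Π (trans (cong O (sym (hi≡ j))) (trans (cor-next j) (sym Ot))))
          (sym (trans (cong head e) (Peeling.head-rev-od Π t)))))
        (to-corner j)

  Corner? : ∀ u → Dec (Corner u)
  Corner? u = any? (λ k → u ≟ᵛ cor k)

  Chords : Set
  Chords = ∀ {x y} → Adj x y → ¬ Corner x → ¬ Corner y → Σ ℕ λ P → Σ ℕ λ Q → (P , Q) ∈ links × P < Q ×
           ((lw [ P ]= x × lw [ Q ]= y) ⊎ (lw [ P ]= y × lw [ Q ]= x))

  Adj-sym : ∀ {x y} → Adj x y → Adj y x
  Adj-sym {x} (i , refl) = back x i , back-nbr x i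

  link-edge : ∀ {P Q x y} → (P , Q) ∈ links → P < Q → lw [ P ]= x → lw [ Q ]= y → ¬ Corner x → ¬ Corner y → Edge x y
  link-edge {P} {Q} m lt a b nx ny with real-index a nx | real-index b ny
  ... | u , zu , refl | v , zv , refl =
    chord-edge (subst₂ (λ e f → (e , f) ∈ allL) (sym zu) (sym zv) (∈-++⁺ˡ (∈-map⁺ pick m)))
      (z-cancel (subst₂ _<_ (sym zu) (sym zv) (sel-mono Z lt)))

  adj-edge : Chords → ∀ {x y} → Adj x y → Edge x y
  adj-edge chords {x} {y} a with Corner? x | Corner? y
  ... | yes (k , refl) | _ = corner-edge k a
  ... | no _ | yes (k , refl) = Edge-sym (corner-edge k (Adj-sym a))
  ... | no nx | no ny with chords a nx ny
  ... | P , Q , m , lt , inj₁ (q , r) = link-edge m lt q r nx ny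
  ... | P , Q , m , lt , inj₂ (q , r) = Edge-sym (link-edge m lt q r ny nx)

  -- Corners of 𝕌 are glued by the same rule as those of `Π`. Corners of `Π` being distinct, each
  -- gluing of a chain determines the corresponding gluing in 𝕌.
  corner-joined : ∀ {x k k′} → cor k ~ x → cor k′ ~ x → Joined x (cv k) (cv k′)
  corner-joined {x} {k} {k′} l l′ with ~-preserves {λ w → Σ (Fin s) λ j → w ≡ cor j × cv k G.~ cv j} along
      (Eq.transitive _ l (Eq.symmetric _ l′)) (k , refl , ε)
    where
    along : Closed-under Glued (λ w → Σ (Fin s) λ j → w ≡ cor j × cv k G.~ cv j)
    along (first {i} {j} e) =
      (λ (_ , q , r) → stk j , refl , Eq.transitive _ (subst (λ i → cv k G.~ cv i) (sym (cor-injective q)) r) (Eq.return (glueU (first {i} {j} e)))) ,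
      (λ (_ , q , r) → stk i , refl , Eq.transitive _ (subst (λ i → cv k G.~ cv i) (sym (cor-injective q)) r) (Eq.return (glueU (first {j} {i} (sym e)))))
    along (final {i} {j} e) =
      (λ (_ , q , r) → enk j , refl , Eq.transitive _ (subst (λ i → cv k G.~ cv i) (sym (cor-injective q)) r) (Eq.return (glueU (final {i} {j} e)))) ,
      (λ (_ , q , r) → enk i , refl , Eq.transitive _ (subst (λ i → cv k G.~ cv i) (sym (cor-injective q)) r) (Eq.return (glueU (final {j} {i} (sym e)))))
    along (middle e a b) =
      (λ (_ , q , _) → ⊥-elim (InR₀-¬Corner (∈Y₀ (at-∈ a)) (_ , q))) ,
      (λ (_ , q , _) → ⊥-elim (InR₀-¬Corner (∈Y₀ (at-∈ b)) (_ , q)))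
  ... | j , e , r with cor-injective e
  ... | refl = by-glue {x} l r

  place-< : ∀ {k y w} → labels (Y k) [ y ]= w → d k + y < p
  place-< {k} {y} a = subst (d k + y <_) (d+length k) (+-monoʳ-< (d k) (subst (y <_) (length-map proj₁ (Y k)) (at-< a)))

  place-lab : ∀ {k y w} (a : labels (Y k) [ y ]= w) (lt : d k + y < p) → lab (ix k lt) ≡ w
  place-lab {k} {y} {w} a lt = lab-ix {k} lt (subst₂ (λ xs n → xs [ n ]= w) (sym (labels-FY k))
    (cong (_+ y) (length-replicate (d k))) (at-++ʳ (replicate (d k) (st k)) a))

  ix-irr : ∀ {k y} (lt lt′ : y < p) → ix k lt ≡ ix k lt′
  ix-irr lt lt′ = cong (ix _) (<-irrelevant lt lt′)

  Reach : Fin V → U → Place → Set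
  Reach x a (k , y) = Σ (d k + y < p) λ lt → ∃ λ w → labels (Y k) [ y ]= w × w ~ x × Joined x a (dg (ix k lt))

  -- Each link becomes a connection in 𝕌 within one branch set: `across` is the glue on the
  -- diagonal, and `cap` is a chord whose ends carry the same label.
  reach-link : ∀ {x a} → Closed-under (Link Y caps) (Reach x a)
  reach-link {x} {a} (across {i} {j} {y} e _) = go {i} {j} e , go {j} {i} (sym e)
    where
    go : ∀ {i j} → letter σ i ≡ letter σ j → Reach x a (i , y) → Reach x a (j , y)
    go {i} {j} e (lt , w , q , l , J) with at-exists (labels (Y j)) (subst (y <_) (Pointwise-length (twin e)) (at-< q))
    ... | w′ , q′ = lt′ , w′ , q′ , Eq.transitive _ (Eq.symmetric _ (Pointwise-at (twin e) q q′)) l ,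
          (J ◅◅ subst (λ v → Joined x (dg (ix i lt)) (dg v)) eq
            (by-glue {x} (β-dg {x} {ix i lt} (subst (_~ x) (sym (place-lab {i} q lt)) l)) (Eq.return (glueU (middle {i} {j} e lt)))))
      where
      lt′ = place-< {j} q′
      d≡ : d i + y ≡ d j + y
      d≡ = cong (λ n → p ∸ n + y) (twin-length e)
      eq : ix j lt ≡ ix j lt′
      eq = ix-cong {j} lt lt′ d≡
        where
        ix-cong : ∀ {k : Fin s} {m n} (lt : m < p) (lt′ : n < p) → m ≡ n → ix k lt ≡ ix k lt′
        ix-cong {k} lt lt′ refl = ix-irr {k} lt lt′
  reach-link {x} {a} (cap {k} {y} {y′} m) = go , back′
    where
    w = proj₁ (proj₂ (capEnds m))
    r₁ = proj₁ (proj₂ (proj₂ (capEnds m)))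
    r₂ = proj₂ (proj₂ (proj₂ (capEnds m)))
    lt = proj₁ (cap-<p m)
    lt′ = proj₂ (cap-<p m)
    joined : w ~ x → Joined x (dg (ix k lt)) (dg (ix k lt′))
    joined l with cap-chord m
    ... | inj₁ (ch , o) = chord-joined ch o (subst (_~ x) (sym (place-lab {k} r₁ lt)) l) (subst (_~ x) (sym (place-lab {k} r₂ lt′)) l)
    ... | inj₂ (ch , o) = Joined-sym (chord-joined ch o (subst (_~ x) (sym (place-lab {k} r₂ lt′)) l) (subst (_~ x) (sym (place-lab {k} r₁ lt)) l))
    go : Reach x a (k , y) → Reach x a (k , y′)
    go (u , v , r , l , J) with at-func r r₁
    ... | refl = lt′ , w , r₂ , l , (J ◅◅ subst (λ v → Joined x (dg v) (dg (ix k lt′))) (ix-irr lt u) (joined l))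
    back′ : Reach x a (k , y′) → Reach x a (k , y)
    back′ (u , v , r , l , J) with at-func r r₂
    ... | refl = lt , w , r₁ , l , (J ◅◅ subst (λ v → Joined x (dg v) (dg (ix k lt))) (ix-irr lt′ u) (Joined-sym (joined l)))

  -- Connectivity is reduced to anchors: a corner, or a labelled place. One branch set cannot have
  -- both kinds, because by `known` the labels at places are not corners.
  data Root (x : Fin V) (a : U) : Set where
    corner : ∀ k → cor k ~ x → Joined x a (cv k) → Root x a
    place  : ∀ {k y w} (lt : d k + y < p) → labels (Y k) [ y ]= w → w ~ x → Joined x a (dg (ix k lt)) → Root x a

  -- Pads and their corner are consecutive on the outer cycle, so a pad reaches the corner step by
  -- step.
  pad-joined : ∀ {x} k n {a} → n ≤ d k → OU k [ n ]= a → st k ~ x → β x a × Joined x a (cv (stk k))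
  pad-joined k zero    le here l = l , ε
  pad-joined {x} k (suc n) {a} le q l with OC-at k (OC-pad n le)
    where
    OC-pad : ∀ n → suc n ≤ d k → OC k [ suc n ]= st k
    OC-pad n lt = there (at-++ˡ (subst (_[ n ]= st k) (sym (labels-FY k)) (at-replicate (d k) lt)))
  ... | a′ , q′ , βa′ with at-func q q′ | at-exists (OU k) (<-trans (n<1+n n) (at-< q))
  ... | refl | b , r = βa , (by-edge {x} βa (proj₁ ih) (A-sym (consecutive k r q)) ◅◅ proj₂ ih)
    where
    ih = pad-joined k n (≤-trans (n≤1+n n) le) r l
    βa = β-resp {a = a} l βa′

  border-root : ∀ {x} y → lab y ~ x → Root x (dg y)
  border-root {x} v l with as-ix v
  ... | k , y , lt , refl with y <? d k
  ... | yes y<d = corner (stk k) l′ (proj₂ (pad-joined k (suc y) y<d (there (at-++ˡ (DU-at k lt))) l′))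
    where
    l′ : st k ~ x
    l′ = subst (_~ x) (lab-ix {k} lt (subst (_[ y ]= st k) (sym (labels-FY k)) (at-replicate (d k) y<d))) l
  ... | no y≮d with at-++⁻ (replicate (d k) (st k)) (subst (_[ y ]= proj₁ (label-ix k lt)) (labels-FY k) (proj₂ (label-ix k lt)))
  ... | inj₁ q = ⊥-elim (y≮d (subst (y <_) (length-replicate (d k)) (at-< q)))
  ... | inj₂ (u , e , q) = found (trans e (cong (_+ u) (length-replicate (d k))))
    where
    found : y ≡ d k + u → Root x (dg (ix k lt))
    found refl = place {k = k} {u} lt q (subst (_~ x) (place-lab {k} q lt) l) ε

  root : ∀ {x} a → β x a → Root x a
  root (cv k)       l           = corner k l ε
  root {x} (gv i j le) (y , o , l) with border-root y l
  ... | corner k l′ J    = corner k l′ (hook i j le o l ◅◅ J)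
  ... | place lt q l′ J  = place lt q l′ (hook i j le o l ◅◅ J)

  not-both : ∀ {x k k′ y w} → cor k ~ x → labels (Y k′) [ y ]= w → w ~ x → ⊥
  not-both l q l′ = proj₂ (known q) (~-corner (Eq.transitive _ l (Eq.symmetric _ l′)) (_ , refl))

  joined : ∀ {x a b} → β x a → β x b → Joined x a b
  joined {x} {a} {b} βa βb with root a βa | root b βb
  ... | corner k l J     | corner k′ l′ J′ = J ◅◅ corner-joined l l′ ◅◅ Joined-sym J′
  ... | corner k l J     | place {k′} lt q l′ J′ = ⊥-elim (not-both {k′ = k′} l q l′)
  ... | place {k} lt q l J   | corner _ l′ J′ = ⊥-elim (not-both {k′ = k} l′ q l)
  ... | place {k} {y} {w} lt q l J | place {k′} {y′} {w′} lt′ q′ l′ J′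
      with closure-preserves (reach-link {x} {a}) (conn q q′ (Eq.transitive _ l (Eq.symmetric _ l′))) (lt , w , q , l , J)
  ... | lt″ , _ , _ , _ , J″ = subst (λ v → Joined x a (dg v)) (ix-irr lt″ lt′) J″ ◅◅ Joined-sym J′

  nonempty : ∀ {x} → x ∈ lw → Σ U (β x)
  nonempty {x} m with ∈-concat-tabulate⁻ (λ k → cor k ∷ orient (pos k) (reals (Y k))) (subst (x ∈_) (sym spelled) m)
  ... | k , here refl = cv k , ε
  ... | k , there q with ∈-at (∈-reals {xs = Y k} (∈-orient⁻ (pos k) q))
  ... | y , a = dg (ix k (place-< {k} a)) , β-dg {x} {ix k (place-< {k} a)} (subst (_~ x) (sym (place-lab {k} a (place-< {k} a))) ε)

  minor : (∀ x → x ∈ lw) → Chords → Minor (sewing (toBordered Π)) (sewing (𝕌 σ p))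
  minor all chords = record
    { β        = β
    ; β-resp   = λ {x} {y} {a} → β-resp {x} {y} {a}
    ; β-sat    = λ {x} → β-sat {x}
    ; nonempty = λ x → nonempty (all x)
    ; disjoint = λ {x} {y} {a} → disjoint {x} {y} {a}
    ; conn     = joined
    ; edges    = λ (x′ , y′ , ex , ey , a) _ →
        let u , v , βu , βv , e = adj-edge chords a in
        u , v , β-resp {a = u} (Eq.symmetric _ ex) βu , β-resp {a = v} (Eq.symmetric _ ey) βv , e
    }

theorem2 : (m n : ℕ) (Π : PolyEmb) → HasSize Π m n →
    PMinor (toBordered Π) (𝕌 (PolyEmb.σ Π) (m + 2 * n))
theorem2 m n Π (narrow , few-inner) = refl ,
  Model.minor Π (m + 2 * n) letters steps (state grown) fits links nocross all chords
  where
  open Plane Π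
  open Sides Π
  open Insertion Π using (state)
  open Unfold.Unfolding (Unfold.unfold Π)
  steps≤n : steps ≤ n
  steps≤n = +-cancelˡ-≤ L _ _ (≤-trans few few-inner)
  int≤m : ∀ k → int k ≤ m
  int≤m k = +-cancelˡ-≤ (suc (lo k)) _ _ (subst₂ _≤_ (hi≡ k) (+-suc (lo k) m) (narrow k))
  fits : ∀ k → length (Words.State.Y (state grown) k) ≤ m + 2 * n
  fits k = ≤-trans (Words.State.size (state grown) k) (+-mono-≤ (int≤m k) (*-monoʳ-≤ 2 steps≤n))
  chords : ∀ {x y} → Adj x y → ¬ Corner x → ¬ Corner y → Σ ℕ λ P → Σ ℕ λ Q → (P , Q) ∈ links × P < Q ×
           ((letters [ P ]= x × letters [ Q ]= y) ⊎ (letters [ P ]= y × letters [ Q ]= x))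
  chords a nx ny = edges a (λ e → nx (c₀-corner e)) (λ e → ny (c₀-corner e))
    where
    first-side : ∀ {n} → 2 ≤ n → Σ (Fin n) λ k → inject₁ k ≡ fzero
    first-side (s≤s _) = fzero , refl
    c₀-corner : ∀ {x} → x ≡ c₀ → Corner x
    c₀-corner e = let k , k≡0 = first-side (WFSig.len≥2 σ-ok) in
      k , trans e (sym (trans (cong (O ∘ q) k≡0) (cong O q-0)))
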